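{- As formal power series in $q$ (equivalently, as analytic functions for $|q|<1$), the following two identities hold: $$\sum_{n\ge1}\frac{q^n(q^{2n+1};q^2)_{\infty}}{(1-q^n)^2(q^{n+1};q)_{\infty}}=\frac{1}{(q^2;q^2)_{\infty}}\sum_{n\ge1}\frac{nq^n}{1-q^n}-\frac{1}{2}\sum_{n\ge1}N_2(n)q^{2n},$$ $$\sum_{n\ge1}\frac{q^{n(n+1)/2}(q^{2n+1};q^2)_{\infty}}{(1-q^n)^2(q^{n+1};q)_{\infty}}=\frac{1}{(q^2;q^2)_{\infty}}\sum_{n\ge1}\frac{nq^n}{1-q^n}-\frac{1}{2}\sum_{n\ge1}M_2(n)q^{2n}.$$
   Context: Notation: $(a;q)_n=(1-a)(1-aq)\cdots(1-aq^{n-1})$ and $(a;q)_\infty=\prod_{k\ge0}(1-aq^k)$. The rank of a partition is its largest part minus its number of parts; $N(m,n)$ is the number of partitions of $n$ with rank $m$, and $N_2(n)=\sum_{m\in\mathbb{Z}}m^2N(m,n)$. The crank counts $M(m,n)$ are defined by $\sum_{n\ge0}\sum_{m\in\mathbb{Z}}M(m,n)z^mq^n=\frac{(q;q)_\infty}{(zq;q)_\infty(q/z;q)_\infty}$ (for $n\ge2$, $M(m,n)$ is the number of partitions of $n$ with crank $m$), and $M_2(n)=\sum_{m\in\mathbb{Z}}m^2M(m,n)$. -}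

module Defs where

open import Data.Bool using (Bool; true; false; if_then_else_)
open import Data.Nat as ℕ using (ℕ; zero; suc; _∸_; _≡ᵇ_)
open import Data.Integer as ℤ using (ℤ; +_)
open import Data.Rational as ℚ using (ℚ; 0ℚ; 1ℚ; ½)
open import Data.List using (List; []; _∷_; length; concatMap; map; filter; replicate; _++_; upTo; foldr)
open import Relation.Nullary.Decidable using (does)

sumTo : ℕ → (ℕ → ℚ) → ℚ
sumTo zero    f = 0ℚ
sumTo (suc n) f = sumTo n f ℚ.+ f n

sumZ : ℕ → (ℤ → ℚ) → ℚ
sumZ n f = sumTo (suc (n ℕ.+ n)) (λ i → f ((+ i) ℤ.- (+ n)))

ℤtoℚ : ℤ → ℚ
ℤtoℚ z = z ℚ./ 1

ℕtoℚ : ℕ → ℚ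
ℕtoℚ n = (+ n) ℚ./ 1

-- Formal power series in q with rational coefficients: n ↦ [q^n]

Series : Set
Series = ℕ → ℚ

_⊕_ : Series → Series → Series
(f ⊕ g) n = f n ℚ.+ g n

_⊖_ : Series → Series → Series
(f ⊖ g) n = f n ℚ.- g n

scale : ℚ → Series → Series
scale c f n = c ℚ.* f n

_⊛_ : Series → Series → Series
(f ⊛ g) n = sumTo (suc n) (λ i → f i ℚ.* g (n ∸ i))

infixl 7 _⊛_
infixl 6 _⊕_ _⊖_

mono : ℕ → Series
mono k n = if k ≡ᵇ n then 1ℚ else 0ℚ

one : Series
one = mono 0

-- Infinite sum Σ_{a ≥ 0} T a, for a family with T a = O(q^a):
-- its q^n coefficient is that of the finite partial sum over a ≤ n.
infSum : (ℕ → Series) → Series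
infSum T n = sumTo (suc n) (λ a → T a n)

prodTo : ℕ → (ℕ → Series) → Series
prodTo zero    F = one
prodTo (suc k) F = prodTo k F ⊛ F k

-- Infinite product Π_{k ≥ 0} F k, for factors with F k = 1 + O(q^(k+1)):
-- its q^n coefficient is that of the finite partial product over k ≤ n.
infProd : (ℕ → Series) → Series
infProd F n = prodTo (suc n) F n

-- 1/(1 - q^k) = Σ_{a ≥ 0} q^(k a)   (used only for k ≥ 1)
geom : ℕ → Series
geom k = infSum (λ a → mono (k ℕ.* a))

-- (q^a ; q^d)_∞ = Π_{k≥0} (1 - q^(a + d k))   (used only for a, d ≥ 1)
poch∞ : ℕ → ℕ → Series
poch∞ a d = infProd (λ k → one ⊖ mono (a ℕ.+ d ℕ.* k))

-- 1/(q^a ; q^d)_∞ = Π_{k≥0} 1/(1 - q^(a + d k))   (used only for a, d ≥ 1)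
invPoch∞ : ℕ → ℕ → Series
invPoch∞ a d = infProd (λ k → geom (a ℕ.+ d ℕ.* k))

-- Partitions (as non-increasing lists of positive parts) and the rank

partsLE : ℕ → ℕ → List (List ℕ)
partsLE zero    n = if n ≡ᵇ 0 then ([] ∷ []) else []
partsLE (suc k) n =
  concatMap (λ j → map (replicate j (suc k) ++_) (partsLE k (n ∸ j ℕ.* suc k)))
            (filter (λ j → j ℕ.* suc k ℕ.≤? n) (upTo (suc n)))

partitions : ℕ → List (List ℕ)
partitions n = partsLE n n

largestPart : List ℕ → ℕ
largestPart []      = 0
largestPart (x ∷ _) = x

rank : List ℕ → ℤ
rank λp = (+ largestPart λp) ℤ.- (+ length λp)

Nrank : ℤ → ℕ → ℕ
Nrank m n = length (filter (λ λp → rank λp ℤ.≟ m) (partitions n))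

-- N_2(n) = Σ_m m^2 N(m,n)  (ranks of partitions of n lie in [-n, n])
N₂ : ℕ → ℚ
N₂ n = sumZ n (λ m → ℤtoℚ (m ℤ.* m) ℚ.* ℕtoℚ (Nrank m n))

-- Bivariate series: n ↦ m ↦ [z^m q^n], Laurent in z.
-- At each q^n all series used here have z-support in [-n, n], so the
-- z-convolution in the product can be restricted to that range.

BSeries : Set
BSeries = ℕ → ℤ → ℚ

_⊛ᵇ_ : BSeries → BSeries → BSeries
(f ⊛ᵇ g) n m = sumTo (suc n) (λ i → sumZ i (λ j → f i j ℚ.* g (n ∸ i) (m ℤ.- j)))

bmono : ℤ → ℕ → BSeries
bmono a k n m = if (k ≡ᵇ n) then (if does (a ℤ.≟ m) then 1ℚ else 0ℚ) else 0ℚ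

bone : BSeries
bone = bmono (+ 0) 0

lift : Series → BSeries
lift f n m = if does (m ℤ.≟ + 0) then f n else 0ℚ

bInfSum : (ℕ → BSeries) → BSeries
bInfSum T n m = sumTo (suc n) (λ a → T a n m)

bProdTo : ℕ → (ℕ → BSeries) → BSeries
bProdTo zero    F = bone
bProdTo (suc k) F = bProdTo k F ⊛ᵇ F k

bInfProd : (ℕ → BSeries) → BSeries
bInfProd F n m = bProdTo (suc n) F n m

-- 1/(1 - z q^k) = Σ_a z^a q^(k a)      (k ≥ 1)
geomZ : ℕ → BSeries
geomZ k = bInfSum (λ a → bmono (+ a) (k ℕ.* a))

-- 1/(1 - z⁻¹ q^k) = Σ_b z^(-b) q^(k b)  (k ≥ 1)
geomZ⁻ : ℕ → BSeries
geomZ⁻ k = bInfSum (λ b → bmono (ℤ.- (+ b)) (k ℕ.* b))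

crankGF : BSeries
crankGF = lift (poch∞ 1 1) ⊛ᵇ bInfProd (λ k → geomZ (suc k) ⊛ᵇ geomZ⁻ (suc k))

Mcrank : ℤ → ℕ → ℚ
Mcrank m n = crankGF n m

-- M_2(n) = Σ_m m^2 M(m,n)  (z-support at q^n lies in [-n, n])
M₂ : ℕ → ℚ
M₂ n = sumZ n (λ m → ℤtoℚ (m ℤ.* m) ℚ.* Mcrank m n)

sigmaSeries : Series
sigmaSeries = infSum (λ a → scale (ℕtoℚ (suc a)) (mono (suc a) ⊛ geom (suc a)))

lhs₁ : Series
lhs₁ = infSum (λ a → let n = suc a in
  mono n ⊛ poch∞ (suc (2 ℕ.* n)) 2 ⊛ geom n ⊛ geom n ⊛ invPoch∞ (suc n) 1)

lhs₂ : Series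
lhs₂ = infSum (λ a → let n = suc a in
  mono (n ℕ.* suc n ℕ./ 2) ⊛ poch∞ (suc (2 ℕ.* n)) 2 ⊛ geom n ⊛ geom n ⊛ invPoch∞ (suc n) 1)

rhs₁ : Series
rhs₁ = invPoch∞ 2 2 ⊛ sigmaSeries
       ⊖ scale ½ (infSum (λ a → scale (N₂ (suc a)) (mono (2 ℕ.* suc a))))

rhs₂ : Series
rhs₂ = invPoch∞ 2 2 ⊛ sigmaSeries
       ⊖ scale ½ (infSum (λ a → scale (M₂ (suc a)) (mono (2 ℕ.* suc a))))

{-# OPTIONS --safe #-}
-- Modulo q^N every sum and product is finite, so all q-series identities are proved in an arbitrary
-- commutative ring with a nilpotent element q. Since (q^(2n+1);q²)_∞/(q^(n+1);q)_∞ equals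
-- (q)_n/((q;q²)_n (q²;q²)_∞), with δ_n = (q)_(n-1)² q^n/(q;q²)_n the left-hand sides times (q²;q²)_∞ are
--   Σ δ_n/(q)_n   and   Σ δ_n A_n,   where A_m = q^(m(m-1)/2)/(q)_m.
-- Comparing coefficients in (-z;q)_∞/(z²;q²)_∞ = 1/(z;q)_∞ gives 1/(q)_n = Σ_j A_(n-2j)/(q²;q²)_j, so the first
-- sum is Σ_j X_j/(q²;q²)_j with X_j = Σ_m δ_(m+2j) A_m, while the second is X_0. The q-analogue of Gauss's
-- second theorem evaluates X_j = q^(2j) (q²;q²)_(j-1)² for j ≥ 1, and its second-order term at a = b = 1
-- (one order being taken with dual numbers) gives X_0 = Σ_(k odd) q^k/(1-q^k)². Put g(q) = Σ q^n/(1-q^n)² and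
-- T(q) = Σ (q)_(n-1) q^n/(1-q^n); then X_0 = g(q) - g(q²) and Σ_(j≥1) X_j/(q²;q²)_j = T(q²).
-- Summing (largest part - number of parts)² over partitions by largest part gives
-- ½ Σ N₂(n) q^n = (g(q) - T(q))/(q)_∞, and the z-moments of the crank product give
-- ½ Σ M₂(n) q^n = g(q)/(q)_∞; both are used at q².
module Submission where

open import Defs
open import Level using (0ℓ)
open import Algebra using (CommutativeRing; RawRing)
open import Data.Bool using (true; false; if_then_else_)
open import Data.Nat as ℕ using (ℕ; zero; suc; _∸_; z≤n; s≤s; _<_; _≤_)
import Data.Nat.Coprimality as ℕ
import Data.Nat.DivMod as ℕ
import Data.Nat.Properties as ℕ
open import Data.Integer as ℤ using (ℤ; +_; -[1+_])
import Data.Integer.Properties as ℤ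
open import Data.Rational as ℚ using (ℚ; mkℚ; 0ℚ; 1ℚ; ½)
import Data.Rational.Properties as ℚ
open import Data.List
  using (List; []; _∷_; _++_; map; concatMap; filter; length; replicate; applyUpTo; upTo)
open import Data.List.Properties using (length-++; length-replicate)
open import Data.List.Relation.Unary.All as All using (All; []; _∷_)
open import Data.List.Relation.Unary.All.Properties using (concat⁺; map⁺; all-filter)
open import Data.Maybe using (Maybe; just; nothing)
open import Data.Product using (_×_; _,_; proj₁; proj₂; ∃)
open import Relation.Nullary using (¬_; yes; no; contradiction)
open import Relation.Nullary.Decidable using (does; dec-false; dec-true)
open import Relation.Unary using (Pred; Decidable)
open import Relation.Binary.PropositionalEquality as ≡ using (_≡_; _≢_)
import Relation.Binary.Reasoning.Setoid
import Algebra.Properties.CommutativeSemiring.Exp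
import Algebra.Properties.Ring
import Algebra.Properties.Semiring.Exp
import Algebra.Properties.Semiring.Mult.TCOptimised
import Algebra.Solver.Ring
open import Algebra.Solver.Ring.AlmostCommutativeRing
  using (fromCommutativeRing; _-Raw-AlmostCommutative⟶_)

-- Gauss's series does not apply to the terms δ_n/(q)_n of the first sum, because the factor
-- q^(m(m-1)/2) is missing. Expanding through A_m restores that factor at the price of shifts by 2j,
-- and even shifts are the ones within reach: Gauss's theorem enters through its contiguous relation
-- (1-abq) S(a,b) = (1-aq) S(aq²,b), which moves a by q² and is proved by telescoping. Started from
-- S(1,b) = 1, it yields the diagonal values S(q^(2i),q^(2i)); iterated down to a = 0 at b = 1, it
-- yields the first-order term. At a = b = 1 the quantity wanted is the coefficient of (1-a)(1-b),
-- and 1-a cannot be cancelled where it is zero. Since the ring is arbitrary, the identity can be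
-- read over the dual numbers at a = 1 + ε, whose ε-component performs the cancellation. The same
-- generality lets the lemmas for q be reused for q² inside one ring, and lets the generating
-- functions of N₂ and M₂ be evaluated at q².

-- A ring solver with integer coefficients over any commutative ring

module IntegerSolver (R : CommutativeRing 0ℓ 0ℓ) where
  open CommutativeRing R
  open Algebra.Properties.Ring ring
  open Algebra.Properties.Semiring.Mult.TCOptimised semiring
    using (×-homo-+; ×1-homo-*) renaming (_×_ to _·_)
  open Relation.Binary.Reasoning.Setoid setoid

  ⟦_⟧ℤ : ℤ → Carrier
  ⟦ + n ⟧ℤ      = n · 1#
  ⟦ -[1+ n ] ⟧ℤ = - (suc n · 1#)

  ⟦⊖⟧ : ∀ m n → ⟦ m ℤ.⊖ n ⟧ℤ ≈ m · 1# - n · 1#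
  ⟦⊖⟧ m zero = sym (trans (+-congˡ -0#≈0#) (+-identityʳ _))
  ⟦⊖⟧ zero (suc n) = sym (+-identityˡ _)
  ⟦⊖⟧ (suc m) (suc n) rewrite ℤ.[1+m]⊖[1+n]≡m⊖n m n = begin
    ⟦ m ℤ.⊖ n ⟧ℤ                       ≈⟨ ⟦⊖⟧ m n ⟩
    m · 1# - n · 1#                    ≈⟨ +-congʳ (+-identityʳ _) ⟨
    m · 1# + 0# - n · 1#               ≈⟨ +-congʳ (+-congˡ (-‿inverseʳ 1#)) ⟨
    m · 1# + (1# - 1#) - n · 1#        ≈⟨ +-congʳ (+-assoc _ _ _) ⟨
    m · 1# + 1# - 1# - n · 1#          ≈⟨ +-assoc _ _ _ ⟩
    m · 1# + 1# + (- 1# - n · 1#)      ≈⟨ +-congʳ (+-comm _ _) ⟩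
    1# + m · 1# + (- 1# - n · 1#)      ≈⟨ +-cong (×-homo-+ 1# 1 m) (sym (-‿+-comm 1# (n · 1#))) ⟨
    suc m · 1# + - (1# + n · 1#)       ≈⟨ +-congˡ (-‿cong (×-homo-+ 1# 1 n)) ⟨
    suc m · 1# - suc n · 1#            ∎

  ⟦-⟧ : ∀ i → ⟦ ℤ.- i ⟧ℤ ≈ - ⟦ i ⟧ℤ
  ⟦-⟧ (+ zero)  = sym -0#≈0#
  ⟦-⟧ (+ suc n) = refl
  ⟦-⟧ -[1+ n ]  = sym (-‿involutive _)

  ⟦+⟧ : ∀ i j → ⟦ i ℤ.+ j ⟧ℤ ≈ ⟦ i ⟧ℤ + ⟦ j ⟧ℤ
  ⟦+⟧ (+ m)    (+ n)    = ×-homo-+ 1# m n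
  ⟦+⟧ (+ m)    -[1+ n ] = ⟦⊖⟧ m (suc n)
  ⟦+⟧ -[1+ m ] (+ n)    = trans (⟦⊖⟧ n (suc m)) (+-comm _ _)
  ⟦+⟧ -[1+ m ] -[1+ n ] = begin
    - (suc (suc (m ℕ.+ n)) · 1#)     ≡⟨ ≡.cong (λ k → - (k · 1#)) (≡.cong suc (ℕ.+-suc m n)) ⟨
    - ((suc m ℕ.+ suc n) · 1#)       ≈⟨ -‿cong (×-homo-+ 1# (suc m) (suc n)) ⟩
    - (suc m · 1# + suc n · 1#)      ≈⟨ -‿+-comm _ _ ⟨
    - (suc m · 1#) + - (suc n · 1#)  ∎

  ⟦*+⟧ : ∀ i n → ⟦ i ℤ.* + n ⟧ℤ ≈ ⟦ i ⟧ℤ * n · 1#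
  ⟦*+⟧ (+ m) n rewrite ≡.sym (ℤ.pos-* m n) = ×1-homo-* m n
  ⟦*+⟧ -[1+ m ] n rewrite ≡.sym (ℤ.neg-distribˡ-* (+ suc m) (+ n)) | ≡.sym (ℤ.pos-* (suc m) n) = begin
    ⟦ ℤ.- (+ (suc m ℕ.* n)) ⟧ℤ  ≈⟨ ⟦-⟧ (+ (suc m ℕ.* n)) ⟩
    - ((suc m ℕ.* n) · 1#)      ≈⟨ -‿cong (×1-homo-* (suc m) n) ⟩
    - (suc m · 1# * n · 1#)     ≈⟨ -‿distribˡ-* _ _ ⟩
    - (suc m · 1#) * n · 1#     ∎

  ⟦*⟧ : ∀ i j → ⟦ i ℤ.* j ⟧ℤ ≈ ⟦ i ⟧ℤ * ⟦ j ⟧ℤ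
  ⟦*⟧ i (+ n) = ⟦*+⟧ i n
  ⟦*⟧ i -[1+ n ] rewrite ≡.sym (ℤ.neg-distribʳ-* i (+ suc n)) = begin
    ⟦ ℤ.- (i ℤ.* + suc n) ⟧ℤ  ≈⟨ ⟦-⟧ (i ℤ.* + suc n) ⟩
    - ⟦ i ℤ.* + suc n ⟧ℤ      ≈⟨ -‿cong (⟦*+⟧ i (suc n)) ⟩
    - (⟦ i ⟧ℤ * suc n · 1#)   ≈⟨ -‿distribʳ-* _ _ ⟩
    ⟦ i ⟧ℤ * - (suc n · 1#)   ∎

  ℤ-rawRing : RawRing 0ℓ 0ℓ
  ℤ-rawRing = record
    { Carrier = ℤ ; _≈_ = _≡_ ; _+_ = ℤ._+_ ; _*_ = ℤ._*_ ; -_ = ℤ.-_ ; 0# = + 0 ; 1# = + 1 }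

  homomorphism : ℤ-rawRing -Raw-AlmostCommutative⟶ fromCommutativeRing R
  homomorphism = record
    { ⟦_⟧ = ⟦_⟧ℤ ; +-homo = ⟦+⟧ ; *-homo = ⟦*⟧ ; -‿homo = ⟦-⟧ ; 0-homo = refl ; 1-homo = refl }

  _≟ℤ_ : ∀ i j → Maybe (⟦ i ⟧ℤ ≈ ⟦ j ⟧ℤ)
  i ≟ℤ j with i ℤ.≟ j
  ... | yes ≡.refl = just refl
  ... | no  _      = nothing

  open Algebra.Solver.Ring ℤ-rawRing (fromCommutativeRing R) homomorphism _≟ℤ_ public
    using (solve; _:=_; _:+_; _:*_; _:-_; con)

-- Finite sums and products in a commutative ring

-- Two successors at a time, so that sums, products and shifts over even indices unfold by
-- computation.
double : ℕ → ℕ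
double zero    = zero
double (suc n) = suc (suc (double n))

double≡+ : ∀ n → double n ≡ n ℕ.+ n
double≡+ zero    = ≡.refl
double≡+ (suc n) = ≡.cong suc (≡.trans (≡.cong suc (double≡+ n)) (≡.sym (ℕ.+-suc n n)))

module FiniteSums (R : CommutativeRing 0ℓ 0ℓ) where
  open CommutativeRing R public hiding (zero)
  open Algebra.Properties.Ring ring public using (-0#≈0#)
  open Algebra.Properties.Semiring.Exp semiring public
    using (_^_; ^-homo-*; ^-assocʳ; ^-congˡ)
  open Algebra.Properties.CommutativeSemiring.Exp commutativeSemiring public
    using (^-distrib-*)
  open IntegerSolver R public using (solve; _:=_; _:+_; _:*_; _:-_; con)
  open Relation.Binary.Reasoning.Setoid setoid public

  Σ< : ℕ → (ℕ → Carrier) → Carrier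
  Σ< zero    f = 0#
  Σ< (suc n) f = Σ< n f + f n

  Π< : ℕ → (ℕ → Carrier) → Carrier
  Π< zero    f = 1#
  Π< (suc n) f = Π< n f * f n

  -- The image of n in the ring. `ν (suc k)` unfolds to `ν k + 1#`, which the solver treats as a
  -- polynomial in `ν k`.
  ν : ℕ → Carrier
  ν zero    = 0#
  ν (suc n) = ν n + 1#

  ≡⇒≈ : ∀ {x y} → x ≡ y → x ≈ y
  ≡⇒≈ = reflexive

  x*0≈0 : ∀ {x y} → y ≈ 0# → x * y ≈ 0#
  x*0≈0 y≈0 = trans (*-congˡ y≈0) (zeroʳ _)

  0*y≈0 : ∀ {x y} → x ≈ 0# → x * y ≈ 0#
  0*y≈0 x≈0 = trans (*-congʳ x≈0) (zeroˡ _)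

  +-elimʳ : ∀ {x y} → y ≈ 0# → x + y ≈ x
  +-elimʳ y≈0 = trans (+-congˡ y≈0) (+-identityʳ _)

  1-0≈1 : ∀ {x} → x ≈ 0# → 1# - x ≈ 1#
  1-0≈1 x≈0 = trans (+-congˡ (trans (-‿cong x≈0) -0#≈0#)) (+-identityʳ _)

  1-cong : ∀ {x y} → x ≈ y → 1# - x ≈ 1# - y
  1-cong x≈y = +-congˡ (-‿cong x≈y)

  x-y≈0⇒x≈y : ∀ {x y} → x - y ≈ 0# → x ≈ y
  x-y≈0⇒x≈y {x} {y} eq = begin
    x          ≈⟨ solve 2 (λ x y → x := (x :- y) :+ y) refl x y ⟩
    x - y + y  ≈⟨ +-congʳ eq ⟩
    0# + y     ≈⟨ +-identityˡ y ⟩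
    y          ∎

  Σ-cong< : ∀ n {f g : ℕ → Carrier} → (∀ i → i < n → f i ≈ g i) → Σ< n f ≈ Σ< n g
  Σ-cong< zero    eq = refl
  Σ-cong< (suc n) eq = +-cong (Σ-cong< n (λ i i<n → eq i (ℕ.m<n⇒m<1+n i<n))) (eq n ℕ.≤-refl)

  Σ-cong : ∀ n {f g : ℕ → Carrier} → (∀ i → f i ≈ g i) → Σ< n f ≈ Σ< n g
  Σ-cong n eq = Σ-cong< n (λ i _ → eq i)

  Σ-zero : ∀ n {f : ℕ → Carrier} → (∀ i → i < n → f i ≈ 0#) → Σ< n f ≈ 0#
  Σ-zero zero    eq = refl
  Σ-zero (suc n) eq =
    trans (+-elimʳ (eq n ℕ.≤-refl)) (Σ-zero n (λ i i<n → eq i (ℕ.m<n⇒m<1+n i<n)))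

  Σ-+ : ∀ n f g → Σ< n (λ i → f i + g i) ≈ Σ< n f + Σ< n g
  Σ-+ zero    f g = sym (+-identityˡ 0#)
  Σ-+ (suc n) f g = begin
    Σ< n (λ i → f i + g i) + (f n + g n)  ≈⟨ +-congʳ (Σ-+ n f g) ⟩
    Σ< n f + Σ< n g + (f n + g n)
      ≈⟨ solve 4 (λ a b c d → (a :+ b) :+ (c :+ d) := (a :+ c) :+ (b :+ d)) refl _ _ _ _ ⟩
    Σ< n f + f n + (Σ< n g + g n)         ∎

  Σ-*ˡ : ∀ n c f → Σ< n (λ i → c * f i) ≈ c * Σ< n f
  Σ-*ˡ zero    c f = sym (zeroʳ c)
  Σ-*ˡ (suc n) c f = trans (+-congʳ (Σ-*ˡ n c f)) (sym (distribˡ c _ _))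

  Σ-*ʳ : ∀ n c f → Σ< n (λ i → f i * c) ≈ Σ< n f * c
  Σ-*ʳ n c f = trans (Σ-cong n (λ i → *-comm (f i) c)) (trans (Σ-*ˡ n c f) (*-comm c _))

  Σ-minus : ∀ n f g → Σ< n (λ i → f i - g i) ≈ Σ< n f - Σ< n g
  Σ-minus zero    f g = sym (-‿inverseʳ 0#)
  Σ-minus (suc n) f g = begin
    Σ< n (λ i → f i - g i) + (f n - g n)  ≈⟨ +-congʳ (Σ-minus n f g) ⟩
    Σ< n f - Σ< n g + (f n - g n)
      ≈⟨ solve 4 (λ a b c d → (a :- b) :+ (c :- d) := (a :+ c) :- (b :+ d)) refl _ _ _ _ ⟩
    Σ< n f + f n - (Σ< n g + g n)         ∎

  Σ-head : ∀ n f → Σ< (suc n) f ≈ f 0 + Σ< n (λ i → f (suc i))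
  Σ-head zero    f = +-comm 0# (f 0)
  Σ-head (suc n) f = trans (+-congʳ (Σ-head n f)) (+-assoc _ _ _)

  -- The tail keeps the full range n at the cost of a vanishing term `f n`. In use n is the
  -- precision N, and `f N` contains an N-th power of a nilpotent element.
  Σ-shift : ∀ n f → f n ≈ 0# → Σ< n f ≈ f 0 + Σ< n (λ i → f (suc i))
  Σ-shift n f fn≈0 = trans (sym (+-elimʳ fn≈0)) (Σ-head n f)

  Σ-only-head : ∀ n f → (∀ i → i < n → f (suc i) ≈ 0#) → Σ< (suc n) f ≈ f 0
  Σ-only-head n f eq = trans (Σ-head n f) (+-elimʳ (Σ-zero n eq))

  Σ-extend : ∀ d n f → (∀ i → n ≤ i → f i ≈ 0#) → Σ< (d ℕ.+ n) f ≈ Σ< n f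
  Σ-extend zero    n f eq = refl
  Σ-extend (suc d) n f eq = trans (+-elimʳ (eq (d ℕ.+ n) (ℕ.m≤n+m n d))) (Σ-extend d n f eq)

  Σ-split : ∀ m n f → Σ< (m ℕ.+ n) f ≈ Σ< m f + Σ< n (λ i → f (m ℕ.+ i))
  Σ-split m zero    f rewrite ℕ.+-identityʳ m = sym (+-identityʳ _)
  Σ-split m (suc n) f rewrite ℕ.+-suc m n = trans (+-congʳ (Σ-split m n f)) (+-assoc _ _ _)

  Σ-window : ∀ a k b f → (∀ i → i < a → f i ≈ 0#) → (∀ i → a ℕ.+ k ≤ i → f i ≈ 0#) →
             Σ< (a ℕ.+ (k ℕ.+ b)) f ≈ Σ< k (λ i → f (a ℕ.+ i))
  Σ-window a k b f below above = begin
    Σ< (a ℕ.+ (k ℕ.+ b)) f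
      ≈⟨ Σ-split a (k ℕ.+ b) f ⟩
    Σ< a f + Σ< (k ℕ.+ b) (λ i → f (a ℕ.+ i))
      ≈⟨ trans (+-congʳ (Σ-zero a below)) (+-identityˡ _) ⟩
    Σ< (k ℕ.+ b) (λ i → f (a ℕ.+ i))
      ≈⟨ Σ-split k b _ ⟩
    Σ< k (λ i → f (a ℕ.+ i)) + Σ< b (λ i → f (a ℕ.+ (k ℕ.+ i)))
      ≈⟨ +-elimʳ (Σ-zero b (λ i _ → above _ (ℕ.+-monoʳ-≤ a (ℕ.m≤m+n k i)))) ⟩
    Σ< k (λ i → f (a ℕ.+ i))  ∎

  Σ-single : ∀ k {t} f → t < k → (∀ i → i ≢ t → f i ≈ 0#) → Σ< k f ≈ f t
  Σ-single (suc k) {t} f t<sk eq with t ℕ.≟ k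
  ... | yes ≡.refl = trans (+-congʳ (Σ-zero t (λ i i<t → eq i (ℕ.<⇒≢ i<t)))) (+-identityˡ _)
  ... | no t≢k     = trans (+-elimʳ (eq k (λ k≡t → t≢k (≡.sym k≡t))))
                           (Σ-single k f (ℕ.≤∧≢⇒< (ℕ.s≤s⁻¹ t<sk) t≢k) eq)

  Σ-swap : ∀ m n (f : ℕ → ℕ → Carrier) →
           Σ< m (λ i → Σ< n (f i)) ≈ Σ< n (λ j → Σ< m (λ i → f i j))
  Σ-swap zero    n f = sym (Σ-zero n (λ _ _ → refl))
  Σ-swap (suc m) n f = trans (+-congʳ (Σ-swap m n f)) (sym (Σ-+ n _ _))

  Σ-double : ∀ n f → Σ< (double n) f ≈ Σ< n (λ i → f (double i)) + Σ< n (λ i → f (suc (double i)))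
  Σ-double zero    f = sym (+-identityˡ 0#)
  Σ-double (suc n) f = trans (+-congʳ (+-congʳ (Σ-double n f)))
    (solve 4 (λ a b c d → ((a :+ b) :+ c) :+ d := (a :+ c) :+ (b :+ d)) refl _ _ _ _)

  Σ-telescope : ∀ n (f g : ℕ → Carrier) → (∀ i → f i + g i ≈ g (suc i)) → Σ< n f + g 0 ≈ g n
  Σ-telescope zero    f g eq = +-identityˡ _
  Σ-telescope (suc n) f g eq = begin
    Σ< n f + f n + g 0    ≈⟨ solve 3 (λ a b c → (a :+ b) :+ c := b :+ (a :+ c)) refl _ _ _ ⟩
    f n + (Σ< n f + g 0)  ≈⟨ +-congˡ (Σ-telescope n f g eq) ⟩
    f n + g n             ≈⟨ eq n ⟩
    g (suc n)             ∎

  Π-cong : ∀ n {f g : ℕ → Carrier} → (∀ i → f i ≈ g i) → Π< n f ≈ Π< n g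
  Π-cong zero    eq = refl
  Π-cong (suc n) eq = *-cong (Π-cong n eq) (eq n)

  Π-* : ∀ n f g → Π< n (λ i → f i * g i) ≈ Π< n f * Π< n g
  Π-* zero    f g = sym (*-identityˡ 1#)
  Π-* (suc n) f g = trans (*-congʳ (Π-* n f g))
    (solve 4 (λ a b c d → (a :* b) :* (c :* d) := (a :* c) :* (b :* d)) refl _ _ _ _)

  Π-one : ∀ n {f : ℕ → Carrier} → (∀ i → f i ≈ 1#) → Π< n f ≈ 1#
  Π-one zero    eq = refl
  Π-one (suc n) eq = trans (*-cong (Π-one n eq) (eq n)) (*-identityˡ 1#)

  Π-inverse : ∀ n (f g : ℕ → Carrier) → (∀ i → f i * g i ≈ 1#) → Π< n f * Π< n g ≈ 1#
  Π-inverse n f g eq = trans (sym (Π-* n f g)) (Π-one n eq)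

  Π-split : ∀ m n f → Π< (m ℕ.+ n) f ≈ Π< m f * Π< n (λ i → f (m ℕ.+ i))
  Π-split m zero    f rewrite ℕ.+-identityʳ m = sym (*-identityʳ _)
  Π-split m (suc n) f rewrite ℕ.+-suc m n = trans (*-congʳ (Π-split m n f)) (*-assoc _ _ _)

  Π-extend : ∀ d n f → (∀ i → n ≤ i → f i ≈ 1#) → Π< (d ℕ.+ n) f ≈ Π< n f
  Π-extend zero    n f eq = refl
  Π-extend (suc d) n f eq =
    trans (trans (*-congˡ (eq (d ℕ.+ n) (ℕ.m≤n+m n d))) (*-identityʳ _)) (Π-extend d n f eq)

  Π-double : ∀ n f → Π< (double n) f ≈ Π< n (λ i → f (double i)) * Π< n (λ i → f (suc (double i)))
  Π-double zero    f = sym (*-identityˡ 1#)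
  Π-double (suc n) f = trans (*-congʳ (*-congʳ (Π-double n f)))
    (solve 4 (λ a b c d → ((a :* b) :* c) :* d := (a :* c) :* (b :* d)) refl _ _ _ _)

  -- The rings have zero divisors, q among them, so cancellation always goes through an explicit
  -- inverse.
  cancel-unit : ∀ {u v x y} → u * v ≈ 1# → u * x ≈ u * y → x ≈ y
  cancel-unit {u} {v} {x} {y} uv≈1 ux≈uy = begin
    x            ≈⟨ *-identityˡ x ⟨
    1# * x       ≈⟨ *-congʳ uv≈1 ⟨
    u * v * x    ≈⟨ solve 3 (λ u v x → (u :* v) :* x := v :* (u :* x)) refl u v x ⟩
    v * (u * x)  ≈⟨ *-congˡ ux≈uy ⟩
    v * (u * y)  ≈⟨ solve 3 (λ u v x → (u :* v) :* x := v :* (u :* x)) refl u v y ⟨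
    u * v * y    ≈⟨ *-congʳ uv≈1 ⟩
    1# * y       ≈⟨ *-identityˡ y ⟩
    y            ∎

  inverse-unique : ∀ {u v w} → u * v ≈ 1# → u * w ≈ 1# → v ≈ w
  inverse-unique uv uw = cancel-unit uv (trans uv (sym uw))

-- Geometric series of a nilpotent element

module Nilpotent (R : CommutativeRing 0ℓ 0ℓ) (q : CommutativeRing.Carrier R) (n : ℕ)
                 (q^N≈0 : CommutativeRing._≈_ R (FiniteSums._^_ R q (suc n)) (CommutativeRing.0# R))
                 where
  open FiniteSums R

  -- The precision is a successor, so every sum over i < N contains its term at 0.
  N : ℕ
  N = suc n

  q^-vanish : ∀ {k} → N ≤ k → q ^ k ≈ 0#
  q^-vanish {k} N≤k = begin
    q ^ k                  ≡⟨ ≡.cong (q ^_) (ℕ.m+[n∸m]≡n N≤k) ⟨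
    q ^ (N ℕ.+ (k ℕ.∸ N))  ≈⟨ ^-homo-* q N (k ℕ.∸ N) ⟩
    q ^ N * q ^ (k ℕ.∸ N)  ≈⟨ 0*y≈0 q^N≈0 ⟩
    0#                     ∎

  -- This is 1/(1-qy). The factor q is built in because it makes qy nilpotent for every y, so the
  -- geometric series is finite.
  inv : Carrier → Carrier
  inv y = Σ< N (λ i → (q * y) ^ i)

  [q*y]^N≈0 : ∀ y → (q * y) ^ N ≈ 0#
  [q*y]^N≈0 y = trans (^-distrib-* q y N) (0*y≈0 q^N≈0)

  inv-law : ∀ y → (1# - q * y) * inv y ≈ 1#
  inv-law y = begin
    (1# - x) * inv y          ≈⟨ solve 2 (λ x s → (con (+ 1) :- x) :* s := s :- x :* s) refl x (inv y) ⟩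
    inv y - x * inv y         ≈⟨ +-congˡ (-‿cong (Σ-*ˡ N x (x ^_))) ⟨
    inv y - Σ< N (λ i → x ^ suc i)
      ≈⟨ +-congʳ (Σ-shift N (x ^_) ([q*y]^N≈0 y)) ⟩
    1# + Σ< N (λ i → x ^ suc i) - Σ< N (λ i → x ^ suc i)
      ≈⟨ solve 1 (λ s → (con (+ 1) :+ s) :- s := con (+ 1)) refl _ ⟩
    1#                        ∎
    where x = q * y

  inv-cong : ∀ {x y} → x ≈ y → inv x ≈ inv y
  inv-cong eq = Σ-cong N (λ i → ^-congˡ i (*-congˡ eq))

  inv-step : ∀ y → inv y ≈ 1# + q * y * inv y
  inv-step y = begin
    inv y  ≈⟨ solve 2 (λ x v → v := (con (+ 1) :- x) :* v :+ x :* v) refl (q * y) (inv y) ⟩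
    (1# - q * y) * inv y + q * y * inv y  ≈⟨ +-congʳ (inv-law y) ⟩
    1# + q * y * inv y  ∎

  -- This is Σ j x^j = x/(1-x)². Shifting the index gives D = x(D + G), with G the geometric sum,
  -- and the unit 1-x is then cancelled.
  Σνx : ∀ y → Σ< N (λ j → ν j * (q * y) ^ j) ≈ inv y * (q * y * inv y)
  Σνx y = cancel-unit (inv-law y) (begin
    (1# - x) * D         ≈⟨ solve 2 (λ x d → (con (+ 1) :- x) :* d := d :- x :* d) refl x D ⟩
    D - x * D            ≈⟨ +-congʳ D≈ ⟩
    x * (D + G) - x * D  ≈⟨ solve 3 (λ x d g → x :* (d :+ g) :- x :* d := con (+ 1) :* (x :* g)) refl x D G ⟩
    1# * (x * G)         ≈⟨ *-congʳ (inv-law y) ⟨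
    (1# - x) * G * (x * G)    ≈⟨ *-assoc _ _ _ ⟩
    (1# - x) * (G * (x * G))  ∎)
    where
    x = q * y
    G = inv y
    D = Σ< N (λ j → ν j * x ^ j)
    D≈ : D ≈ x * (D + G)
    D≈ = begin
      D  ≈⟨ Σ-shift N _ (x*0≈0 ([q*y]^N≈0 y)) ⟩
      0# * 1# + Σ< N (λ j → (ν j + 1#) * (x * x ^ j))
        ≈⟨ trans (+-congʳ (zeroˡ _)) (+-identityˡ _) ⟩
      Σ< N (λ j → (ν j + 1#) * (x * x ^ j))
        ≈⟨ Σ-cong N (λ j → solve 3 (λ v x p → (v :+ con (+ 1)) :* (x :* p) := x :* (v :* p :+ p)) refl (ν j) x (x ^ j)) ⟩
      Σ< N (λ j → x * (ν j * x ^ j + x ^ j))  ≈⟨ Σ-*ˡ N x _ ⟩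
      x * Σ< N (λ j → ν j * x ^ j + x ^ j)    ≈⟨ *-congˡ (Σ-+ N _ _) ⟩
      x * (D + G)  ∎

  -- This is Σ j² x^j = x(1+x)/(1-x)³, written through c = x/(1-x) as (2c² + c)/(1-x). The index
  -- shift now also produces the first moment.
  Σν²x : ∀ y → let c = q * y * inv y in
         Σ< N (λ j → ν j * ν j * (q * y) ^ j) ≈ inv y * (c * c + c * c + c)
  Σν²x y = cancel-unit (inv-law y) (begin
    (1# - x) * S         ≈⟨ solve 2 (λ x d → (con (+ 1) :- x) :* d := d :- x :* d) refl x S ⟩
    S - x * S            ≈⟨ +-congʳ S≈ ⟩
    x * (S + (D + D + G)) - x * S  ≈⟨ solve 4 (λ x s d g → x :* (s :+ (d :+ d :+ g)) :- x :* s := con (+ 1) :* (x :* (d :+ d :+ g))) refl x S D G ⟩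
    1# * (x * (D + D + G))    ≈⟨ *-congˡ (*-congˡ (+-congʳ (+-cong (Σνx y) (Σνx y)))) ⟩
    1# * (x * (G * c + G * c + G))         ≈⟨ *-congʳ (inv-law y) ⟨
    (1# - x) * G * (x * (G * c + G * c + G))
      ≈⟨ solve 3 (λ x g u → u :* g :* (x :* (g :* (x :* g) :+ g :* (x :* g) :+ g)) :=
           u :* (g :* ((x :* g) :* (x :* g) :+ (x :* g) :* (x :* g) :+ (x :* g)))) refl x G (1# - x) ⟩
    (1# - x) * (G * (c * c + c * c + c))  ∎)
    where
    x = q * y
    G = inv y
    c = x * G
    D = Σ< N (λ j → ν j * x ^ j)
    S = Σ< N (λ j → ν j * ν j * x ^ j)
    S≈ : S ≈ x * (S + (D + D + G))
    S≈ = begin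
      S  ≈⟨ Σ-shift N _ (x*0≈0 ([q*y]^N≈0 y)) ⟩
      0# * 0# * 1# + Σ< N (λ j → (ν j + 1#) * (ν j + 1#) * (x * x ^ j))
        ≈⟨ trans (+-congʳ (0*y≈0 (zeroˡ _))) (+-identityˡ _) ⟩
      Σ< N (λ j → (ν j + 1#) * (ν j + 1#) * (x * x ^ j))
        ≈⟨ Σ-cong N (λ j → solve 3 (λ v x p → (v :+ con (+ 1)) :* (v :+ con (+ 1)) :* (x :* p) := x :* (v :* v :* p :+ (v :* p :+ v :* p :+ p))) refl (ν j) x (x ^ j)) ⟩
      Σ< N (λ j → x * (ν j * ν j * x ^ j + (ν j * x ^ j + ν j * x ^ j + x ^ j)))  ≈⟨ Σ-*ˡ N x _ ⟩
      x * Σ< N (λ j → ν j * ν j * x ^ j + (ν j * x ^ j + ν j * x ^ j + x ^ j))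
        ≈⟨ *-congˡ (trans (Σ-+ N _ _) (+-congˡ (trans (Σ-+ N _ _) (+-congʳ (Σ-+ N _ _))))) ⟩
      x * (S + (D + D + G))  ∎

-- Moments of the largest part, and the sum behind the second rank moment

module RankMoment (R : CommutativeRing 0ℓ 0ℓ) (q : CommutativeRing.Carrier R) (n : ℕ)
                  (q^N≈0 : CommutativeRing._≈_ R (FiniteSums._^_ R q (suc n)) (CommutativeRing.0# R))
                  where
  open FiniteSums R
  open Nilpotent R q n q^N≈0

  -- In standard notation: `F k` = (q)_k, `P k` = 1/(q)_k, and `c k` = q^(k+1)/(1-q^(k+1)). When
  -- partitions with parts at most k are weighted by q^size, `h k` and `g k` are the mean and the
  -- variance of the number of parts. `L k` is the tail of `h`; modulo q^N, `P N` stands for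
  -- 1/(q)_∞.
  I c F P h g L : ℕ → Carrier
  I k = inv (q ^ k)
  c k = q ^ suc k * I k
  F k = Π< k (λ j → 1# - q ^ suc j)
  P k = Π< k I
  h k = Σ< k c
  g k = Σ< k (λ j → c j * I j)
  L k = h N - h k

  T : Carrier
  T = Σ< N (λ m → F m * c m)

  I-law : ∀ k → (1# - q ^ suc k) * I k ≈ 1#
  I-law k = inv-law (q ^ k)

  I≈1+c : ∀ k → I k ≈ 1# + c k
  I≈1+c k = inv-step (q ^ k)

  FP≈1 : ∀ k → F k * P k ≈ 1#
  FP≈1 k = Π-inverse k _ _ I-law

  [q^suc]^N≈0 : ∀ i → (q ^ suc i) ^ N ≈ 0#
  [q^suc]^N≈0 i = [q*y]^N≈0 (q ^ i)

  -- Moments of the largest part k, whose weight q^k is replaced by q^((i+1)k): for i = N only k = 0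
  -- survives, and the step from i to i + 1 multiplies by 1 - q^(i+1).
  E : (ℕ → Carrier) → ℕ → Carrier
  E w i = Σ< N (λ k → w k * ((q ^ suc i) ^ k * P k))

  -- Write 1 = q^k + (1-q^k). The first summand raises i by one, since (q^(i+1))^k q^k =
  -- (q^(i+2))^k; in the second, 1-q^k removes the last factor of 1/(q)_k and lowers k by one.
  E-step : ∀ w i → E w i ≈ E w (suc i) + q ^ suc i * E (λ k → w (suc k)) i
  E-step w i = begin
    E w i
      ≈⟨ Σ-cong N split ⟩
    Σ< N (λ k → w k * (x′ ^ k * P k) + d k)
      ≈⟨ Σ-+ N _ _ ⟩
    E w (suc i) + Σ< N d
      ≈⟨ +-congˡ (trans (Σ-shift N d d-tail) (trans (+-cong d-head (Σ-cong N d-step)) (+-identityˡ _))) ⟩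
    E w (suc i) + Σ< N (λ k → x * (w (suc k) * (x ^ k * P k)))
      ≈⟨ +-congˡ (Σ-*ˡ N x _) ⟩
    E w (suc i) + x * E (λ k → w (suc k)) i  ∎
    where
    x  = q ^ suc i
    x′ = q ^ suc (suc i)
    d : ℕ → Carrier
    d k = w k * (x ^ k * P k) * (1# - q ^ k)
    split : ∀ k → w k * (x ^ k * P k) ≈ w k * (x′ ^ k * P k) + d k
    split k = begin
      w k * (x ^ k * P k)
        ≈⟨ solve 4 (λ w y p z → w :* (y :* p) := w :* (z :* y :* p) :+ w :* (y :* p) :* (con (+ 1) :- z)) refl (w k) (x ^ k) (P k) (q ^ k) ⟩
      w k * (q ^ k * x ^ k * P k) + d k
        ≈⟨ +-congʳ (*-congˡ (*-congʳ (^-distrib-* q x k))) ⟨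
      w k * (x′ ^ k * P k) + d k  ∎
    d-tail : d N ≈ 0#
    d-tail = 0*y≈0 (x*0≈0 (0*y≈0 ([q^suc]^N≈0 i)))
    d-head : d 0 ≈ 0#
    d-head = x*0≈0 (-‿inverseʳ 1#)
    d-step : ∀ k → d (suc k) ≈ x * (w (suc k) * (x ^ k * P k))
    d-step k = begin
      d (suc k)
        ≈⟨ solve 6 (λ w x y p i u → w :* (x :* y :* (p :* i)) :* u := u :* i :* (x :* (w :* (y :* p)))) refl
             (w (suc k)) x (x ^ k) (P k) (I k) (1# - q ^ suc k) ⟩
      (1# - q ^ suc k) * I k * (x * (w (suc k) * (x ^ k * P k)))
        ≈⟨ trans (*-congʳ (I-law k)) (*-identityˡ _) ⟩
      x * (w (suc k) * (x ^ k * P k))  ∎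

  E-last : ∀ w → E w N ≈ w 0
  E-last w = trans (Σ-only-head n _ (λ k _ → x*0≈0 (0*y≈0 (0*y≈0 (q^-vanish (ℕ.n≤1+n N))))))
                   (trans (*-congˡ (*-identityˡ 1#)) (*-identityʳ _))

  E-cong : ∀ {w w′} → (∀ k → w k ≈ w′ k) → ∀ i → E w i ≈ E w′ i
  E-cong eq i = Σ-cong N (λ k → *-congʳ (eq k))

  E-+ : ∀ w w′ i → E (λ k → w k + w′ k) i ≈ E w i + E w′ i
  E-+ w w′ i = trans (Σ-cong N (λ k → distribʳ _ (w k) (w′ k))) (Σ-+ N _ _)

  descent-F : ∀ (Z : ℕ → Carrier) → (∀ i → Z (suc i) ≈ (1# - q ^ suc i) * Z i) → ∀ i → Z i ≈ F i * Z 0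
  descent-F Z step zero    = sym (*-identityˡ _)
  descent-F Z step (suc i) = begin
    Z (suc i)                      ≈⟨ step i ⟩
    (1# - q ^ suc i) * Z i         ≈⟨ *-congˡ (descent-F Z step i) ⟩
    (1# - q ^ suc i) * (F i * Z 0) ≈⟨ solve 3 (λ u f z → u :* (f :* z) := f :* u :* z) refl _ _ _ ⟩
    F (suc i) * Z 0                ∎

  -- The value at N is a unit multiple of the value at 0, so the boundary condition at N, where the
  -- moments are explicit, forces the whole sequence to vanish. This replaces uniqueness of a limit.
  descent-0 : ∀ (Z : ℕ → Carrier) → (∀ i → Z (suc i) ≈ (1# - q ^ suc i) * Z i) → Z N ≈ 0# → ∀ i → Z i ≈ 0#
  descent-0 Z step Z-last i = trans (descent-F Z step i) (x*0≈0
    (cancel-unit (FP≈1 N) (trans (sym (descent-F Z step N)) (trans Z-last (sym (zeroʳ _))))))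

  E₀ E₁ E₂ : ℕ → Carrier
  E₀ = E (λ _ → 1#)
  E₁ = E ν
  E₂ = E (λ k → ν k * ν k)

  E₀-step : ∀ i → E₀ (suc i) ≈ (1# - q ^ suc i) * E₀ i
  E₀-step i = begin
    E₀ (suc i)                ≈⟨ solve 2 (λ a b → a := (a :+ b) :- b) refl (E₀ (suc i)) (q ^ suc i * E₀ i) ⟩
    E₀ (suc i) + x * E₀ i - x * E₀ i  ≈⟨ +-congʳ (E-step _ i) ⟨
    E₀ i - x * E₀ i           ≈⟨ solve 2 (λ e x → e :- x :* e := (con (+ 1) :- x) :* e) refl (E₀ i) x ⟩
    (1# - x) * E₀ i           ∎
    where x = q ^ suc i

  -- Euler: Σ_k z^k/(q)_k = 1/(z)_∞ at z = q^(i+1).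
  E₀≈FP : ∀ i → E₀ i ≈ F i * P N
  E₀≈FP i = trans (descent-F E₀ E₀-step i) (*-congˡ (cancel-unit (FP≈1 N)
    (trans (sym (descent-F E₀ E₀-step N)) (trans (E-last (λ _ → 1#)) (sym (FP≈1 N))))))

  L-step : ∀ i → L (suc i) ≈ L i - c i
  L-step i = solve 3 (λ a b c → a :- (b :+ c) := (a :- b) :- c) refl _ _ _

  -- Applying z d/dz to Euler's 1/(z)_∞ multiplies it by Σ_j zq^j/(1-zq^j), which is `L i` at z =
  -- q^(i+1). Here z is not a variable, so the difference of the two sides is shown to satisfy the
  -- homogeneous step instead.
  E₁≈E₀L : ∀ i → E₁ i ≈ E₀ i * L i
  E₁≈E₀L i = x-y≈0⇒x≈y (descent-0 (λ i → E₁ i - E₀ i * L i) step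
      (trans (+-cong (E-last ν) (-‿cong (x*0≈0 (-‿inverseʳ _)))) (trans (+-identityˡ _) -0#≈0#)) i)
    where
    step : ∀ i → E₁ (suc i) - E₀ (suc i) * L (suc i) ≈ (1# - q ^ suc i) * (E₁ i - E₀ i * L i)
    step i = begin
      E₁ (suc i) - E₀ (suc i) * L (suc i)
        ≈⟨ +-cong (solve 2 (λ a b → a := (a :+ b) :- b) refl (E₁ (suc i)) (x * (E₁ i + E₀ i)))
                  (-‿cong (*-cong (E₀-step i) (L-step i))) ⟩
      E₁ (suc i) + x * (E₁ i + E₀ i) - x * (E₁ i + E₀ i) - u * E₀ i * (L i - x * I i)
        ≈⟨ +-congʳ (+-congʳ (trans (E-step ν i) (+-congˡ (*-congˡ (E-+ ν _ i))))) ⟨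
      E₁ i - x * (E₁ i + E₀ i) - u * E₀ i * (L i - x * I i)
        ≈⟨ solve 6 (λ e₁ e₀ x l k u → (e₁ :- x :* (e₁ :+ e₀)) :- u :* e₀ :* (l :- x :* k) :=
             (e₁ :- x :* (e₁ :+ e₀)) :- u :* e₀ :* l :+ u :* k :* (x :* e₀)) refl (E₁ i) (E₀ i) x (L i) (I i) u ⟩
      E₁ i - x * (E₁ i + E₀ i) - u * E₀ i * L i + u * I i * (x * E₀ i)
        ≈⟨ +-congˡ (*-congʳ (I-law i)) ⟩
      E₁ i - x * (E₁ i + E₀ i) - u * E₀ i * L i + 1# * (x * E₀ i)
        ≈⟨ solve 4 (λ e₁ e₀ x l → (e₁ :- x :* (e₁ :+ e₀)) :- (con (+ 1) :- x) :* e₀ :* l :+ con (+ 1) :* (x :* e₀) :=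
             (con (+ 1) :- x) :* (e₁ :- e₀ :* l)) refl (E₁ i) (E₀ i) x (L i) ⟩
      u * (E₁ i - E₀ i * L i)  ∎
      where
      x = q ^ suc i
      u = 1# - x

  M : ℕ → Carrier
  M i = L i * L i + (g N - g i)

  M-step : ∀ i → M (suc i) ≈ M i - c i * (L i + L i + 1#)
  M-step i = begin
    L (suc i) * L (suc i) + (g N - (g i + c i * I i))
      ≈⟨ +-cong (*-cong (L-step i) (L-step i)) (+-congˡ (-‿cong (+-congˡ (*-congˡ (I≈1+c i))))) ⟩
    (L i - c i) * (L i - c i) + (g N - (g i + c i * (1# + c i)))
      ≈⟨ solve 4 (λ l c a b → (l :- c) :* (l :- c) :+ (a :- (b :+ c :* (con (+ 1) :+ c))) :=
           (l :* l :+ (a :- b)) :- c :* (l :+ l :+ con (+ 1))) refl (L i) (c i) (g N) (g i) ⟩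
    M i - c i * (L i + L i + 1#)  ∎

  -- A second z d/dz produces L² + z dL/dz, and z dL/dz is the tail Σ_j zq^j/(1-zq^j)² of `g`.
  E₂≈E₀M : ∀ i → E₂ i ≈ E₀ i * M i
  E₂≈E₀M i = x-y≈0⇒x≈y (descent-0 (λ i → E₂ i - E₀ i * M i) step
      (trans (+-cong (trans (E-last (λ k → ν k * ν k)) (zeroˡ _))
                     (-‿cong (x*0≈0 (trans (+-cong (0*y≈0 (-‿inverseʳ _)) (-‿inverseʳ _)) (+-identityˡ _)))))
             (trans (+-identityˡ _) -0#≈0#)) i)
    where
    step : ∀ i → E₂ (suc i) - E₀ (suc i) * M (suc i) ≈ (1# - q ^ suc i) * (E₂ i - E₀ i * M i)
    step i = begin
      E₂ (suc i) - E₀ (suc i) * M (suc i)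
        ≈⟨ +-cong (solve 2 (λ a b → a := (a :+ b) :- b) refl (E₂ (suc i)) (x * (E₂ i + (E₁ i + E₁ i + E₀ i))))
                  (-‿cong (*-cong (E₀-step i) (M-step i))) ⟩
      E₂ (suc i) + x * (E₂ i + (E₁ i + E₁ i + E₀ i)) - x * (E₂ i + (E₁ i + E₁ i + E₀ i))
        - u * E₀ i * (M i - x * I i * (L i + L i + 1#))
        ≈⟨ +-congʳ (+-congʳ E₂-step) ⟨
      E₂ i - x * (E₂ i + (E₁ i + E₁ i + E₀ i)) - u * E₀ i * (M i - x * I i * (L i + L i + 1#))
        ≈⟨ +-congʳ (+-congˡ (-‿cong (*-congˡ (+-congˡ (+-congʳ (+-cong (E₁≈E₀L i) (E₁≈E₀L i))))))) ⟩
      E₂ i - x * (E₂ i + (E₀ i * L i + E₀ i * L i + E₀ i)) - u * E₀ i * (M i - x * I i * (L i + L i + 1#))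
        ≈⟨ solve 7 (λ e₂ e₀ x l k u m → (e₂ :- x :* (e₂ :+ (e₀ :* l :+ e₀ :* l :+ e₀))) :- u :* e₀ :* (m :- x :* k :* (l :+ l :+ con (+ 1))) :=
             (e₂ :- x :* (e₂ :+ (e₀ :* l :+ e₀ :* l :+ e₀))) :- u :* e₀ :* m :+ u :* k :* (x :* e₀ :* (l :+ l :+ con (+ 1)))) refl
             (E₂ i) (E₀ i) x (L i) (I i) u (M i) ⟩
      E₂ i - x * (E₂ i + (E₀ i * L i + E₀ i * L i + E₀ i)) - u * E₀ i * M i + u * I i * (x * E₀ i * (L i + L i + 1#))
        ≈⟨ +-congˡ (*-congʳ (I-law i)) ⟩
      E₂ i - x * (E₂ i + (E₀ i * L i + E₀ i * L i + E₀ i)) - u * E₀ i * M i + 1# * (x * E₀ i * (L i + L i + 1#))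
        ≈⟨ solve 5 (λ e₂ e₀ x l m → (e₂ :- x :* (e₂ :+ (e₀ :* l :+ e₀ :* l :+ e₀))) :- (con (+ 1) :- x) :* e₀ :* m :+ con (+ 1) :* (x :* e₀ :* (l :+ l :+ con (+ 1))) :=
             (con (+ 1) :- x) :* (e₂ :- e₀ :* m)) refl (E₂ i) (E₀ i) x (L i) (M i) ⟩
      u * (E₂ i - E₀ i * M i)  ∎
      where
      x = q ^ suc i
      u = 1# - x
      E₂-step : E₂ i ≈ E₂ (suc i) + x * (E₂ i + (E₁ i + E₁ i + E₀ i))
      E₂-step = trans (E-step _ i) (+-congˡ (*-congˡ (begin
        E (λ k → (ν k + 1#) * (ν k + 1#)) i
          ≈⟨ E-cong (λ k → solve 1 (λ v → (v :+ con (+ 1)) :* (v :+ con (+ 1)) := v :* v :+ (v :+ v :+ con (+ 1))) refl (ν k)) i ⟩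
        E (λ k → ν k * ν k + (ν k + ν k + 1#)) i
          ≈⟨ trans (E-+ _ _ i) (+-congˡ (trans (E-+ _ _ i) (+-congʳ (E-+ _ _ i)))) ⟩
        E₂ i + (E₁ i + E₁ i + E₀ i)  ∎)))

  lambert : ℕ → Carrier
  lambert k = Σ< N (λ m → (q ^ suc m) ^ k * c m)

  lambert-step : ∀ k → lambert k ≈ c k + lambert (suc k)
  lambert-step k = begin
    lambert k
      ≈⟨ Σ-cong N term ⟩
    Σ< N (λ m → q ^ suc k * (q ^ suc k) ^ m + (q ^ suc m) ^ suc k * c m)
      ≈⟨ Σ-+ N _ _ ⟩
    Σ< N (λ m → q ^ suc k * (q ^ suc k) ^ m) + lambert (suc k)
      ≈⟨ +-congʳ (Σ-*ˡ N _ _) ⟩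
    c k + lambert (suc k)  ∎
    where
    flip-exponents : ∀ m → (q ^ suc k) ^ suc m ≈ (q ^ suc m) ^ suc k
    flip-exponents m = begin
      (q ^ suc k) ^ suc m    ≈⟨ ^-assocʳ q (suc k) (suc m) ⟩
      q ^ (suc k ℕ.* suc m)  ≡⟨ ≡.cong (q ^_) (ℕ.*-comm (suc k) (suc m)) ⟩
      q ^ (suc m ℕ.* suc k)  ≈⟨ ^-assocʳ q (suc m) (suc k) ⟨
      (q ^ suc m) ^ suc k    ∎
    term : ∀ m → (q ^ suc m) ^ k * c m ≈ q ^ suc k * (q ^ suc k) ^ m + (q ^ suc m) ^ suc k * c m
    term m = begin
      (q ^ suc m) ^ k * c m
        ≈⟨ solve 3 (λ x y i → y :* (x :* i) := x :* y :* ((con (+ 1) :- x) :* i) :+ x :* y :* (x :* i)) refl (q ^ suc m) ((q ^ suc m) ^ k) (I m) ⟩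
      (q ^ suc m) ^ suc k * ((1# - q ^ suc m) * I m) + (q ^ suc m) ^ suc k * c m
        ≈⟨ +-congʳ (trans (*-congˡ (I-law m)) (*-identityʳ _)) ⟩
      (q ^ suc m) ^ suc k + (q ^ suc m) ^ suc k * c m
        ≈⟨ +-congʳ (flip-exponents m) ⟨
      q ^ suc k * (q ^ suc k) ^ m + (q ^ suc m) ^ suc k * c m  ∎

  -- Both sides are the double sum of q^((m+1)(r+1)) over m ≥ 0 and r ≥ k, taken in the two orders.
  -- Each `lambert-step` splits off r = k, so `h k + lambert k` is constant, and `lambert N`
  -- vanishes.
  lambert≈L : ∀ k → lambert k ≈ L k
  lambert≈L k = begin
    lambert k                  ≈⟨ solve 2 (λ a b → a := (b :+ a) :- b) refl (lambert k) (h k) ⟩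
    h k + lambert k - h k      ≈⟨ +-congʳ (trans (constant k) (sym (constant N))) ⟩
    h N + lambert N - h k      ≈⟨ +-congʳ (+-elimʳ (Σ-zero N (λ m _ → 0*y≈0 ([q^suc]^N≈0 m)))) ⟩
    h N - h k                  ∎
    where
    constant : ∀ k → h k + lambert k ≈ h 0 + lambert 0
    constant zero    = refl
    constant (suc k) = trans (+-assoc _ _ _) (trans (+-congˡ (sym (lambert-step k))) (constant k))

  -- The factor (q)_m/(q)_∞ is expanded by Euler's sum at z = q^(m+1); exchanging the sums leaves,
  -- for each k, a Lambert series over m.
  PT≈ΣPL : P N * T ≈ Σ< N (λ k → P k * L k)
  PT≈ΣPL = begin
    P N * T                                   ≈⟨ Σ-*ˡ N _ _ ⟨
    Σ< N (λ m → P N * (F m * c m))            ≈⟨ Σ-cong N (λ m → expand m) ⟩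
    Σ< N (λ m → Σ< N (λ k → P k * ((q ^ suc m) ^ k * c m)))  ≈⟨ Σ-swap N N _ ⟩
    Σ< N (λ k → Σ< N (λ m → P k * ((q ^ suc m) ^ k * c m)))  ≈⟨ Σ-cong N (λ k → Σ-*ˡ N (P k) _) ⟩
    Σ< N (λ k → P k * lambert k)              ≈⟨ Σ-cong N (λ k → *-congˡ (lambert≈L k)) ⟩
    Σ< N (λ k → P k * L k)                    ∎
    where
    expand : ∀ m → P N * (F m * c m) ≈ Σ< N (λ k → P k * ((q ^ suc m) ^ k * c m))
    expand m = begin
      P N * (F m * c m)  ≈⟨ solve 3 (λ p f c → p :* (f :* c) := f :* p :* c) refl (P N) (F m) (c m) ⟩
      F m * P N * c m    ≈⟨ *-congʳ (E₀≈FP m) ⟨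
      E₀ m * c m         ≈⟨ Σ-*ʳ N (c m) _ ⟨
      Σ< N (λ k → 1# * ((q ^ suc m) ^ k * P k) * c m)
        ≈⟨ Σ-cong N (λ k → solve 3 (λ y p c → con (+ 1) :* (y :* p) :* c := p :* (y :* c)) refl ((q ^ suc m) ^ k) (P k) (c m)) ⟩
      Σ< N (λ k → P k * ((q ^ suc m) ^ k * c m))  ∎

  -- ν k - h (suc k) is the mean rank when the largest part is suc k, and g (suc k) the variance.
  rankTerm : ℕ → Carrier
  rankTerm k = c k * P k * ((ν k - h (suc k)) * (ν k - h (suc k)) + g (suc k))

  -- Expanding the square of (largest part - number of parts) gives s₂ - 2 s₁ + s₀. The second
  -- moments of the largest part and of the number of parts agree, as conjugation predicts, both
  -- being (h² + g)/(q)_∞; the mixed moment is (h² + T)/(q)_∞, so h² cancels.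
  Σ-rankTerm : Σ< N rankTerm ≈ (P N * g N - P N * T) + (P N * g N - P N * T)
  Σ-rankTerm = begin
    Σ< N rankTerm
      ≈⟨ Σ-cong N expand ⟩
    Σ< N (λ k → s₂ k - (s₁ k + s₁ k) + s₀ k)
      ≈⟨ trans (Σ-+ N _ _) (+-congʳ (trans (Σ-minus N _ _) (+-congˡ (-‿cong (Σ-+ N _ _))))) ⟩
    Σ< N s₂ - (Σ< N s₁ + Σ< N s₁) + Σ< N s₀
      ≈⟨ +-cong (+-cong Σs₂ (-‿cong (+-cong Σs₁ Σs₁))) Σs₀ ⟩
    P N * (h N * h N + g N) - ((h N * (P N * h N) + P N * T) + (h N * (P N * h N) + P N * T)) + P N * (h N * h N + g N)
      ≈⟨ solve 4 (λ p h g t → p :* (h :* h :+ g) :- ((h :* (p :* h) :+ p :* t) :+ (h :* (p :* h) :+ p :* t)) :+ p :* (h :* h :+ g) :=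
           (p :* g :- p :* t) :+ (p :* g :- p :* t)) refl (P N) (h N) (g N) T ⟩
    (P N * g N - P N * T) + (P N * g N - P N * T)  ∎
    where
    s₂ s₁ s₀ Ph : ℕ → Carrier
    s₂ k = ν (suc k) * ν (suc k) * (c k * P k)
    s₁ k = ν (suc k) * (c k * P k * (1# + h (suc k)))
    s₀ k = c k * P k * ((1# + h (suc k)) * (1# + h (suc k)) + g (suc k))
    Ph k = P k * h k

    expand : ∀ k → rankTerm k ≈ s₂ k - (s₁ k + s₁ k) + s₀ k
    expand k = solve 4 (λ u v h g → u :* ((v :- h) :* (v :- h) :+ g) :=
      (v :+ con (+ 1)) :* (v :+ con (+ 1)) :* u
        :- ((v :+ con (+ 1)) :* (u :* (con (+ 1) :+ h)) :+ (v :+ con (+ 1)) :* (u :* (con (+ 1) :+ h)))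
        :+ u :* ((con (+ 1) :+ h) :* (con (+ 1) :+ h) :+ g)) refl
      (c k * P k) (ν k) (h (suc k)) (g (suc k))

    P-step : ∀ k → P (suc k) ≈ P k * (1# + c k)
    P-step k = *-congˡ (I≈1+c k)

    E-as-parts : ∀ w → w 0 ≈ 0# → E w 0 ≈ Σ< N (λ k → w (suc k) * (c k * P k))
    E-as-parts w w0≈0 = begin
      E w 0
        ≈⟨ Σ-shift N _ (x*0≈0 (0*y≈0 ([q^suc]^N≈0 0))) ⟩
      w 0 * (1# * 1#) + Σ< N (λ k → w (suc k) * ((q ^ 1) ^ suc k * (P k * I k)))
        ≈⟨ trans (+-congʳ (0*y≈0 w0≈0)) (+-identityˡ _) ⟩
      Σ< N (λ k → w (suc k) * ((q ^ 1) ^ suc k * (P k * I k)))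
        ≈⟨ Σ-cong N (λ k → *-congˡ (begin
             (q ^ 1) ^ suc k * (P k * I k)
               ≈⟨ *-congʳ (^-congˡ (suc k) (*-identityʳ q)) ⟩
             q ^ suc k * (P k * I k)
               ≈⟨ solve 3 (λ x p i → x :* (p :* i) := x :* i :* p) refl _ (P k) (I k) ⟩
             c k * P k  ∎)) ⟩
      Σ< N (λ k → w (suc k) * (c k * P k))  ∎

    L0≈h : L 0 ≈ h N
    L0≈h = solve 1 (λ h → h :- con (+ 0) := h) refl (h N)

    E₀0≈P : E₀ 0 ≈ P N
    E₀0≈P = trans (E₀≈FP 0) (*-identityˡ _)

    Σs₂ : Σ< N s₂ ≈ P N * (h N * h N + g N)
    Σs₂ = begin
      Σ< N s₂     ≈⟨ E-as-parts (λ k → ν k * ν k) (zeroˡ _) ⟨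
      E₂ 0        ≈⟨ E₂≈E₀M 0 ⟩
      E₀ 0 * M 0  ≈⟨ *-cong E₀0≈P (+-cong (*-cong L0≈h L0≈h) (solve 1 (λ h → h :- con (+ 0) := h) refl (g N))) ⟩
      P N * (h N * h N + g N)  ∎

    Σs₀ : Σ< N s₀ ≈ P N * (h N * h N + g N)
    Σs₀ = begin
      Σ< N s₀       ≈⟨ +-elimʳ (x*0≈0 (trans (+-identityʳ _) (zeroˡ _))) ⟨
      Σ< N s₀ + v 0 ≈⟨ Σ-telescope N s₀ v step ⟩
      v N           ∎
      where
      v : ℕ → Carrier
      v k = P k * (h k * h k + g k)
      step : ∀ k → s₀ k + v k ≈ v (suc k)
      step k = begin
        s₀ k + v k
          ≈⟨ +-congʳ (*-congˡ (+-congˡ (+-congˡ (*-congˡ (I≈1+c k))))) ⟩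
        c k * P k * ((1# + h (suc k)) * (1# + h (suc k)) + (g k + c k * (1# + c k))) + v k
          ≈⟨ solve 4 (λ p c h g → c :* p :* ((con (+ 1) :+ (h :+ c)) :* (con (+ 1) :+ (h :+ c)) :+ (g :+ c :* (con (+ 1) :+ c))) :+ p :* (h :* h :+ g) :=
               p :* (con (+ 1) :+ c) :* ((h :+ c) :* (h :+ c) :+ (g :+ c :* (con (+ 1) :+ c)))) refl (P k) (c k) (h k) (g k) ⟩
        P k * (1# + c k) * (h (suc k) * h (suc k) + (g k + c k * (1# + c k)))
          ≈⟨ *-cong (P-step k) (+-congˡ (+-congˡ (*-congˡ (I≈1+c k)))) ⟨
        v (suc k)  ∎

    by-parts : ∀ (f a : ℕ → Carrier) → (∀ k → f k ≈ a (suc k) - a k) →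
               Σ< N (λ k → ν (suc k) * f k) + Σ< N a ≈ ν N * a N
    by-parts f a eq = begin
      Σ< N (λ k → ν (suc k) * f k) + Σ< N a
        ≈⟨ Σ-+ N _ _ ⟨
      Σ< N (λ k → ν (suc k) * f k + a k)
        ≈⟨ +-elimʳ (zeroˡ (a 0)) ⟨
      Σ< N (λ k → ν (suc k) * f k + a k) + ν 0 * a 0
        ≈⟨ Σ-telescope N _ (λ k → ν k * a k) step ⟩
      ν N * a N  ∎
      where
      step : ∀ k → ν (suc k) * f k + a k + ν k * a k ≈ ν (suc k) * a (suc k)
      step k = trans (+-congʳ (+-congʳ (*-congˡ (eq k))))
        (solve 3 (λ v a b → (v :+ con (+ 1)) :* (b :- a) :+ a :+ v :* a := (v :+ con (+ 1)) :* b) refl (ν k) (a k) (a (suc k)))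

    ΣP : P N * h N + Σ< N P ≈ ν N * P N
    ΣP = begin
      P N * h N + Σ< N P
        ≈⟨ +-congʳ (trans (E₁≈E₀L 0) (*-cong E₀0≈P L0≈h)) ⟨
      E₁ 0 + Σ< N P
        ≈⟨ +-congʳ (E-as-parts ν refl) ⟩
      Σ< N (λ k → ν (suc k) * (c k * P k)) + Σ< N P
        ≈⟨ by-parts _ P (λ k → begin
             c k * P k              ≈⟨ solve 2 (λ c p → c :* p := p :* (con (+ 1) :+ c) :- p) refl (c k) (P k) ⟩
             P k * (1# + c k) - P k ≈⟨ +-congʳ (P-step k) ⟨
             P (suc k) - P k        ∎) ⟩
      ν N * P N  ∎

    -- Writing `h k` as `h N - L k` is what brings T in, through `PT≈ΣPL`.
    ΣPh : Σ< N Ph ≈ h N * Σ< N P - P N * T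
    ΣPh = begin
      Σ< N Ph
        ≈⟨ Σ-cong N (λ k → solve 3 (λ p h H → p :* h := H :* p :- p :* (H :- h)) refl (P k) (h k) (h N)) ⟩
      Σ< N (λ k → h N * P k - P k * L k)
        ≈⟨ trans (Σ-minus N _ _) (+-cong (Σ-*ˡ N (h N) P) (-‿cong (sym PT≈ΣPL))) ⟩
      h N * Σ< N P - P N * T  ∎

    -- The summands multiplying `ν (suc k)` are increments of `Ph`, so summation by parts applies.
    -- Its boundary term contains `ν N`, which has no limit as N grows; it cancels against the
    -- boundary term in `ΣP`.
    Σs₁ : Σ< N s₁ ≈ h N * (P N * h N) + P N * T
    Σs₁ = begin
      Σ< N s₁
        ≈⟨ solve 2 (λ a b → a := (a :+ b) :- b) refl (Σ< N s₁) (Σ< N Ph) ⟩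
      Σ< N s₁ + Σ< N Ph - Σ< N Ph
        ≈⟨ +-cong (by-parts _ Ph Ph-step) (-‿cong ΣPh) ⟩
      ν N * (P N * h N) - (h N * Σ< N P - P N * T)
        ≈⟨ solve 5 (λ v p h s t → v :* (p :* h) :- (h :* s :- t) := h :* (v :* p) :- h :* s :+ t) refl (ν N) (P N) (h N) (Σ< N P) (P N * T) ⟩
      h N * (ν N * P N) - h N * Σ< N P + P N * T
        ≈⟨ +-congʳ (+-congʳ (*-congˡ ΣP)) ⟨
      h N * (P N * h N + Σ< N P) - h N * Σ< N P + P N * T
        ≈⟨ solve 4 (λ h p s t → h :* (p :+ s) :- h :* s :+ t := h :* p :+ t) refl (h N) (P N * h N) (Σ< N P) (P N * T) ⟩
      h N * (P N * h N) + P N * T  ∎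
      where
      Ph-step : ∀ k → c k * P k * (1# + h (suc k)) ≈ Ph (suc k) - Ph k
      Ph-step k = begin
        c k * P k * (1# + (h k + c k))
          ≈⟨ solve 3 (λ c p h → c :* p :* (con (+ 1) :+ (h :+ c)) := p :* (con (+ 1) :+ c) :* (h :+ c) :- p :* h) refl (c k) (P k) (h k) ⟩
        P k * (1# + c k) * (h k + c k) - Ph k
          ≈⟨ +-congʳ (*-congʳ (P-step k)) ⟨
        Ph (suc k) - Ph k  ∎

-- Contiguous relations for the q-analogue of Gauss's second theorem

-- W(a,b) = Σ_m (aq)_m (bq)_m q^((m+1)(m+2)/2) / ((q)_(m+1) (abq;q²)_(m+1)), the series in the q-analogue
-- of Gauss's second theorem with its factors (1-a)(1-b) removed.
module GaussSecond (R : CommutativeRing 0ℓ 0ℓ) (q : CommutativeRing.Carrier R) (n : ℕ)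
                   (q^N≈0 : CommutativeRing._≈_ R (FiniteSums._^_ R q (suc n)) (CommutativeRing.0# R))
                   where
  open FiniteSums R
  open Nilpotent R q n q^N≈0
  open RankMoment R q n q^N≈0 using (I; I-law)

  D J : Carrier → Carrier → ℕ → Carrier
  D a b m = 1# - q * (a * b * (q ^ m * q ^ m))
  J a b m = inv (a * b * (q ^ m * q ^ m))

  ratio : Carrier → Carrier → ℕ → Carrier
  ratio a b m = (1# - a * q ^ m) * (1# - b * q ^ m) * q ^ suc m * I m * J a b m

  w : Carrier → Carrier → ℕ → Carrier
  w a b zero    = q * I 0 * J a b 0
  w a b (suc m) = w a b m * ratio a b (suc m)

  -- `S a b` is the full series Σ (a)_m (b)_m q^(m(m+1)/2)/((q)_m (abq;q²)_m): its term at m+1 is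
  -- (1-a)(1-b) times `w a b m`.
  W S : Carrier → Carrier → Carrier
  W a b = Σ< N (w a b)
  S a b = 1# + (1# - a) * (1# - b) * W a b

  DJ≈1 : ∀ a b m → D a b m * J a b m ≈ 1#
  DJ≈1 a b m = inv-law _

  J-cong : ∀ {a a′ b b′} → a ≈ a′ → b ≈ b′ → ∀ m → J a b m ≈ J a′ b′ m
  J-cong a≈ b≈ m = inv-cong (*-congʳ (*-cong a≈ b≈))

  w-cong : ∀ {a a′ b b′} → a ≈ a′ → b ≈ b′ → ∀ m → w a b m ≈ w a′ b′ m
  w-cong a≈ b≈ zero    = *-congˡ (J-cong a≈ b≈ 0)
  w-cong a≈ b≈ (suc m) = *-cong (w-cong a≈ b≈ m)
    (*-cong (*-congʳ (*-congʳ (*-cong (1-cong (*-congʳ a≈)) (1-cong (*-congʳ b≈))))) (J-cong a≈ b≈ (suc m)))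

  W-cong : ∀ {a a′ b b′} → a ≈ a′ → b ≈ b′ → W a b ≈ W a′ b′
  W-cong a≈ b≈ = Σ-cong N (w-cong a≈ b≈)

  S-cong : ∀ {a a′ b b′} → a ≈ a′ → b ≈ b′ → S a b ≈ S a′ b′
  S-cong a≈ b≈ = +-congˡ (*-cong (*-cong (1-cong a≈) (1-cong b≈)) (W-cong a≈ b≈))

  w-sym : ∀ a b m → w a b m ≈ w b a m
  w-sym a b zero    = *-congˡ (inv-cong (*-congʳ (*-comm a b)))
  w-sym a b (suc m) = *-cong (w-sym a b m)
    (*-cong (*-congʳ (*-congʳ (*-comm _ _))) (inv-cong (*-congʳ (*-comm a b))))

  S-sym : ∀ a b → S a b ≈ S b a
  S-sym a b = +-congˡ (*-cong (*-comm _ _) (Σ-cong N (w-sym a b)))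

  -- Replacing a by aq² turns (aq)_m into (aq³)_m and moves (abq;q²)_(m+1) up by one factor. The
  -- quotient of the two terms is therefore rational in q^m, and it is stated with denominators
  -- cleared.
  w-shift : ∀ a b m →
    (1# - a * q) * (1# - a * (q * q)) * w (a * (q * q)) b m * D a b (suc m)
      ≈ D a b 0 * (1# - a * q ^ suc m) * (1# - a * q ^ suc (suc m)) * w a b m
  w-shift a b zero = begin
    (1# - a * q) * (1# - a * (q * q)) * (q * I 0 * J (a * (q * q)) b 0) * D a b 1
      ≈⟨ *-congʳ (*-congˡ (*-congˡ (inv-cong
           (solve 3 (λ a b q → a :* (q :* q) :* b :* (con (+ 1) :* con (+ 1)) := a :* b :* (q :* con (+ 1) :* (q :* con (+ 1)))) refl a b q)))) ⟩
    (1# - a * q) * (1# - a * (q * q)) * (q * I 0 * J a b 1) * D a b 1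
      ≈⟨ solve 5 (λ u q i j d → u :* (q :* i :* j) :* d := u :* (q :* i) :* (d :* j)) refl _ q (I 0) (J a b 1) (D a b 1) ⟩
    (1# - a * q) * (1# - a * (q * q)) * (q * I 0) * (D a b 1 * J a b 1)
      ≈⟨ *-congˡ (trans (DJ≈1 a b 1) (sym (DJ≈1 a b 0))) ⟩
    (1# - a * q) * (1# - a * (q * q)) * (q * I 0) * (D a b 0 * J a b 0)
      ≈⟨ solve 5 (λ a q i j d → (con (+ 1) :- a :* q) :* (con (+ 1) :- a :* (q :* q)) :* (q :* i) :* (d :* j) :=
           d :* (con (+ 1) :- a :* (q :* con (+ 1))) :* (con (+ 1) :- a :* (q :* (q :* con (+ 1)))) :* (q :* i :* j)) refl a q (I 0) (J a b 0) (D a b 0) ⟩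
    D a b 0 * (1# - a * q ^ 1) * (1# - a * q ^ 2) * w a b 0  ∎
  w-shift a b (suc m) = begin
    (1# - a * q) * (1# - a * (q * q)) * (w a′ b m * ((1# - a′ * x) * (1# - b * x) * (q * x) * I (suc m) * J a′ b (suc m))) * D a b (2 ℕ.+ m)
      ≈⟨ *-congʳ (*-congˡ (*-congˡ (*-congˡ (inv-cong
           (solve 4 (λ a b q x → a :* (q :* q) :* b :* (x :* x) := a :* b :* (q :* x :* (q :* x))) refl a b q x))))) ⟩
    (1# - a * q) * (1# - a * (q * q)) * (w a′ b m * ((1# - a′ * x) * (1# - b * x) * (q * x) * I (suc m) * J a b (2 ℕ.+ m))) * D a b (2 ℕ.+ m)
      ≈⟨ solve 5 (λ u v c j d → u :* (v :* (c :* j)) :* d := u :* v :* c :* (d :* j)) refl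
           ((1# - a * q) * (1# - a * (q * q))) (w a′ b m) ((1# - a′ * x) * (1# - b * x) * (q * x) * I (suc m)) (J a b (2 ℕ.+ m)) (D a b (2 ℕ.+ m)) ⟩
    (1# - a * q) * (1# - a * (q * q)) * w a′ b m * ((1# - a′ * x) * (1# - b * x) * (q * x) * I (suc m)) * (D a b (2 ℕ.+ m) * J a b (2 ℕ.+ m))
      ≈⟨ *-congˡ (trans (DJ≈1 a b (2 ℕ.+ m)) (sym (DJ≈1 a b (suc m)))) ⟩
    (1# - a * q) * (1# - a * (q * q)) * w a′ b m * ((1# - a′ * x) * (1# - b * x) * (q * x) * I (suc m)) * (D a b (suc m) * J a b (suc m))
      ≈⟨ solve 4 (λ u c j d → u :* c :* (d :* j) := u :* d :* (c :* j)) refl _ _ _ _ ⟩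
    (1# - a * q) * (1# - a * (q * q)) * w a′ b m * D a b (suc m) * ((1# - a′ * x) * (1# - b * x) * (q * x) * I (suc m) * J a b (suc m))
      ≈⟨ *-congʳ (w-shift a b m) ⟩
    D a b 0 * (1# - a * x) * (1# - a * (q * x)) * w a b m * ((1# - a′ * x) * (1# - b * x) * (q * x) * I (suc m) * J a b (suc m))
      ≈⟨ solve 8 (λ d a b q x v i j →
           d :* (con (+ 1) :- a :* x) :* (con (+ 1) :- a :* (q :* x)) :* v :* ((con (+ 1) :- a :* (q :* q) :* x) :* (con (+ 1) :- b :* x) :* (q :* x) :* i :* j) :=
           d :* (con (+ 1) :- a :* (q :* x)) :* (con (+ 1) :- a :* (q :* (q :* x))) :* (v :* ((con (+ 1) :- a :* x) :* (con (+ 1) :- b :* x) :* (q :* x) :* i :* j)))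
           refl (D a b 0) a b q x (w a b m) (I (suc m)) (J a b (suc m)) ⟩
    D a b 0 * (1# - a * (q * x)) * (1# - a * (q * (q * x))) * w a b (suc m)  ∎
    where
    x  = q ^ suc m
    a′ = a * (q * q)

  -- The q-Zeilberger certificate of the recurrence a ↦ aq².
  γ : Carrier → Carrier → ℕ → Carrier
  γ a b m = a * D a b 0 * (1# - q ^ suc m) * w a b m

  -- After multiplication by the unit `D a b (suc m)` every term is a multiple of `w a b m`, by
  -- `w-shift` and the recursion of `w`. What remains is a polynomial identity in a, b, q and x =
  -- q^(m+1).
  γ-step : ∀ a b m →
    D a b 0 * (1# - a) * w a b m - (1# - a * q) * (1# - a * (q * q)) * w (a * (q * q)) b m + γ a b m
      ≈ γ a b (suc m)
  γ-step a b m = cancel-unit (DJ≈1 a b (suc m)) (begin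
    d * (d₀ * (1# - a) * v - r * v′ + γ a b m)
      ≈⟨ solve 6 (λ d e v r v′ c → d :* (e :* v :- r :* v′ :+ c) := d :* (e :* v :+ c) :- r :* v′ :* d) refl d (d₀ * (1# - a)) v r v′ (γ a b m) ⟩
    d * (d₀ * (1# - a) * v + γ a b m) - r * v′ * d
      ≈⟨ +-congˡ (-‿cong (w-shift a b m)) ⟩
    d * (d₀ * (1# - a) * v + a * d₀ * (1# - x) * v) - d₀ * (1# - a * x) * (1# - a * (q * x)) * v
      ≈⟨ solve 6 (λ a b x q d₀ v →
           (con (+ 1) :- q :* (a :* b :* (x :* x))) :* (d₀ :* (con (+ 1) :- a) :* v :+ a :* d₀ :* (con (+ 1) :- x) :* v)
             :- d₀ :* (con (+ 1) :- a :* x) :* (con (+ 1) :- a :* (q :* x)) :* v :=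
           a :* d₀ :* (v :* ((con (+ 1) :- a :* x) :* (con (+ 1) :- b :* x) :* (q :* x))) :* con (+ 1) :* con (+ 1)) refl a b x q d₀ v ⟩
    -- The two trailing units make room for (1-qx)/(1-qx) and d/d: the inverses complete
    -- `w a b (suc m)`, and 1-qx is the factor that `γ` carries.
    a * d₀ * (v * ((1# - a * x) * (1# - b * x) * (q * x))) * 1# * 1#
      ≈⟨ *-cong (*-congˡ (I-law (suc m))) (DJ≈1 a b (suc m)) ⟨
    a * d₀ * (v * ((1# - a * x) * (1# - b * x) * (q * x))) * ((1# - q * x) * I (suc m)) * (d * J a b (suc m))
      ≈⟨ solve 7 (λ e v c u i d j → e :* (v :* c) :* (u :* i) :* (d :* j) := d :* (e :* u :* (v :* (c :* i :* j)))) refl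
           (a * d₀) v ((1# - a * x) * (1# - b * x) * (q * x)) (1# - q * x) (I (suc m)) d (J a b (suc m)) ⟩
    d * γ a b (suc m)  ∎)
    where
    x  = q ^ suc m
    d  = D a b (suc m)
    d₀ = D a b 0
    v  = w a b m
    v′ = w (a * (q * q)) b m
    r  = (1# - a * q) * (1# - a * (q * q))

  -- The telescoped sum leaves only boundary values of `γ`: aq at 0, which is the inhomogeneous
  -- term, and nothing at N, where `w` contains q^(N+1).
  W-contiguous : ∀ a b →
    D a b 0 * (1# - a) * W a b + a * q ≈ (1# - a * q) * (1# - a * (q * q)) * W (a * (q * q)) b
  W-contiguous a b = x-y≈0⇒x≈y (begin
    d₀ * (1# - a) * W a b + a * q - r * W (a * (q * q)) b
      ≈⟨ solve 3 (λ x y z → x :+ y :- z := x :- z :+ y) refl _ _ _ ⟩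
    d₀ * (1# - a) * W a b - r * W (a * (q * q)) b + a * q
      ≈⟨ +-cong (sym (trans (Σ-minus N _ _) (+-cong (Σ-*ˡ N _ _) (-‿cong (Σ-*ˡ N _ _))))) (sym γ-head) ⟩
    Σ< N (λ m → d₀ * (1# - a) * w a b m - r * w (a * (q * q)) b m) + γ a b 0
      ≈⟨ Σ-telescope N _ (γ a b) (γ-step a b) ⟩
    γ a b N
      ≈⟨ x*0≈0 (x*0≈0 (0*y≈0 (0*y≈0 (x*0≈0 (q^-vanish (ℕ.n≤1+n N)))))) ⟩
    0#  ∎)
    where
    d₀ = D a b 0
    r  = (1# - a * q) * (1# - a * (q * q))
    γ-head : γ a b 0 ≈ a * q
    γ-head = begin
      a * d₀ * (1# - q ^ 1) * (q * I 0 * J a b 0)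
        ≈⟨ solve 6 (λ a d u q i j → a :* d :* u :* (q :* i :* j) := a :* q :* (u :* i) :* (d :* j)) refl a d₀ (1# - q ^ 1) q (I 0) (J a b 0) ⟩
      a * q * ((1# - q ^ 1) * I 0) * (d₀ * J a b 0)
        ≈⟨ *-cong (*-congˡ (I-law 0)) (DJ≈1 a b 0) ⟩
      a * q * 1# * 1#
        ≈⟨ trans (*-identityʳ _) (*-identityʳ _) ⟩
      a * q  ∎

  -- The leading 1 of S absorbs the inhomogeneous term aq, so S satisfies a homogeneous first-order
  -- recurrence.
  S-contiguous : ∀ a b → D a b 0 * S a b ≈ (1# - a * q) * S (a * (q * q)) b
  S-contiguous a b = begin
    d₀ * (1# + (1# - a) * (1# - b) * W a b)
      ≈⟨ solve 5 (λ d a b q W → d :* (con (+ 1) :+ (con (+ 1) :- a) :* (con (+ 1) :- b) :* W) :=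
           d :- (con (+ 1) :- b) :* (a :* q) :+ (con (+ 1) :- b) :* (d :* (con (+ 1) :- a) :* W :+ a :* q)) refl d₀ a b q (W a b) ⟩
    d₀ - (1# - b) * (a * q) + (1# - b) * (d₀ * (1# - a) * W a b + a * q)
      ≈⟨ +-congˡ (*-congˡ (W-contiguous a b)) ⟩
    d₀ - (1# - b) * (a * q) + (1# - b) * ((1# - a * q) * (1# - a * (q * q)) * W (a * (q * q)) b)
      ≈⟨ solve 4 (λ a b q W → con (+ 1) :- q :* (a :* b :* (con (+ 1) :* con (+ 1))) :- (con (+ 1) :- b) :* (a :* q)
             :+ (con (+ 1) :- b) :* ((con (+ 1) :- a :* q) :* (con (+ 1) :- a :* (q :* q)) :* W) :=
           (con (+ 1) :- a :* q) :* (con (+ 1) :+ (con (+ 1) :- a :* (q :* q)) :* (con (+ 1) :- b) :* W)) refl a b q (W (a * (q * q)) b) ⟩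
    (1# - a * q) * S (a * (q * q)) b  ∎
    where d₀ = D a b 0

  -- One contiguous step in each argument, the second reached by symmetry, moves along the diagonal
  -- from y to yq².
  S-diagonal : ∀ y → (1# - q * (y * y)) * (1# - q * (q * q) * (y * y)) * S y y
                       ≈ (1# - y * q) * (1# - y * q) * S (y * (q * q)) (y * (q * q))
  S-diagonal y = begin
    (1# - q * (y * y)) * (1# - q * (q * q) * (y * y)) * S y y
      ≈⟨ solve 3 (λ q y s → (con (+ 1) :- q :* (y :* y)) :* (con (+ 1) :- q :* (q :* q) :* (y :* y)) :* s :=
           (con (+ 1) :- q :* (y :* (y :* (q :* q)) :* (con (+ 1) :* con (+ 1)))) :* ((con (+ 1) :- q :* (y :* y :* (con (+ 1) :* con (+ 1)))) :* s)) refl q y (S y y) ⟩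
    D y (y * (q * q)) 0 * (D y y 0 * S y y)
      ≈⟨ *-congˡ (trans (S-contiguous y y) (*-congˡ (S-sym _ _))) ⟩
    D y (y * (q * q)) 0 * ((1# - y * q) * S y (y * (q * q)))
      ≈⟨ solve 3 (λ d u s → d :* (u :* s) := u :* (d :* s)) refl _ _ _ ⟩
    (1# - y * q) * (D y (y * (q * q)) 0 * S y (y * (q * q)))
      ≈⟨ *-congˡ (S-contiguous y (y * (q * q))) ⟩
    (1# - y * q) * ((1# - y * q) * S (y * (q * q)) (y * (q * q)))
      ≈⟨ *-assoc _ _ _ ⟨
    (1# - y * q) * (1# - y * q) * S (y * (q * q)) (y * (q * q))  ∎

  -- The logarithmic derivative in a of the product formula at b = 1, with the factor 1-a not yet cancelled.
  V : Carrier → Carrier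
  V a = Σ< N (λ j → q * (q * q) ^ j * inv ((q * q) ^ j) * inv (a * (q * q) ^ j))

  -- At b = 1 the factor 1-aq stands on both sides of the contiguous relation and cancels, so (1-a)
  -- W(a,1) changes by aq/(1-aq) when a becomes aq². After N steps a has become 0, and the total
  -- `W 0# 1#` does not depend on the starting point. Comparing the starting points a and 1, the
  -- latter with vanishing factor 1-1, leaves a difference of two sums divisible by 1-a term by
  -- term.
  [1-a]W≈[1-a]V : ∀ a → (1# - a) * W a 1# ≈ (1# - a) * V a
  [1-a]W≈[1-a]V a = begin
    (1# - a) * W a 1#
      ≈⟨ solve 2 (λ x y → x := (y :+ x) :- y) refl _ _ ⟩
    Φ a + (1# - a) * W a 1# - Φ a
      ≈⟨ +-congʳ (trans (Φ-law a) (sym (Φ-law 1#))) ⟩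
    Φ 1# + (1# - 1#) * W 1# 1# - Φ a
      ≈⟨ solve 3 (λ x y z → x :+ (con (+ 1) :- con (+ 1)) :* y :- z := x :- z) refl _ _ _ ⟩
    Φ 1# - Φ a
      ≈⟨ Σ-minus N _ _ ⟨
    Σ< N (λ j → φ 1# j - φ a j)
      ≈⟨ Σ-cong N difference ⟩
    Σ< N (λ j → (1# - a) * (q * p ^ j * inv (p ^ j) * inv (a * p ^ j)))
      ≈⟨ Σ-*ˡ N _ _ ⟩
    (1# - a) * V a  ∎
    where
    p = q * q

    φ : Carrier → ℕ → Carrier
    φ a j = a * p ^ j * q * inv (a * p ^ j)

    Φ : Carrier → Carrier
    Φ a = Σ< N (φ a)

    p^N≈0 : p ^ N ≈ 0#
    p^N≈0 = [q*y]^N≈0 q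

    step : ∀ a j → φ a j + (1# - a * p ^ j) * W (a * p ^ j) 1# ≈ (1# - a * p ^ suc j) * W (a * p ^ suc j) 1#
    step a j = cancel-unit (inv-law y) (begin
      (1# - q * y) * (y * q * inv y + (1# - y) * W y 1#)
        ≈⟨ solve 5 (λ u y q v W → u :* (y :* q :* v :+ (con (+ 1) :- y) :* W) := u :* (con (+ 1) :- y) :* W :+ u :* v :* (y :* q)) refl (1# - q * y) y q (inv y) (W y 1#) ⟩
      (1# - q * y) * (1# - y) * W y 1# + (1# - q * y) * inv y * (y * q)
        ≈⟨ +-cong (*-congʳ (*-congʳ (solve 2 (λ q y → con (+ 1) :- q :* y := con (+ 1) :- q :* (y :* con (+ 1) :* (con (+ 1) :* con (+ 1)))) refl q y)))
                  (trans (*-congʳ (inv-law y)) (*-identityˡ _)) ⟩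
      D y 1# 0 * (1# - y) * W y 1# + y * q
        ≈⟨ W-contiguous y 1# ⟩
      (1# - y * q) * (1# - y * p) * W (y * p) 1#
        ≈⟨ *-cong (*-cong (1-cong (*-comm y q)) (1-cong yp)) (W-cong yp refl) ⟩
      (1# - q * y) * (1# - a * p ^ suc j) * W (a * p ^ suc j) 1#
        ≈⟨ *-assoc _ _ _ ⟩
      (1# - q * y) * ((1# - a * p ^ suc j) * W (a * p ^ suc j) 1#)  ∎)
      where
      y = a * p ^ j
      yp : y * p ≈ a * p ^ suc j
      yp = solve 3 (λ a z p → a :* z :* p := a :* (p :* z)) refl a (p ^ j) p

    Φ-law : ∀ a → Φ a + (1# - a) * W a 1# ≈ W 0# 1#
    Φ-law a = begin
      Φ a + (1# - a) * W a 1#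
        ≈⟨ +-congˡ (*-cong (1-cong (*-identityʳ a)) (W-cong (*-identityʳ a) refl)) ⟨
      Φ a + (1# - a * p ^ 0) * W (a * p ^ 0) 1#
        ≈⟨ Σ-telescope N (φ a) (λ j → (1# - a * p ^ j) * W (a * p ^ j) 1#) (step a) ⟩
      (1# - a * p ^ N) * W (a * p ^ N) 1#
        ≈⟨ *-cong (1-0≈1 (x*0≈0 p^N≈0)) (W-cong (x*0≈0 p^N≈0) refl) ⟩
      1# * W 0# 1#
        ≈⟨ *-identityˡ _ ⟩
      W 0# 1#  ∎

    difference : ∀ j → φ 1# j - φ a j ≈ (1# - a) * (q * p ^ j * inv (p ^ j) * inv (a * p ^ j))
    difference j = begin
      1# * z * q * inv (1# * z) - a * z * q * i′
        ≈⟨ +-congʳ (*-cong (*-congʳ (*-identityˡ z)) (inv-cong (*-identityˡ z))) ⟩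
      z * q * i - a * z * q * i′
        ≈⟨ solve 4 (λ x i′ i t → x :* i :- t :* i′ := x :* i :* con (+ 1) :- t :* i′ :* con (+ 1)) refl (z * q) i′ i (a * z * q) ⟩
      z * q * i * 1# - a * z * q * i′ * 1#
        ≈⟨ +-cong (*-congˡ (inv-law (a * z))) (-‿cong (*-congˡ (inv-law z))) ⟨
      z * q * i * ((1# - q * (a * z)) * i′) - a * z * q * i′ * ((1# - q * z) * i)
        ≈⟨ solve 5 (λ z q i i′ a → z :* q :* i :* ((con (+ 1) :- q :* (a :* z)) :* i′) :- a :* z :* q :* i′ :* ((con (+ 1) :- q :* z) :* i) :=
             (con (+ 1) :- a) :* (q :* z :* i :* i′)) refl z q i i′ a ⟩
      (1# - a) * (q * z * i * i′)  ∎
      where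
      z  = p ^ j
      i  = inv z
      i′ = inv (a * z)

-- Dual numbers, and the first-order term at a = 1

module DualNumbers (R : CommutativeRing 0ℓ 0ℓ) where
  open FiniteSums R

  dual : CommutativeRing 0ℓ 0ℓ
  dual = record
    { Carrier = Carrier × Carrier
    ; _≈_ = λ x y → (proj₁ x ≈ proj₁ y) × (proj₂ x ≈ proj₂ y)
    ; _+_ = λ x y → proj₁ x + proj₁ y , proj₂ x + proj₂ y
    ; _*_ = λ x y → proj₁ x * proj₁ y , proj₁ x * proj₂ y + proj₂ x * proj₁ y
    ; -_ = λ x → - proj₁ x , - proj₂ x
    ; 0# = 0# , 0#
    ; 1# = 1# , 0#
    ; isCommutativeRing = record
      { isRing = record
        { +-isAbelianGroup = record
          { isGroup = record
            { isMonoid = record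
              { isSemigroup = record
                { isMagma = record
                  { isEquivalence = record
                    { refl = refl , refl
                    ; sym = λ e → sym (proj₁ e) , sym (proj₂ e)
                    ; trans = λ e f → trans (proj₁ e) (proj₁ f) , trans (proj₂ e) (proj₂ f)
                    }
                  ; ∙-cong = λ e f → +-cong (proj₁ e) (proj₁ f) , +-cong (proj₂ e) (proj₂ f)
                  }
                ; assoc = λ x y z → +-assoc _ _ _ , +-assoc _ _ _
                }
              ; identity = (λ x → +-identityˡ _ , +-identityˡ _) , (λ x → +-identityʳ _ , +-identityʳ _)
              }
            ; inverse = (λ x → -‿inverseˡ _ , -‿inverseˡ _) , (λ x → -‿inverseʳ _ , -‿inverseʳ _)
            ; ⁻¹-cong = λ e → -‿cong (proj₁ e) , -‿cong (proj₂ e)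
            }
          ; comm = λ x y → +-comm _ _ , +-comm _ _
          }
        ; *-cong = λ e f → *-cong (proj₁ e) (proj₁ f)
                         , +-cong (*-cong (proj₁ e) (proj₂ f)) (*-cong (proj₂ e) (proj₁ f))
        ; *-assoc = λ x y z → *-assoc _ _ _ , solve 6 (λ a a′ b b′ c c′ →
            (a :* b) :* c′ :+ (a :* b′ :+ a′ :* b) :* c := a :* (b :* c′ :+ b′ :* c) :+ a′ :* (b :* c)) refl
            (proj₁ x) (proj₂ x) (proj₁ y) (proj₂ y) (proj₁ z) (proj₂ z)
        ; *-identity = (λ x → *-identityˡ _ , solve 2 (λ a a′ → con (+ 1) :* a′ :+ con (+ 0) :* a := a′) refl (proj₁ x) (proj₂ x))
                     , (λ x → *-identityʳ _ , solve 2 (λ a a′ → a :* con (+ 0) :+ a′ :* con (+ 1) := a′) refl (proj₁ x) (proj₂ x))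
        ; distrib = (λ x y z → distribˡ _ _ _ , solve 6 (λ a a′ b b′ c c′ →
                        a :* (b′ :+ c′) :+ a′ :* (b :+ c) := (a :* b′ :+ a′ :* b) :+ (a :* c′ :+ a′ :* c)) refl
                        (proj₁ x) (proj₂ x) (proj₁ y) (proj₂ y) (proj₁ z) (proj₂ z))
                  , (λ x y z → distribʳ _ _ _ , solve 6 (λ a a′ b b′ c c′ →
                        (b :+ c) :* a′ :+ (b′ :+ c′) :* a := (b :* a′ :+ b′ :* a) :+ (c :* a′ :+ c′ :* a)) refl
                        (proj₁ x) (proj₂ x) (proj₁ y) (proj₂ y) (proj₁ z) (proj₂ z))
        }
      ; *-comm = λ x y → *-comm _ _ , trans (+-comm _ _) (+-cong (*-comm _ _) (*-comm _ _))
      }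
    }

module Derivative (R : CommutativeRing 0ℓ 0ℓ) (q : CommutativeRing.Carrier R) (n : ℕ)
                  (q^N≈0 : CommutativeRing._≈_ R (FiniteSums._^_ R q (suc n)) (CommutativeRing.0# R))
                  where
  open FiniteSums R
  open DualNumbers R
  private module D = FiniteSums dual

  -- Setting ε = 0 commutes with each construction used; these lemmas carry the identity over the
  -- dual numbers back to R.
  proj₁-Σ : ∀ k (f : ℕ → D.Carrier) {f′ : ℕ → Carrier} → (∀ i → proj₁ (f i) ≈ f′ i) → proj₁ (D.Σ< k f) ≈ Σ< k f′
  proj₁-Σ zero    f eq = refl
  proj₁-Σ (suc k) f eq = +-cong (proj₁-Σ k f eq) (eq k)

  proj₁-^ : ∀ x {x′} → proj₁ x ≈ x′ → ∀ k → proj₁ (x D.^ k) ≈ x′ ^ k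
  proj₁-^ x eq zero    = refl
  proj₁-^ x eq (suc k) = *-cong eq (proj₁-^ x eq k)

  ιq : D.Carrier
  ιq = q , 0#

  ι-^ : ∀ k → (ιq D.^ k) D.≈ (q ^ k , 0#)
  ι-^ zero    = refl , refl
  ι-^ (suc k) = *-congˡ (proj₁ (ι-^ k))
              , trans (+-cong (x*0≈0 (proj₂ (ι-^ k))) (zeroˡ _)) (+-identityˡ _)

  ι-q^N≈0 : (ιq D.^ suc n) D.≈ D.0#
  ι-q^N≈0 = D.trans (ι-^ (suc n)) (q^N≈0 , refl)

  open Nilpotent R q n q^N≈0
  open RankMoment R q n q^N≈0 using (I)
  open GaussSecond R q n q^N≈0
  private
    module ND = Nilpotent dual ιq n ι-q^N≈0
    module RD = RankMoment dual ιq n ι-q^N≈0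
    module GD = GaussSecond dual ιq n ι-q^N≈0

  proj₁-inv : ∀ x {x′} → proj₁ x ≈ x′ → proj₁ (ND.inv x) ≈ inv x′
  proj₁-inv x eq = proj₁-Σ N _ (proj₁-^ (ιq D.* x) (*-congˡ eq))

  proj₁-I : ∀ k → proj₁ (RD.I k) ≈ I k
  proj₁-I k = proj₁-inv (ιq D.^ k) (proj₁-^ ιq refl k)

  proj₁-J : ∀ x y k → proj₁ (GD.J x y k) ≈ J (proj₁ x) (proj₁ y) k
  proj₁-J x y k = proj₁-inv (x D.* y D.* (ιq D.^ k D.* ιq D.^ k)) (*-congˡ (*-cong (proj₁-^ ιq refl k) (proj₁-^ ιq refl k)))

  proj₁-w : ∀ x y k → proj₁ (GD.w x y k) ≈ w (proj₁ x) (proj₁ y) k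
  proj₁-w x y zero    = *-cong (*-congˡ (proj₁-I 0)) (proj₁-J x y 0)
  proj₁-w x y (suc k) = *-cong (proj₁-w x y k)
    (*-cong (*-cong (*-cong (*-cong (1-cong (*-congˡ q^)) (1-cong (*-congˡ q^))) (proj₁-^ ιq refl (2 ℕ.+ k))) (proj₁-I (suc k)))
            (proj₁-J x y (suc k)))
    where q^ = proj₁-^ ιq refl (suc k)

  -- At a = 1 + ε the factor 1-a is -ε, and cancelling it from [1-a]W≈[1-a]V leaves the values at a = 1.
  W≈V : W 1# 1# ≈ V 1#
  W≈V = begin
    W 1# 1#                            ≈⟨ proj₁-Σ N (GD.w a D.1#) (proj₁-w a D.1#) ⟨
    proj₁ (GD.W a D.1#)                ≈⟨ cancel-ε (proj₂ (GD.[1-a]W≈[1-a]V a)) ⟩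
    proj₁ (GD.V a)                     ≈⟨ proj₁-Σ N _ (λ j → *-cong (*-cong (*-congˡ (p^ j)) (proj₁-inv (ιp D.^ j) (p^ j)))
                                                             (proj₁-inv (a D.* ιp D.^ j) (*-congˡ (p^ j)))) ⟩
    V 1#                               ∎
    where
    a ιp : D.Carrier
    a = 1# , 1#
    ιp = ιq D.* ιq
    p^ : ∀ j → proj₁ (ιp D.^ j) ≈ (q * q) ^ j
    p^ = proj₁-^ ιp refl
    cancel-ε : ∀ {x x′ y y′} → (1# - 1#) * x′ + (0# - 1#) * x ≈ (1# - 1#) * y′ + (0# - 1#) * y → x ≈ y
    cancel-ε {x} {x′} {y} {y′} eq = begin
      x  ≈⟨ solve 2 (λ x x′ → x := con (+ 0) :- ((con (+ 1) :- con (+ 1)) :* x′ :+ (con (+ 0) :- con (+ 1)) :* x)) refl x x′ ⟩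
      0# - ((1# - 1#) * x′ + (0# - 1#) * x)  ≈⟨ 1-cong′ eq ⟩
      0# - ((1# - 1#) * y′ + (0# - 1#) * y)
        ≈⟨ solve 2 (λ x x′ → x := con (+ 0) :- ((con (+ 1) :- con (+ 1)) :* x′ :+ (con (+ 0) :- con (+ 1)) :* x)) refl y y′ ⟨
      y  ∎
      where
      1-cong′ : ∀ {x y} → x ≈ y → 0# - x ≈ 0# - y
      1-cong′ e = +-congˡ (-‿cong e)

-- The sums of δ against A and against 1/(q)

module QIdentities (R : CommutativeRing 0ℓ 0ℓ) (q : CommutativeRing.Carrier R) (n : ℕ)
                   (q^N≈0 : CommutativeRing._≈_ R (FiniteSums._^_ R q (suc n)) (CommutativeRing.0# R))
                   where
  open FiniteSums R
  open Nilpotent R q n q^N≈0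
  open RankMoment R q n q^N≈0
  open GaussSecond R q n q^N≈0 hiding (D)
  open Derivative R q n q^N≈0 using (W≈V)

  p : Carrier
  p = q * q

  p^N≈0 : p ^ N ≈ 0#
  p^N≈0 = [q*y]^N≈0 q

  -- Since p = q·q is q times a ring element, p^N = 0 at the same precision, and everything known
  -- for q holds for q² in the same ring.
  module Base² = RankMoment R p n p^N≈0

  q^double : ∀ k → q ^ double k ≈ p ^ k
  q^double zero    = refl
  q^double (suc k) = trans (sym (*-assoc _ _ _)) (*-congˡ (q^double k))

  -- O k = (q;q²)_k, Q k = 1/(q;q²)_k, t k = q^(k(k-1)/2)
  O Q t A δ X : ℕ → Carrier
  O k = Π< k (λ l → 1# - q * (q ^ l * q ^ l))
  Q k = Π< k (λ l → inv (q ^ l * q ^ l))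
  t k = Π< k (q ^_)
  A k = t k * P k
  δ zero    = 0#
  δ (suc k) = F k * F k * q ^ suc k * Q (suc k)
  X e = Σ< N (λ m → δ (m ℕ.+ e) * A m)

  OQ≈1 : ∀ k → O k * Q k ≈ 1#
  OQ≈1 k = Π-inverse k _ _ (λ l → inv-law _)

  δ-vanish : ∀ {k} → N ≤ k → δ k ≈ 0#
  δ-vanish {suc k} N≤k = 0*y≈0 (x*0≈0 (q^-vanish N≤k))

  -- S(1,b) = 1, because its factor 1-a vanishes. One contiguous step in a gives S(q²,q²), and
  -- `S-diagonal` then advances both arguments by q², which is why only even exponents appear.
  -- Denominators stay on the left.
  S-even : ∀ i → F (suc (double i)) * F (suc (double i)) * S (p ^ suc i) (p ^ suc i)
                   ≈ O (double (suc i)) * (Base².F i * Base².F i)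
  S-even zero = begin
    F 1 * F 1 * S (p ^ 1) (p ^ 1)
      ≈⟨ *-congˡ (S-cong (solve 1 (λ q → q :* q :* con (+ 1) := con (+ 1) :* (q :* q)) refl q) refl) ⟩
    F 1 * F 1 * S (1# * (q * q)) (p ^ 1)
      ≈⟨ solve 2 (λ q s → con (+ 1) :* (con (+ 1) :- q :* con (+ 1)) :* (con (+ 1) :* (con (+ 1) :- q :* con (+ 1))) :* s :=
           (con (+ 1) :- q) :* ((con (+ 1) :- con (+ 1) :* q) :* s)) refl q _ ⟩
    (1# - q) * ((1# - 1# * q) * S (1# * (q * q)) (p ^ 1))
      ≈⟨ *-congˡ (S-contiguous 1# (p ^ 1)) ⟨
    (1# - q) * (GaussSecond.D R q n q^N≈0 1# (p ^ 1) 0 * S 1# (p ^ 1))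
      ≈⟨ solve 2 (λ q w → (con (+ 1) :- q) :* ((con (+ 1) :- q :* (con (+ 1) :* (q :* q :* con (+ 1)) :* (con (+ 1) :* con (+ 1))))
             :* (con (+ 1) :+ (con (+ 1) :- con (+ 1)) :* (con (+ 1) :- q :* q :* con (+ 1)) :* w)) :=
           con (+ 1) :* (con (+ 1) :- q :* (con (+ 1) :* con (+ 1))) :* (con (+ 1) :- q :* (q :* con (+ 1) :* (q :* con (+ 1)))) :* (con (+ 1) :* con (+ 1)))
           refl q (W 1# (p ^ 1)) ⟩
    O 2 * (Base².F 0 * Base².F 0)  ∎
  S-even (suc i) = begin
    F (3 ℕ.+ m) * F (3 ℕ.+ m) * S (p ^ (2 ℕ.+ i)) (p ^ (2 ℕ.+ i))
      ≈⟨ *-cong (*-cong F-step F-step) (S-cong (*-comm _ _) (*-comm _ _)) ⟩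
    f * (1# - y) * (1# - q * y) * (f * (1# - y) * (1# - q * y)) * S (y * p) (y * p)
      ≈⟨ solve 4 (λ f y q s → f :* (con (+ 1) :- y) :* (con (+ 1) :- q :* y) :* (f :* (con (+ 1) :- y) :* (con (+ 1) :- q :* y)) :* s :=
           f :* f :* ((con (+ 1) :- y) :* (con (+ 1) :- y)) :* ((con (+ 1) :- y :* q) :* (con (+ 1) :- y :* q) :* s)) refl f y q (S (y * p) (y * p)) ⟩
    f * f * ((1# - y) * (1# - y)) * ((1# - y * q) * (1# - y * q) * S (y * p) (y * p))
      ≈⟨ *-congˡ (S-diagonal y) ⟨
    f * f * ((1# - y) * (1# - y)) * ((1# - q * (y * y)) * (1# - q * (q * q) * (y * y)) * S y y)
      ≈⟨ solve 4 (λ a b c d → a :* b :* (c :* d) := a :* d :* (b :* c)) refl _ _ _ _ ⟩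
    f * f * S y y * ((1# - y) * (1# - y) * ((1# - q * (y * y)) * (1# - q * (q * q) * (y * y))))
      ≈⟨ *-congʳ (S-even i) ⟩
    O (2 ℕ.+ m) * (Base².F i * Base².F i) * ((1# - y) * (1# - y) * ((1# - q * (y * y)) * (1# - q * (q * q) * (y * y))))
      ≈⟨ solve 4 (λ o f y q → o :* (f :* f) :* ((con (+ 1) :- y) :* (con (+ 1) :- y) :* ((con (+ 1) :- q :* (y :* y)) :* (con (+ 1) :- q :* (q :* q) :* (y :* y)))) :=
           o :* (con (+ 1) :- q :* (y :* y)) :* (con (+ 1) :- q :* (q :* y :* (q :* y))) :* (f :* (con (+ 1) :- y) :* (f :* (con (+ 1) :- y)))) refl
           (O (2 ℕ.+ m)) (Base².F i) y q ⟩
    O (2 ℕ.+ m) * (1# - q * (y * y)) * (1# - q * (q * y * (q * y))) * (Base².F (suc i) * Base².F (suc i))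
      ≈⟨ *-congʳ (*-cong (*-congˡ (1-cong (*-congˡ (*-cong q^≈y q^≈y)))) (1-cong (*-congˡ (*-cong (*-congˡ q^≈y) (*-congˡ q^≈y))))) ⟨
    O (4 ℕ.+ m) * (Base².F (suc i) * Base².F (suc i))  ∎
    where
    m = double i
    y = p ^ suc i
    f = F (suc m)
    q^≈y : q ^ (2 ℕ.+ m) ≈ y
    q^≈y = q^double (suc i)
    F-step : F (3 ℕ.+ m) ≈ f * (1# - y) * (1# - q * y)
    F-step = *-cong (*-congˡ (1-cong q^≈y)) (1-cong (*-congˡ q^≈y))

  -- With a = b = q^e one has (q)_(m+e) = (q)_e (aq)_m and (q;q²)_(m+1+e) = (q;q²)_e (abq;q²)_(m+1).
  -- A shifted product of δ and A is thus a term of Gauss's series, up to a factor independent of m.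
  δA≈w : ∀ e m → δ (suc (m ℕ.+ e)) * A (suc m) ≈ F e * F e * q ^ e * Q e * w (q ^ e) (q ^ e) m
  δA≈w e zero = trans (*-congʳ (*-congˡ (*-congˡ (inv-cong (sym (trans (*-congˡ (*-identityˡ 1#)) (*-identityʳ _)))))))
    (solve 6 (λ f q y o j i → f :* f :* (q :* y) :* (o :* j) :* (con (+ 1) :* con (+ 1) :* (con (+ 1) :* i)) :=
       f :* f :* y :* o :* (q :* i :* j)) refl (F e) q (q ^ e) (Q e) (J (q ^ e) (q ^ e) 0) (I 0))
  δA≈w e (suc m) = begin
    F (suc k) * F (suc k) * (q * q ^ suc k) * (Q (suc k) * inv (q ^ suc k * q ^ suc k)) * (t (suc m) * x * (P (suc m) * I (suc m)))
      ≈⟨ *-congʳ (*-cong (*-congʳ (*-cong Fk Fk)) (*-congˡ (inv-cong (begin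
           q ^ suc k * q ^ suc k  ≈⟨ *-cong xy xy ⟩
           x * y * (x * y)        ≈⟨ solve 2 (λ x y → x :* y :* (x :* y) := y :* y :* (x :* x)) refl x y ⟩
           y * y * (x * x)        ∎)))) ⟩
    F k * (1# - y * x) * (F k * (1# - y * x)) * (q * q ^ suc k) * (Q (suc k) * J y y (suc m)) * (t (suc m) * x * (P (suc m) * I (suc m)))
      ≈⟨ solve 10 (λ f u q z o j t x p i → f :* u :* (f :* u) :* (q :* z) :* (o :* j) :* (t :* x :* (p :* i)) :=
           f :* f :* z :* o :* (t :* p) :* (u :* u :* (q :* x) :* i :* j)) refl
           (F k) (1# - y * x) q (q ^ suc k) (Q (suc k)) (J y y (suc m)) (t (suc m)) x (P (suc m)) (I (suc m)) ⟩
    δ (suc k) * A (suc m) * ratio y y (suc m)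
      ≈⟨ *-congʳ (δA≈w e m) ⟩
    F e * F e * q ^ e * Q e * w y y m * ratio y y (suc m)
      ≈⟨ *-assoc _ _ _ ⟩
    F e * F e * q ^ e * Q e * w y y (suc m)  ∎
    where
    k = m ℕ.+ e
    x = q ^ suc m
    y = q ^ e
    xy : q ^ suc k ≈ x * y
    xy = ^-homo-* q (suc m) e
    Fk : F (suc k) ≈ F k * (1# - y * x)
    Fk = *-congˡ (1-cong (trans xy (*-comm x y)))

  ΣδA≈W : Σ< N (λ m → δ m * A m) ≈ W 1# 1#
  ΣδA≈W = begin
    Σ< N (λ m → δ m * A m)
      ≈⟨ Σ-shift N _ (0*y≈0 (δ-vanish ℕ.≤-refl)) ⟩
    0# * A 0 + Σ< N (λ m → δ (suc m) * A (suc m))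
      ≈⟨ trans (+-congʳ (zeroˡ _)) (+-identityˡ _) ⟩
    Σ< N (λ m → δ (suc m) * A (suc m))
      ≈⟨ Σ-cong N (λ m → begin
           δ (suc m) * A (suc m)           ≡⟨ ≡.cong (λ k → δ (suc k) * A (suc m)) (ℕ.+-identityʳ m) ⟨
           δ (suc (m ℕ.+ 0)) * A (suc m)   ≈⟨ δA≈w 0 m ⟩
           1# * 1# * 1# * 1# * w 1# 1# m
             ≈⟨ solve 1 (λ w → con (+ 1) :* con (+ 1) :* con (+ 1) :* con (+ 1) :* w := w) refl _ ⟩
           w 1# 1# m  ∎) ⟩
    W 1# 1#  ∎

  -- The term m = 0 supplies the leading 1 of S. In the others, (q)_(e+1)² exceeds the (q)_e² of
  -- `δ (suc e)` by (1-q^(e+1))², which is the factor (1-a)(1-b).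
  X≈δS : ∀ e → X (suc e) ≈ δ (suc e) * S (q ^ suc e) (q ^ suc e)
  X≈δS e = begin
    X (suc e)
      ≈⟨ Σ-shift N _ (0*y≈0 (δ-vanish (ℕ.m≤m+n N (suc e)))) ⟩
    δ (suc e) * (1# * 1#) + Σ< N (λ m → δ (suc (m ℕ.+ suc e)) * A (suc m))
      ≈⟨ +-congˡ (trans (Σ-cong N (δA≈w (suc e))) (Σ-*ˡ N _ _)) ⟩
    δ (suc e) * (1# * 1#) + F (suc e) * F (suc e) * y * Q (suc e) * W y y
      ≈⟨ solve 4 (λ f y o w → f :* f :* y :* o :* (con (+ 1) :* con (+ 1)) :+ f :* (con (+ 1) :- y) :* (f :* (con (+ 1) :- y)) :* y :* o :* w :=
           f :* f :* y :* o :* (con (+ 1) :+ (con (+ 1) :- y) :* (con (+ 1) :- y) :* w)) refl (F e) y (Q (suc e)) (W y y) ⟩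
    δ (suc e) * S y y  ∎
    where y = q ^ suc e

  X-even : ∀ i → X (double (suc i)) ≈ p ^ suc i * (Base².F i * Base².F i)
  X-even i = begin
    X (2 ℕ.+ m)
      ≈⟨ X≈δS (suc m) ⟩
    F (suc m) * F (suc m) * q ^ (2 ℕ.+ m) * Q (2 ℕ.+ m) * S (q ^ (2 ℕ.+ m)) (q ^ (2 ℕ.+ m))
      ≈⟨ *-cong (*-congʳ (*-congˡ (q^double (suc i)))) (S-cong (q^double (suc i)) (q^double (suc i))) ⟩
    F (suc m) * F (suc m) * y * Q (2 ℕ.+ m) * S y y
      ≈⟨ solve 4 (λ f y o s → f :* y :* o :* s := f :* s :* (y :* o)) refl _ _ _ _ ⟩
    F (suc m) * F (suc m) * S y y * (y * Q (2 ℕ.+ m))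
      ≈⟨ *-congʳ (S-even i) ⟩
    O (2 ℕ.+ m) * (Base².F i * Base².F i) * (y * Q (2 ℕ.+ m))
      ≈⟨ solve 4 (λ o f y r → o :* f :* (y :* r) := o :* r :* (y :* f)) refl _ _ _ _ ⟩
    O (2 ℕ.+ m) * Q (2 ℕ.+ m) * (y * (Base².F i * Base².F i))
      ≈⟨ trans (*-congʳ (OQ≈1 (2 ℕ.+ m))) (*-identityˡ _) ⟩
    y * (Base².F i * Base².F i)  ∎
    where
    m = double i
    y = p ^ suc i

  -- Sequences are read as coefficients of power series in an auxiliary z. Then `sh` is
  -- multiplication by z, `sh² j` multiplication by z^(2j), and `C` comes from `A` by z ↦ qz.
  sh : (ℕ → Carrier) → ℕ → Carrier
  sh B zero    = 0#
  sh B (suc m) = B m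

  sh² : ℕ → (ℕ → Carrier) → ℕ → Carrier
  sh² zero    B = B
  sh² (suc j) B = sh (sh (sh² j B))

  C : ℕ → Carrier
  C m = q ^ m * A m

  q^*sh² : ∀ j m → q ^ m * sh² j A m ≈ p ^ j * sh² j C m
  q^*sh² zero    m             = sym (*-identityˡ _)
  q^*sh² (suc j) zero          = trans (zeroʳ _) (sym (zeroʳ _))
  q^*sh² (suc j) (suc zero)    = trans (zeroʳ _) (sym (zeroʳ _))
  q^*sh² (suc j) (suc (suc m)) = begin
    q * (q * q ^ m) * sh² j A m  ≈⟨ solve 3 (λ q x a → q :* (q :* x) :* a := q :* q :* (x :* a)) refl q _ _ ⟩
    p * (q ^ m * sh² j A m)      ≈⟨ *-congˡ (q^*sh² j m) ⟩
    p * (p ^ j * sh² j C m)      ≈⟨ *-assoc _ _ _ ⟨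
    p ^ suc j * sh² j C m        ∎

  -- The functional equation A(z) = (1+z) A(qz) of (-z;q)_∞ = Σ A_m z^m.
  A-split : ∀ m → A m ≈ sh C m + C m
  A-split zero    = solve 0 (con (+ 1) :* con (+ 1) := con (+ 0) :+ con (+ 1) :* (con (+ 1) :* con (+ 1))) refl
  A-split (suc m) = begin
    t m * q ^ m * (P m * I m)
      ≈⟨ solve 5 (λ t x p i y → t :* x :* (p :* i) := x :* (t :* p) :* ((con (+ 1) :- y) :* i) :+ y :* (t :* x :* (p :* i))) refl (t m) (q ^ m) (P m) (I m) (q ^ suc m) ⟩
    q ^ m * (t m * P m) * ((1# - q ^ suc m) * I m) + C (suc m)
      ≈⟨ +-congʳ (trans (*-congˡ (I-law m)) (*-identityʳ _)) ⟩
    C m + C (suc m)  ∎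

  sh²A-split : ∀ j m → sh² j A m ≈ sh (sh² j C) m + sh² j C m
  sh²A-split zero    m             = A-split m
  sh²A-split (suc j) zero          = sym (+-identityˡ _)
  sh²A-split (suc j) (suc zero)    = sym (+-identityˡ _)
  sh²A-split (suc j) (suc (suc zero))    = sh²A-split j zero
  sh²A-split (suc j) (suc (suc (suc m))) = sh²A-split j (suc m)

  sh²-vanish : ∀ j B m → m < double j → sh² j B m ≈ 0#
  sh²-vanish (suc j) B zero          m<    = refl
  sh²-vanish (suc j) B (suc zero)    m<    = refl
  sh²-vanish (suc j) B (suc (suc m)) (s≤s (s≤s m<)) = sh²-vanish j B m m<

  conv : ℕ → ℕ → Carrier
  conv k m = Σ< k (λ j → sh² j A m * Base².P j)

  -- The coefficient form of (1-z) G(z) = G(qz) for G(z) = (-z;q)_∞/(z²;q²)_∞. The factor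
  -- 1/(z²;q²)_∞ is cut to k+1 terms, and the bound on m keeps the omitted power z^(2k+2) out of
  -- sight.
  conv-step : ∀ k m → suc m < double (suc k) →
              (1# - q ^ suc m) * conv (suc k) (suc m) ≈ conv (suc k) m
  conv-step k m m< = begin
    (1# - q ^ suc m) * conv (suc k) (suc m)
      ≈⟨ trans (sym (Σ-*ˡ (suc k) _ _)) (Σ-cong (suc k) term) ⟩
    Σ< (suc k) (λ j → sh² j C m * Base².P j + (1# - p ^ j) * (sh² j C (suc m) * Base².P j))
      ≈⟨ trans (Σ-+ (suc k) _ _) (+-congˡ (Σ-head k _)) ⟩
    Σ< (suc k) (λ j → sh² j C m * Base².P j)
      + ((1# - 1#) * (C (suc m) * 1#) + Σ< k (λ j → (1# - p ^ suc j) * (sh (sh² j C) m * Base².P (suc j))))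
      ≈⟨ +-congˡ (trans (+-cong (0*y≈0 (-‿inverseʳ 1#)) (Σ-cong k cancel)) (+-identityˡ _)) ⟩
    Σ< (suc k) (λ j → sh² j C m * Base².P j) + Σ< k (λ j → sh (sh² j C) m * Base².P j)
      ≈⟨ +-congˡ (+-elimʳ (0*y≈0 (sh²-vanish (suc k) C (suc m) m<))) ⟨
    Σ< (suc k) (λ j → sh² j C m * Base².P j) + Σ< (suc k) (λ j → sh (sh² j C) m * Base².P j)
      ≈⟨ Σ-+ (suc k) _ _ ⟨
    Σ< (suc k) (λ j → sh² j C m * Base².P j + sh (sh² j C) m * Base².P j)
      ≈⟨ Σ-cong (suc k) (λ j → trans (+-comm _ _) (trans (sym (distribʳ _ _ _)) (*-congʳ (sym (sh²A-split j m))))) ⟩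
    conv (suc k) m  ∎
    where
    term : ∀ j → (1# - q ^ suc m) * (sh² j A (suc m) * Base².P j)
                   ≈ sh² j C m * Base².P j + (1# - p ^ j) * (sh² j C (suc m) * Base².P j)
    term j = begin
      (1# - q ^ suc m) * (a * Base².P j)
        ≈⟨ solve 3 (λ y a e → (con (+ 1) :- y) :* (a :* e) := (a :- y :* a) :* e) refl (q ^ suc m) a (Base².P j) ⟩
      (a - q ^ suc m * a) * Base².P j
        ≈⟨ *-congʳ (+-cong (sh²A-split j (suc m)) (-‿cong (q^*sh² j (suc m)))) ⟩
      (sh² j C m + sh² j C (suc m) - p ^ j * sh² j C (suc m)) * Base².P j
        ≈⟨ solve 4 (λ b c z e → (b :+ c :- z :* c) :* e := b :* e :+ (con (+ 1) :- z) :* (c :* e)) refl (sh² j C m) (sh² j C (suc m)) (p ^ j) (Base².P j) ⟩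
      sh² j C m * Base².P j + (1# - p ^ j) * (sh² j C (suc m) * Base².P j)  ∎
      where a = sh² j A (suc m)
    cancel : ∀ j → (1# - p ^ suc j) * (sh (sh² j C) m * Base².P (suc j)) ≈ sh (sh² j C) m * Base².P j
    cancel j = begin
      (1# - p ^ suc j) * (sh (sh² j C) m * (Base².P j * Base².I j))
        ≈⟨ solve 4 (λ u s e i → u :* (s :* (e :* i)) := s :* e :* (u :* i)) refl _ _ _ _ ⟩
      sh (sh² j C) m * Base².P j * ((1# - p ^ suc j) * Base².I j)
        ≈⟨ trans (*-congˡ (Base².I-law j)) (*-identityʳ _) ⟩
      sh (sh² j C) m * Base².P j  ∎

  -- The coefficients of (-z;q)_∞ · 1/(z²;q²)_∞ = 1/(z;q)_∞.
  conv≈P : ∀ k m → m < double (suc k) → conv (suc k) m ≈ P m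
  conv≈P k zero    m< = trans (Σ-only-head k _ (λ j _ → zeroˡ _))
    (solve 0 (con (+ 1) :* con (+ 1) :* con (+ 1) := con (+ 1)) refl)
  conv≈P k (suc m) m< = cancel-unit (I-law m) (begin
    (1# - q ^ suc m) * conv (suc k) (suc m)  ≈⟨ conv-step k m m< ⟩
    conv (suc k) m                           ≈⟨ conv≈P k m (ℕ.<-trans ℕ.≤-refl m<) ⟩
    P m                                      ≈⟨ trans (*-congˡ (I-law m)) (*-identityʳ _) ⟨
    P m * ((1# - q ^ suc m) * I m)           ≈⟨ solve 3 (λ p u i → p :* (u :* i) := u :* (p :* i)) refl _ _ _ ⟩
    (1# - q ^ suc m) * P (suc m)             ∎)

  Σ-sh : ∀ (ψ : ℕ → Carrier) → ψ N ≈ 0# → ∀ B → Σ< N (λ m → ψ m * sh B m) ≈ Σ< N (λ m → ψ (suc m) * B m)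
  Σ-sh ψ ψN≈0 B = trans (Σ-shift N _ (0*y≈0 ψN≈0)) (trans (+-congʳ (zeroʳ _)) (+-identityˡ _))

  -- The shift passes from `B` to `ψ`; nothing is lost at the upper end, since `ψ` is zero from N
  -- on.
  Σ-sh² : ∀ j (ψ : ℕ → Carrier) → (∀ {k} → N ≤ k → ψ k ≈ 0#) → ∀ B →
          Σ< N (λ m → ψ m * sh² j B m) ≈ Σ< N (λ m → ψ (double j ℕ.+ m) * B m)
  Σ-sh² zero    ψ ψ≈0 B = refl
  Σ-sh² (suc j) ψ ψ≈0 B = trans (Σ-sh ψ (ψ≈0 ℕ.≤-refl) _)
    (trans (Σ-sh (λ m → ψ (suc m)) (ψ≈0 (ℕ.n≤1+n N)) _)
           (Σ-sh² j (λ m → ψ (2 ℕ.+ m)) (λ N≤k → ψ≈0 (ℕ.m≤n⇒m≤1+n (ℕ.m≤n⇒m≤1+n N≤k))) B))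

  n<double : ∀ m → m < N → m < double N
  n<double m m<N rewrite double≡+ N = ℕ.≤-trans m<N (ℕ.m≤m+n N N)

  ΣδP-expand : Σ< N (λ m → δ m * P m) ≈ Σ< N (λ j → Base².P j * X (double j))
  ΣδP-expand = begin
    Σ< N (λ m → δ m * P m)
      ≈⟨ Σ-cong< N (λ m m<N → *-congˡ (sym (conv≈P n m (n<double m m<N)))) ⟩
    Σ< N (λ m → δ m * conv N m)
      ≈⟨ Σ-cong N (λ m → sym (Σ-*ˡ N (δ m) _)) ⟩
    Σ< N (λ m → Σ< N (λ j → δ m * (sh² j A m * Base².P j)))
      ≈⟨ Σ-swap N N _ ⟩
    Σ< N (λ j → Σ< N (λ m → δ m * (sh² j A m * Base².P j)))
      ≈⟨ Σ-cong N (λ j → trans (Σ-cong N (λ m → solve 3 (λ d a e → d :* (a :* e) := e :* (d :* a)) refl _ _ _)) (Σ-*ˡ N (Base².P j) _)) ⟩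
    Σ< N (λ j → Base².P j * Σ< N (λ m → δ m * sh² j A m))
      ≈⟨ Σ-cong N (λ j → *-congˡ (trans (Σ-sh² j δ δ-vanish A)
           (Σ-cong N (λ m → *-congʳ (≡⇒≈ (≡.cong δ (ℕ.+-comm (double j) m))))))) ⟩
    Σ< N (λ j → Base².P j * X (double j))  ∎

  -- The terms of `V 1#` are those of `g` with odd exponent. The even exponents reproduce the same
  -- series in q², and the terms between N and 2N vanish.
  odd-part : V 1# ≈ g N - Base².g N
  odd-part = begin
    V 1#
      ≈⟨ Σ-cong N (λ i → *-cong (*-cong (*-congˡ (sym (q^double i))) (inv-cong (sym (q^double i))))
                                (inv-cong (trans (*-identityˡ _) (sym (q^double i))))) ⟩
    Σ< N (λ i → f (double i))
      ≈⟨ solve 2 (λ a b → a := (a :+ b) :- b) refl _ _ ⟩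
    Σ< N (λ i → f (double i)) + Σ< N (λ i → f (suc (double i))) - Σ< N (λ i → f (suc (double i)))
      ≈⟨ +-cong (Σ-double N f) (-‿cong (Σ-cong N even)) ⟨
    Σ< (double N) f - Base².g N
      ≈⟨ +-congʳ (trans (≡⇒≈ (≡.cong (λ k → Σ< k f) (double≡+ N)))
                        (Σ-extend N N f (λ i N≤i → 0*y≈0 (0*y≈0 (q^-vanish (ℕ.m≤n⇒m≤1+n N≤i)))))) ⟩
    g N - Base².g N  ∎
    where
    f : ℕ → Carrier
    f j = c j * I j
    even : ∀ i → Base².c i * Base².I i ≈ f (suc (double i))
    even i = *-cong (*-cong (sym (q^double (suc i))) I≈) I≈
      where
      I≈ : Base².I i ≈ I (suc (double i))
      I≈ = inverse-unique (Base².I-law i) (trans (*-congʳ (1-cong (sym (q^double (suc i))))) (I-law (suc (double i))))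

  ΣδA : Σ< N (λ m → δ m * A m) ≈ g N - Base².g N
  ΣδA = trans ΣδA≈W (trans W≈V odd-part)

  ΣδP : Σ< N (λ m → δ m * P m) ≈ g N - Base².g N + Base².T
  ΣδP = begin
    Σ< N (λ m → δ m * P m)
      ≈⟨ ΣδP-expand ⟩
    Σ< N (λ j → Base².P j * X (double j))
      ≈⟨ Σ-shift N _ (x*0≈0 (trans (X-even n) (0*y≈0 p^N≈0))) ⟩
    1# * X 0 + Σ< N (λ j → Base².P (suc j) * X (double (suc j)))
      ≈⟨ +-cong (trans (*-identityˡ _) (Σ-cong N (λ m → *-congʳ (≡⇒≈ (≡.cong δ (ℕ.+-identityʳ m)))))) (Σ-cong N term) ⟩
    Σ< N (λ m → δ m * A m) + Base².T
      ≈⟨ +-congʳ ΣδA ⟩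
    g N - Base².g N + Base².T  ∎
    where
    term : ∀ j → Base².P (suc j) * X (double (suc j)) ≈ Base².F j * Base².c j
    term j = begin
      Base².P j * Base².I j * X (double (suc j))
        ≈⟨ *-congˡ (X-even j) ⟩
      Base².P j * Base².I j * (p ^ suc j * (Base².F j * Base².F j))
        ≈⟨ solve 4 (λ e i y f → e :* i :* (y :* (f :* f)) := f :* e :* (f :* (y :* i))) refl (Base².P j) (Base².I j) (p ^ suc j) (Base².F j) ⟩
      Base².F j * Base².P j * (Base².F j * Base².c j)
        ≈⟨ trans (*-congʳ (Base².FP≈1 j)) (*-identityˡ _) ⟩
      Base².F j * Base².c j  ∎

-- Sums over partitions, built up by largest part

module PartitionSums (R : CommutativeRing 0ℓ 0ℓ) (q : CommutativeRing.Carrier R) (n : ℕ)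
                     (q^N≈0 : CommutativeRing._≈_ R (FiniteSums._^_ R q (suc n)) (CommutativeRing.0# R))
                     where
  open FiniteSums R
  open Nilpotent R q n q^N≈0
  open RankMoment R q n q^N≈0

  ΣL : {A : Set} → (A → Carrier) → List A → Carrier
  ΣL φ []       = 0#
  ΣL φ (x ∷ xs) = φ x + ΣL φ xs

  ΣL-cong : {A : Set} {φ ψ : A → Carrier} → (∀ x → φ x ≈ ψ x) → ∀ xs → ΣL φ xs ≈ ΣL ψ xs
  ΣL-cong eq []       = refl
  ΣL-cong eq (x ∷ xs) = +-cong (eq x) (ΣL-cong eq xs)

  ΣL-+ : {A : Set} (φ ψ : A → Carrier) → ∀ xs → ΣL (λ x → φ x + ψ x) xs ≈ ΣL φ xs + ΣL ψ xs
  ΣL-+ φ ψ []       = sym (+-identityˡ 0#)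
  ΣL-+ φ ψ (x ∷ xs) = trans (+-congˡ (ΣL-+ φ ψ xs))
    (solve 4 (λ a b c d → (a :+ b) :+ (c :+ d) := (a :+ c) :+ (b :+ d)) refl _ _ _ _)

  ΣL-*ˡ : {A : Set} (c : Carrier) (φ : A → Carrier) → ∀ xs → ΣL (λ x → c * φ x) xs ≈ c * ΣL φ xs
  ΣL-*ˡ c φ []       = sym (zeroʳ c)
  ΣL-*ˡ c φ (x ∷ xs) = trans (+-congˡ (ΣL-*ˡ c φ xs)) (sym (distribˡ c _ _))

  ΣL-++ : {A : Set} (φ : A → Carrier) → ∀ xs ys → ΣL φ (xs ++ ys) ≈ ΣL φ xs + ΣL φ ys
  ΣL-++ φ []       ys = sym (+-identityˡ _)
  ΣL-++ φ (x ∷ xs) ys = trans (+-congˡ (ΣL-++ φ xs ys)) (sym (+-assoc _ _ _))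

  ΣL-map : {A B : Set} (φ : B → Carrier) (f : A → B) → ∀ xs → ΣL φ (map f xs) ≈ ΣL (λ x → φ (f x)) xs
  ΣL-map φ f []       = refl
  ΣL-map φ f (x ∷ xs) = +-congˡ (ΣL-map φ f xs)

  ΣL-concatMap : {A B : Set} (φ : B → Carrier) (f : A → List B) → ∀ xs →
                 ΣL φ (concatMap f xs) ≈ ΣL (λ x → ΣL φ (f x)) xs
  ΣL-concatMap φ f []       = refl
  ΣL-concatMap φ f (x ∷ xs) = trans (ΣL-++ φ (f x) _) (+-congˡ (ΣL-concatMap φ f xs))

  ΣL-filter : {A : Set} {P : Pred A 0ℓ} (P? : Decidable P) (φ : A → Carrier) → ∀ xs →
              ΣL φ (filter P? xs) ≈ ΣL (λ x → if does (P? x) then φ x else 0#) xs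
  ΣL-filter P? φ [] = refl
  ΣL-filter P? φ (x ∷ xs) with does (P? x)
  ... | true  = +-congˡ (ΣL-filter P? φ xs)
  ... | false = trans (ΣL-filter P? φ xs) (sym (+-identityˡ _))

  ΣL-applyUpTo : {A : Set} (φ : A → Carrier) (f : ℕ → A) → ∀ k → ΣL φ (applyUpTo f k) ≈ Σ< k (λ i → φ (f i))
  ΣL-applyUpTo φ f zero    = refl
  ΣL-applyUpTo φ f (suc k) = trans (+-congˡ (ΣL-applyUpTo φ (λ i → f (suc i)) k)) (sym (Σ-head k _))

  -- The filter in `partsLE` becomes this shift by s, the coefficient form of multiplication by q^s.
  guarded : (ℕ → Carrier) → ℕ → ℕ → Carrier
  guarded ψ s m = if does (s ℕ.≤? m) then ψ (m ℕ.∸ s) else 0#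

  guarded-vanish : ∀ ψ {s m} → m < s → guarded ψ s m ≈ 0#
  guarded-vanish ψ {s} {m} m<s rewrite dec-false (s ℕ.≤? m) (ℕ.<⇒≱ m<s) = refl

  guarded-suc : ∀ ψ s m → guarded ψ (suc s) (suc m) ≈ guarded ψ s m
  guarded-suc ψ zero    m = refl
  guarded-suc ψ (suc s) m = refl

  Σ-guarded : ∀ ψ s → Σ< N (λ m → q ^ m * guarded ψ s m) ≈ q ^ s * Σ< N (λ m → q ^ m * ψ m)
  Σ-guarded ψ zero    = sym (*-identityˡ _)
  Σ-guarded ψ (suc s) = begin
    Σ< N (λ m → q ^ m * guarded ψ (suc s) m)
      ≈⟨ trans (Σ-shift N _ (0*y≈0 q^N≈0)) (trans (+-congʳ (zeroʳ _)) (+-identityˡ _)) ⟩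
    Σ< N (λ m → q * q ^ m * guarded ψ (suc s) (suc m))
      ≈⟨ Σ-cong N (λ m → trans (*-congˡ (guarded-suc ψ s m)) (*-assoc _ _ _)) ⟩
    Σ< N (λ m → q * (q ^ m * guarded ψ s m))
      ≈⟨ trans (Σ-*ˡ N q _) (*-congˡ (Σ-guarded ψ s)) ⟩
    q * (q ^ s * Σ< N (λ m → q ^ m * ψ m))
      ≈⟨ *-assoc _ _ _ ⟨
    q ^ suc s * Σ< N (λ m → q ^ m * ψ m)  ∎

  addParts : ℕ → ℕ → List ℕ → List ℕ
  addParts j k λp = replicate j (suc k) ++ λp

  partsΣ : ℕ → ℕ → (List ℕ → Carrier) → Carrier
  partsΣ k m φ = ΣL φ (partsLE k m)

  partsΣ-suc : ∀ k m φ → partsΣ (suc k) m φ ≈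
    Σ< (suc m) (λ j → guarded (λ m′ → partsΣ k m′ (λ λp → φ (addParts j k λp))) (j ℕ.* suc k) m)
  partsΣ-suc k m φ = begin
    partsΣ (suc k) m φ
      ≈⟨ ΣL-concatMap φ (λ j → map (addParts j k) (partsLE k (m ℕ.∸ j ℕ.* suc k))) (filter fits? (applyUpTo (λ i → i) (suc m))) ⟩
    ΣL (λ j → ΣL φ (map (addParts j k) (partsLE k (m ℕ.∸ j ℕ.* suc k)))) (filter fits? (applyUpTo (λ i → i) (suc m)))
      ≈⟨ ΣL-cong (λ j → ΣL-map φ (addParts j k) (partsLE k (m ℕ.∸ j ℕ.* suc k))) (filter fits? (applyUpTo (λ i → i) (suc m))) ⟩
    ΣL (λ j → partsΣ k (m ℕ.∸ j ℕ.* suc k) (λ λp → φ (addParts j k λp))) (filter fits? (applyUpTo (λ i → i) (suc m)))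
      ≈⟨ ΣL-filter fits? _ (applyUpTo (λ i → i) (suc m)) ⟩
    _ ≈⟨ ΣL-applyUpTo _ (λ i → i) (suc m) ⟩
    _ ∎
    where
    fits? = λ j → j ℕ.* suc k ℕ.≤? m

  j≤j*sk : ∀ j k → j ≤ j ℕ.* suc k
  j≤j*sk j k = ℕ.m≤m*n j (suc k)

  Σ-extend≤ : ∀ {a b} → a ≤ b → ∀ f → (∀ i → a ≤ i → f i ≈ 0#) → Σ< b f ≈ Σ< a f
  Σ-extend≤ {a} {b} a≤b f eq = trans (≡⇒≈ (≡.cong (λ k → Σ< k f) (≡.sym (ℕ.m∸n+n≡m a≤b)))) (Σ-extend (b ℕ.∸ a) a f eq)

  -- The sum of φ(λ) q^|λ| over partitions λ with parts at most k, modulo q^N.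
  Ŝ : ℕ → (List ℕ → Carrier) → Carrier
  Ŝ k φ = Σ< N (λ m → q ^ m * partsΣ k m φ)

  -- Partitions are classified by the multiplicity j of the part k+1. For the sums to be exchanged,
  -- j must range independently of the size m; the added terms vanish because j(k+1) > m there.
  Ŝ-suc : ∀ k φ → Ŝ (suc k) φ ≈ Σ< N (λ j → (q ^ suc k) ^ j * Ŝ k (λ λp → φ (addParts j k λp)))
  Ŝ-suc k φ = begin
    Ŝ (suc k) φ
      ≈⟨ Σ-cong< N (λ m m<N → *-congˡ (trans (partsΣ-suc k m φ) (sym (Σ-extend≤ m<N _ (λ j m<j →
           guarded-vanish (ψ j) (ℕ.<-≤-trans m<j (j≤j*sk j k))))))) ⟩
    Σ< N (λ m → q ^ m * Σ< N (λ j → guarded (ψ j) (j ℕ.* suc k) m))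
      ≈⟨ Σ-cong N (λ m → sym (Σ-*ˡ N _ _)) ⟩
    Σ< N (λ m → Σ< N (λ j → q ^ m * guarded (ψ j) (j ℕ.* suc k) m))
      ≈⟨ Σ-swap N N _ ⟩
    Σ< N (λ j → Σ< N (λ m → q ^ m * guarded (ψ j) (j ℕ.* suc k) m))
      ≈⟨ Σ-cong N (λ j → trans (Σ-guarded (ψ j) (j ℕ.* suc k)) (*-congʳ (trans
           (≡⇒≈ (≡.cong (q ^_) (ℕ.*-comm j (suc k)))) (sym (^-assocʳ q (suc k) j))))) ⟩
    Σ< N (λ j → (q ^ suc k) ^ j * Ŝ k (λ λp → φ (addParts j k λp)))  ∎
    where
    ψ : ℕ → ℕ → Carrier
    ψ j m = partsΣ k m (λ λp → φ (addParts j k λp))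

  Ŝ-zero : ∀ φ → Ŝ 0 φ ≈ φ []
  Ŝ-zero φ = trans (Σ-only-head n _ (λ _ _ → zeroʳ _)) (trans (*-identityˡ _) (+-identityʳ _))

  Ŝ-cong : ∀ k {φ ψ : List ℕ → Carrier} → (∀ λp → φ λp ≈ ψ λp) → Ŝ k φ ≈ Ŝ k ψ
  Ŝ-cong k eq = Σ-cong N (λ m → *-congˡ (ΣL-cong eq (partsLE k m)))

  Ŝ-+ : ∀ k φ ψ → Ŝ k (λ λp → φ λp + ψ λp) ≈ Ŝ k φ + Ŝ k ψ
  Ŝ-+ k φ ψ = trans (Σ-cong N (λ m → trans (*-congˡ (ΣL-+ φ ψ (partsLE k m))) (distribˡ _ _ _))) (Σ-+ N _ _)

  Ŝ-*ˡ : ∀ k c φ → Ŝ k (λ λp → c * φ λp) ≈ c * Ŝ k φ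
  Ŝ-*ˡ k c φ = trans (Σ-cong N (λ m → trans (*-congˡ (ΣL-*ˡ c φ (partsLE k m)))
    (solve 3 (λ a b c → a :* (b :* c) := b :* (a :* c)) refl _ _ _))) (Σ-*ˡ N c _)

  ν-+ : ∀ a b → ν (a ℕ.+ b) ≈ ν a + ν b
  ν-+ zero    b = sym (+-identityˡ _)
  ν-+ (suc a) b = trans (+-congʳ (ν-+ a b)) (solve 2 (λ a b → a :+ b :+ con (+ 1) := a :+ con (+ 1) :+ b) refl _ _)

  len : List ℕ → Carrier
  len λp = ν (length λp)

  len-addParts : ∀ j k λp → len (addParts j k λp) ≈ ν j + len λp
  len-addParts j k λp rewrite length-++ (replicate j (suc k)) {λp} | length-replicate j {suc k} = ν-+ j (length λp)

  Ŝ₀ Ŝ₁ Ŝ₂ : ℕ → Carrier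
  Ŝ₀ k = Ŝ k (λ _ → 1#)
  Ŝ₁ k = Ŝ k len
  Ŝ₂ k = Ŝ k (λ λp → len λp * len λp)

  Ŝ-quadratic : ∀ k u → Ŝ k (λ λp → (u + len λp) * (u + len λp)) ≈ u * u * Ŝ₀ k + (u + u) * Ŝ₁ k + Ŝ₂ k
  Ŝ-quadratic k u = begin
    Ŝ k (λ λp → (u + len λp) * (u + len λp))
      ≈⟨ Ŝ-cong k (λ λp → solve 2 (λ u l → (u :+ l) :* (u :+ l) := u :* u :* con (+ 1) :+ (u :+ u) :* l :+ l :* l) refl u (len λp)) ⟩
    Ŝ k (λ λp → u * u * 1# + (u + u) * len λp + len λp * len λp)
      ≈⟨ trans (Ŝ-+ k _ _) (+-congʳ (trans (Ŝ-+ k _ _) (+-cong (Ŝ-*ˡ k _ _) (Ŝ-*ˡ k _ _)))) ⟩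
    u * u * Ŝ₀ k + (u + u) * Ŝ₁ k + Ŝ₂ k  ∎

  Ŝ₀≈P : ∀ k → Ŝ₀ k ≈ P k
  Ŝ₀≈P zero    = Ŝ-zero _
  Ŝ₀≈P (suc k) = begin
    Ŝ₀ (suc k)       ≈⟨ trans (Ŝ-suc k _) (Σ-*ʳ N (Ŝ₀ k) _) ⟩
    I k * Ŝ₀ k       ≈⟨ trans (*-congˡ (Ŝ₀≈P k)) (*-comm _ _) ⟩
    P (suc k)        ∎

  -- Under the weight q^size the multiplicities of different parts are independent and geometric.
  -- The part k+1 contributes mean `c k`, and `P k` is the total mass.
  Ŝ₁≈Ph : ∀ k → Ŝ₁ k ≈ P k * h k
  Ŝ₁≈Ph zero    = trans (Ŝ-zero len) (sym (zeroʳ _))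
  Ŝ₁≈Ph (suc k) = begin
    Ŝ₁ (suc k)
      ≈⟨ Ŝ-suc k len ⟩
    Σ< N (λ j → x ^ j * Ŝ k (λ λp → len (addParts j k λp)))
      ≈⟨ Σ-cong N term ⟩
    Σ< N (λ j → ν j * x ^ j * P k + x ^ j * (P k * h k))
      ≈⟨ trans (Σ-+ N _ _) (+-cong (Σ-*ʳ N (P k) _) (Σ-*ʳ N (P k * h k) _)) ⟩
    Σ< N (λ j → ν j * x ^ j) * P k + I k * (P k * h k)
      ≈⟨ +-congʳ (*-congʳ (Σνx (q ^ k))) ⟩
    I k * c k * P k + I k * (P k * h k)
      ≈⟨ solve 4 (λ i c p h → i :* c :* p :+ i :* (p :* h) := p :* i :* (h :+ c)) refl (I k) (c k) (P k) (h k) ⟩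
    P (suc k) * h (suc k)  ∎
    where
    x = q ^ suc k
    term : ∀ j → x ^ j * Ŝ k (λ λp → len (addParts j k λp)) ≈ ν j * x ^ j * P k + x ^ j * (P k * h k)
    term j = begin
      x ^ j * Ŝ k (λ λp → len (addParts j k λp))
        ≈⟨ *-congˡ (Ŝ-cong k (λ λp → trans (len-addParts j k λp) (+-congʳ (sym (*-identityʳ _))))) ⟩
      x ^ j * Ŝ k (λ λp → ν j * 1# + len λp)
        ≈⟨ *-congˡ (trans (Ŝ-+ k _ _) (+-cong (trans (Ŝ-*ˡ k _ _) (*-congˡ (Ŝ₀≈P k))) (Ŝ₁≈Ph k))) ⟩
      x ^ j * (ν j * P k + P k * h k)
        ≈⟨ solve 4 (λ x v p z → x :* (v :* p :+ z) := v :* x :* p :+ x :* z) refl (x ^ j) (ν j) (P k) (P k * h k) ⟩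
      ν j * x ^ j * P k + x ^ j * (P k * h k)  ∎

  Σ-quadratic : ∀ k a b d →
    Σ< N (λ j → (q ^ suc k) ^ j * (ν j * ν j * a + ν j * b + d))
      ≈ I k * ((c k * c k + c k * c k + c k) * a + c k * b + d)
  Σ-quadratic k a b d = begin
    Σ< N (λ j → x ^ j * (ν j * ν j * a + ν j * b + d))
      ≈⟨ Σ-cong N (λ j → solve 5 (λ x v a b d → x :* (v :* v :* a :+ v :* b :+ d) := v :* v :* x :* a :+ v :* x :* b :+ x :* d) refl (x ^ j) (ν j) a b d) ⟩
    Σ< N (λ j → ν j * ν j * x ^ j * a + ν j * x ^ j * b + x ^ j * d)
      ≈⟨ trans (Σ-+ N _ _) (+-cong (trans (Σ-+ N _ _) (+-cong (Σ-*ʳ N a _) (Σ-*ʳ N b _))) (Σ-*ʳ N d _)) ⟩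
    Σ< N (λ j → ν j * ν j * x ^ j) * a + Σ< N (λ j → ν j * x ^ j) * b + I k * d
      ≈⟨ +-congʳ (+-cong (*-congʳ (Σν²x (q ^ k))) (*-congʳ (Σνx (q ^ k)))) ⟩
    I k * (c k * c k + c k * c k + c k) * a + I k * c k * b + I k * d
      ≈⟨ solve 6 (λ i e a c b d → i :* e :* a :+ i :* c :* b :+ i :* d := i :* (e :* a :+ c :* b :+ d)) refl _ _ a _ b d ⟩
    I k * ((c k * c k + c k * c k + c k) * a + c k * b + d)  ∎
    where x = q ^ suc k

  -- Variances of independent multiplicities add, the part k+1 contributing `c k * I k`; the second
  -- moment is mean² plus variance.
  Ŝ₂≈ : ∀ k → Ŝ₂ k ≈ P k * (h k * h k + g k)
  Ŝ₂≈ zero    = trans (Ŝ-zero _) (trans (zeroˡ _) (sym (x*0≈0 (trans (+-identityʳ _) (zeroˡ _)))))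
  Ŝ₂≈ (suc k) = begin
    Ŝ₂ (suc k)
      ≈⟨ Ŝ-suc k _ ⟩
    Σ< N (λ j → x ^ j * Ŝ k (λ λp → len (addParts j k λp) * len (addParts j k λp)))
      ≈⟨ Σ-cong N (λ j → *-congˡ (term j)) ⟩
    Σ< N (λ j → x ^ j * (ν j * ν j * P k + ν j * (P k * h k + P k * h k) + P k * (h k * h k + g k)))
      ≈⟨ Σ-quadratic k _ _ _ ⟩
    I k * ((c k * c k + c k * c k + c k) * P k + c k * (P k * h k + P k * h k) + P k * (h k * h k + g k))
      ≈⟨ solve 5 (λ i c p h g → i :* ((c :* c :+ c :* c :+ c) :* p :+ c :* (p :* h :+ p :* h) :+ p :* (h :* h :+ g)) :=
           p :* i :* ((h :+ c) :* (h :+ c) :+ (g :+ c :* (con (+ 1) :+ c)))) refl (I k) (c k) (P k) (h k) (g k) ⟩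
    P k * I k * (h (suc k) * h (suc k) + (g k + c k * (1# + c k)))
      ≈⟨ *-congˡ (+-congˡ (+-congˡ (*-congˡ (I≈1+c k)))) ⟨
    P (suc k) * (h (suc k) * h (suc k) + g (suc k))  ∎
    where
    x = q ^ suc k
    term : ∀ j → Ŝ k (λ λp → len (addParts j k λp) * len (addParts j k λp))
                   ≈ ν j * ν j * P k + ν j * (P k * h k + P k * h k) + P k * (h k * h k + g k)
    term j = begin
      Ŝ k (λ λp → len (addParts j k λp) * len (addParts j k λp))
        ≈⟨ Ŝ-cong k (λ λp → *-cong (len-addParts j k λp) (len-addParts j k λp)) ⟩
      Ŝ k (λ λp → (ν j + len λp) * (ν j + len λp))
        ≈⟨ Ŝ-quadratic k (ν j) ⟩
      ν j * ν j * Ŝ₀ k + (ν j + ν j) * Ŝ₁ k + Ŝ₂ k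
        ≈⟨ +-cong (+-cong (*-congˡ (Ŝ₀≈P k)) (*-congˡ (Ŝ₁≈Ph k))) (Ŝ₂≈ k) ⟩
      ν j * ν j * P k + (ν j + ν j) * (P k * h k) + P k * (h k * h k + g k)
        ≈⟨ +-congʳ (+-congˡ (solve 2 (λ v z → (v :+ v) :* z := v :* (z :+ z)) refl (ν j) (P k * h k))) ⟩
      ν j * ν j * P k + ν j * (P k * h k + P k * h k) + P k * (h k * h k + g k)  ∎

  rank² : List ℕ → Carrier
  rank² λp = (ν (largestPart λp) - len λp) * (ν (largestPart λp) - len λp)

  -- Without a part k+1 the sum is the one for k. With j+1 copies of it the largest part is known,
  -- and the rank is k - j minus the number of the remaining parts, so a quadratic moment over j
  -- remains.
  Ŝ-rank²-step : ∀ k → Ŝ (suc k) rank² ≈ Ŝ k rank² + rankTerm k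
  Ŝ-rank²-step k = begin
    Ŝ (suc k) rank²
      ≈⟨ trans (Ŝ-suc k rank²) (Σ-shift N _ (0*y≈0 ([q^suc]^N≈0 k))) ⟩
    1# * Ŝ k rank² + Σ< N (λ j → x ^ suc j * Ŝ k (λ λp → rank² (addParts (suc j) k λp)))
      ≈⟨ +-cong (*-identityˡ _) (trans (Σ-cong N term) (Σ-*ˡ N x _)) ⟩
    Ŝ k rank² + x * Σ< N (λ j → x ^ j * (ν j * ν j * P k + ν j * b + d))
      ≈⟨ +-congˡ (*-congˡ (Σ-quadratic k _ _ _)) ⟩
    Ŝ k rank² + x * (I k * ((c k * c k + c k * c k + c k) * P k + c k * b + d))
      ≈⟨ +-congˡ (solve 6 (λ x i p h g v → let c = x :* i in
           x :* (i :* ((c :* c :+ c :* c :+ c) :* p :+ c :* ((p :* h :- v :* p) :+ (p :* h :- v :* p))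
             :+ (v :* v :* p :- (v :+ v) :* (p :* h) :+ p :* (h :* h :+ g)))) :=
           c :* p :* ((v :- (h :+ c)) :* (v :- (h :+ c)) :+ (g :+ c :* (con (+ 1) :+ c)))) refl x (I k) (P k) (h k) (g k) (ν k)) ⟩
    Ŝ k rank² + c k * P k * ((ν k - h (suc k)) * (ν k - h (suc k)) + (g k + c k * (1# + c k)))
      ≈⟨ +-congˡ (*-congˡ (+-congˡ (+-congˡ (*-congˡ (I≈1+c k))))) ⟨
    Ŝ k rank² + rankTerm k  ∎
    where
    x = q ^ suc k
    b = (P k * h k - ν k * P k) + (P k * h k - ν k * P k)
    d = ν k * ν k * P k - (ν k + ν k) * (P k * h k) + P k * (h k * h k + g k)
    term : ∀ j → x ^ suc j * Ŝ k (λ λp → rank² (addParts (suc j) k λp)) ≈ x * (x ^ j * (ν j * ν j * P k + ν j * b + d))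
    term j = trans (*-assoc _ _ _) (*-congˡ (*-congˡ (begin
      Ŝ k (λ λp → rank² (addParts (suc j) k λp))
        ≈⟨ Ŝ-cong k (λ λp → trans (*-cong (+-congˡ (-‿cong (len-addParts (suc j) k λp))) (+-congˡ (-‿cong (len-addParts (suc j) k λp))))
             (solve 3 (λ v u l → (v :+ con (+ 1) :- (u :+ con (+ 1) :+ l)) :* (v :+ con (+ 1) :- (u :+ con (+ 1) :+ l)) := (u :- v :+ l) :* (u :- v :+ l)) refl (ν k) (ν j) (len λp))) ⟩
      Ŝ k (λ λp → (ν j - ν k + len λp) * (ν j - ν k + len λp))
        ≈⟨ Ŝ-quadratic k (ν j - ν k) ⟩
      (ν j - ν k) * (ν j - ν k) * Ŝ₀ k + (ν j - ν k + (ν j - ν k)) * Ŝ₁ k + Ŝ₂ k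
        ≈⟨ +-cong (+-cong (*-congˡ (Ŝ₀≈P k)) (*-congˡ (Ŝ₁≈Ph k))) (Ŝ₂≈ k) ⟩
      (ν j - ν k) * (ν j - ν k) * P k + (ν j - ν k + (ν j - ν k)) * (P k * h k) + P k * (h k * h k + g k)
        ≈⟨ solve 5 (λ u v p z s → (u :- v) :* (u :- v) :* p :+ (u :- v :+ (u :- v)) :* z :+ s :=
             u :* u :* p :+ u :* ((z :- v :* p) :+ (z :- v :* p)) :+ (v :* v :* p :- (v :+ v) :* z :+ s)) refl (ν j) (ν k) (P k) (P k * h k) (P k * (h k * h k + g k)) ⟩
      ν j * ν j * P k + ν j * b + d  ∎)))

  Ŝ-rank² : ∀ k → Ŝ k rank² ≈ Σ< k rankTerm
  Ŝ-rank² zero    = trans (Ŝ-zero rank²) (solve 0 ((con (+ 0) :- con (+ 0)) :* (con (+ 0) :- con (+ 0)) := con (+ 0)) refl)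
  Ŝ-rank² (suc k) = trans (Ŝ-rank²-step k) (+-congʳ (Ŝ-rank² k))

  -- A part larger than m fits into m only zero times, so a uniform bound N on the parts may replace
  -- the bound m in `partitions m`.
  partsΣ-stable : ∀ d m φ → partsΣ (d ℕ.+ m) m φ ≈ partsΣ m m φ
  partsΣ-stable zero    m φ = refl
  partsΣ-stable (suc d) m φ = trans (trans (partsΣ-suc (d ℕ.+ m) m φ)
    (Σ-only-head m _ (λ j _ → guarded-vanish (λ m′ → partsΣ (d ℕ.+ m) m′ (λ λp → φ (addParts (suc j) (d ℕ.+ m) λp))) (s≤s (ℕ.≤-trans (ℕ.m≤n+m m d) (ℕ.m≤m+n _ _))))))
    (partsΣ-stable d m φ)

  rankGF : Σ< N (λ m → q ^ m * ΣL rank² (partitions m)) ≈ (P N * g N - P N * T) + (P N * g N - P N * T)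
  rankGF = begin
    Σ< N (λ m → q ^ m * partsΣ m m rank²)
      ≈⟨ Σ-cong< N (λ m m<N → *-congˡ (sym (trans
           (≡⇒≈ (≡.cong (λ k → partsΣ k m rank²) (≡.sym (ℕ.m∸n+n≡m (ℕ.<⇒≤ m<N)))))
           (partsΣ-stable (N ℕ.∸ m) m rank²)))) ⟩
    Ŝ N rank²
      ≈⟨ Ŝ-rank² N ⟩
    Σ< N rankTerm
      ≈⟨ Σ-rankTerm ⟩
    (P N * g N - P N * T) + (P N * g N - P N * T)  ∎

-- The ring of power series modulo q^N

module Q = FiniteSums ℚ.+-*-commutativeRing

sumTo≡Σ : ∀ n f → sumTo n f ≡ Q.Σ< n f
sumTo≡Σ zero    f = ≡.refl
sumTo≡Σ (suc n) f = ≡.cong (ℚ._+ f n) (sumTo≡Σ n f)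

⊛-as-Σ : ∀ f g n → (f ⊛ g) n ≡ Q.Σ< (suc n) (λ i → f i ℚ.* g (n ∸ i))
⊛-as-Σ f g n = sumTo≡Σ (suc n) _

⊛-zero : ∀ f g → (f ⊛ g) 0 ≡ f 0 ℚ.* g 0
⊛-zero f g = ℚ.+-identityˡ _

⊛-sucˡ : ∀ f g n → (f ⊛ g) (suc n) ≡ f 0 ℚ.* g (suc n) ℚ.+ ((λ i → f (suc i)) ⊛ g) n
⊛-sucˡ f g n = ≡.trans (⊛-as-Σ f g (suc n)) (≡.trans (Q.Σ-head (suc n) _)
  (≡.cong (f 0 ℚ.* g (suc n) ℚ.+_) (≡.sym (⊛-as-Σ (λ i → f (suc i)) g n))))

⊛-sucʳ : ∀ f g n → (f ⊛ g) (suc n) ≡ (f ⊛ (λ i → g (suc i))) n ℚ.+ f (suc n) ℚ.* g 0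
⊛-sucʳ f g n = ≡.cong₂ ℚ._+_
  (≡.trans (sumTo≡Σ (suc n) _) (≡.trans
    (Q.Σ-cong< (suc n) (λ i i<sn → ≡.cong (λ k → f i ℚ.* g k) (ℕ.+-∸-assoc 1 (ℕ.s≤s⁻¹ i<sn))))
    (≡.sym (⊛-as-Σ f (λ i → g (suc i)) n))))
  (≡.cong (λ k → f (suc n) ℚ.* g k) (ℕ.n∸n≡0 n))

⊛-cong≤ : ∀ {f f′ g g′} n → (∀ i → i ≤ n → f i ≡ f′ i) → (∀ i → i ≤ n → g i ≡ g′ i) → (f ⊛ g) n ≡ (f′ ⊛ g′) n
⊛-cong≤ {f} {f′} {g} {g′} n f≡ g≡ = ≡.trans (⊛-as-Σ f g n) (≡.trans
  (Q.Σ-cong< (suc n) (λ i i<sn → ≡.cong₂ ℚ._*_ (f≡ i (ℕ.s≤s⁻¹ i<sn)) (g≡ (n ∸ i) (ℕ.m∸n≤m n i))))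
  (≡.sym (⊛-as-Σ f′ g′ n)))

⊛-cong : ∀ {f f′ g g′} → (∀ i → f i ≡ f′ i) → (∀ i → g i ≡ g′ i) → ∀ n → (f ⊛ g) n ≡ (f′ ⊛ g′) n
⊛-cong f≡ g≡ n = ⊛-cong≤ n (λ i _ → f≡ i) (λ i _ → g≡ i)

⊛-distribʳ : ∀ h f g n → ((f ⊕ g) ⊛ h) n ≡ (f ⊛ h) n ℚ.+ (g ⊛ h) n
⊛-distribʳ h f g n = ≡.trans (⊛-as-Σ (f ⊕ g) h n) (≡.trans
  (Q.Σ-cong (suc n) (λ i → ℚ.*-distribʳ-+ (h (n ∸ i)) (f i) (g i))) (≡.trans (Q.Σ-+ (suc n) _ _)
  (≡.cong₂ ℚ._+_ (≡.sym (⊛-as-Σ f h n)) (≡.sym (⊛-as-Σ g h n)))))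

⊛-scaleˡ : ∀ c f g n → (scale c f ⊛ g) n ≡ c ℚ.* (f ⊛ g) n
⊛-scaleˡ c f g n = ≡.trans (⊛-as-Σ (scale c f) g n) (≡.trans
  (Q.Σ-cong (suc n) (λ i → ℚ.*-assoc c (f i) (g (n ∸ i)))) (≡.trans (Q.Σ-*ˡ (suc n) c _)
  (≡.cong (c ℚ.*_) (≡.sym (⊛-as-Σ f g n)))))

⊛-comm : ∀ f g n → (f ⊛ g) n ≡ (g ⊛ f) n
⊛-comm f g zero    = ≡.trans (⊛-zero f g) (≡.trans (ℚ.*-comm (f 0) (g 0)) (≡.sym (⊛-zero g f)))
⊛-comm f g (suc n) = ≡.trans (⊛-sucˡ f g n) (≡.trans (ℚ.+-comm (f 0 ℚ.* g (suc n)) _) (≡.trans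
  (≡.cong₂ ℚ._+_ (⊛-comm (λ i → f (suc i)) g n) (ℚ.*-comm (f 0) (g (suc n))))
  (≡.sym (⊛-sucʳ g f n))))

-- Induction on the degree through f = f 0 + q f′, which avoids reindexing a triple sum.
⊛-assoc : ∀ f g h n → ((f ⊛ g) ⊛ h) n ≡ (f ⊛ (g ⊛ h)) n
⊛-assoc f g h zero = begin
  ((f ⊛ g) ⊛ h) 0          ≡⟨ ⊛-zero (f ⊛ g) h ⟩
  (f ⊛ g) 0 ℚ.* h 0        ≡⟨ ≡.cong (ℚ._* h 0) (⊛-zero f g) ⟩
  f 0 ℚ.* g 0 ℚ.* h 0      ≡⟨ ℚ.*-assoc (f 0) (g 0) (h 0) ⟩
  f 0 ℚ.* (g 0 ℚ.* h 0)    ≡⟨ ≡.cong (f 0 ℚ.*_) (⊛-zero g h) ⟨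
  f 0 ℚ.* (g ⊛ h) 0        ≡⟨ ⊛-zero f (g ⊛ h) ⟨
  (f ⊛ (g ⊛ h)) 0          ∎
  where open ≡.≡-Reasoning
⊛-assoc f g h (suc n) = begin
  ((f ⊛ g) ⊛ h) (suc n)
    ≡⟨ ⊛-sucˡ (f ⊛ g) h n ⟩
  (f ⊛ g) 0 ℚ.* h (suc n) ℚ.+ ((λ i → (f ⊛ g) (suc i)) ⊛ h) n
    ≡⟨ ≡.cong₂ ℚ._+_ (≡.cong (ℚ._* h (suc n)) (⊛-zero f g)) (⊛-cong {g = h} (⊛-sucˡ f g) (λ _ → ≡.refl) n) ⟩
  f 0 ℚ.* g 0 ℚ.* h (suc n) ℚ.+ ((scale (f 0) g′ ⊕ (f′ ⊛ g)) ⊛ h) n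
    ≡⟨ ≡.cong (f 0 ℚ.* g 0 ℚ.* h (suc n) ℚ.+_) (≡.trans (⊛-distribʳ h (scale (f 0) g′) (f′ ⊛ g) n)
         (≡.cong₂ ℚ._+_ (⊛-scaleˡ (f 0) g′ h n) (⊛-assoc f′ g h n))) ⟩
  f 0 ℚ.* g 0 ℚ.* h (suc n) ℚ.+ (f 0 ℚ.* (g′ ⊛ h) n ℚ.+ (f′ ⊛ (g ⊛ h)) n)
    ≡⟨ Q.solve 5 (λ a b c d e → a Q.:* b Q.:* c Q.:+ (a Q.:* d Q.:+ e) Q.:= a Q.:* (b Q.:* c Q.:+ d) Q.:+ e) ≡.refl
         (f 0) (g 0) (h (suc n)) ((g′ ⊛ h) n) ((f′ ⊛ (g ⊛ h)) n) ⟩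
  f 0 ℚ.* (g 0 ℚ.* h (suc n) ℚ.+ (g′ ⊛ h) n) ℚ.+ (f′ ⊛ (g ⊛ h)) n
    ≡⟨ ≡.cong (λ z → f 0 ℚ.* z ℚ.+ (f′ ⊛ (g ⊛ h)) n) (⊛-sucˡ g h n) ⟨
  f 0 ℚ.* (g ⊛ h) (suc n) ℚ.+ (f′ ⊛ (g ⊛ h)) n
    ≡⟨ ⊛-sucˡ f (g ⊛ h) n ⟨
  (f ⊛ (g ⊛ h)) (suc n)  ∎
  where
  open ≡.≡-Reasoning
  f′ g′ : Series
  f′ i = f (suc i)
  g′ i = g (suc i)

0⊛ : ∀ g n → ((λ _ → 0ℚ) ⊛ g) n ≡ 0ℚ
0⊛ g n = ≡.trans (⊛-as-Σ (λ _ → 0ℚ) g n) (Q.Σ-zero (suc n) (λ i _ → ℚ.*-zeroˡ (g (n ∸ i))))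

mono-⊛-suc : ∀ k f n → (mono (suc k) ⊛ f) (suc n) ≡ (mono k ⊛ f) n
mono-⊛-suc k f n = ≡.trans (⊛-sucˡ (mono (suc k)) f n)
  (≡.trans (≡.cong (ℚ._+ (mono k ⊛ f) n) (ℚ.*-zeroˡ (f (suc n)))) (ℚ.+-identityˡ _))

one-⊛ : ∀ f n → (one ⊛ f) n ≡ f n
one-⊛ f zero    = ≡.trans (⊛-zero one f) (ℚ.*-identityˡ (f 0))
one-⊛ f (suc n) = ≡.trans (⊛-sucˡ one f n)
  (≡.trans (≡.cong₂ ℚ._+_ (ℚ.*-identityˡ (f (suc n))) (0⊛ f n)) (ℚ.+-identityʳ _))

⊝_ : Series → Series
(⊝ f) n = ℚ.- f n

𝟘 : Series
𝟘 n = 0ℚ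

-- A record rather than a bare function type, so that both series can be inferred from the type of a
-- proof.
record _≡_mod_ (f g : Series) (N : ℕ) : Set where
  constructor upto
  field coeff : ∀ n → n < N → f n ≡ g n
open _≡_mod_ public

-- Power series modulo q^N: in this ring q is nilpotent and every infinite sum or product is finite.
seriesRing : ℕ → CommutativeRing 0ℓ 0ℓ
seriesRing N = record
  { Carrier = Series
  ; _≈_ = λ f g → f ≡ g mod N
  ; _+_ = _⊕_
  ; _*_ = _⊛_
  ; -_ = ⊝_
  ; 0# = 𝟘
  ; 1# = one
  ; isCommutativeRing = record
    { isRing = record
      { +-isAbelianGroup = record
        { isGroup = record
          { isMonoid = record
            { isSemigroup = record
              { isMagma = record
                { isEquivalence = record
                  { refl = exactly (λ _ → ≡.refl)
                  ; sym = λ e → upto (λ n n<N → ≡.sym (coeff e n n<N))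
                  ; trans = λ e f → upto (λ n n<N → ≡.trans (coeff e n n<N) (coeff f n n<N))
                  }
                ; ∙-cong = λ e f → upto (λ n n<N → ≡.cong₂ ℚ._+_ (coeff e n n<N) (coeff f n n<N))
                }
              ; assoc = λ f g h → exactly (λ n → ℚ.+-assoc (f n) (g n) (h n))
              }
            ; identity = (λ f → exactly (λ n → ℚ.+-identityˡ (f n))) , (λ f → exactly (λ n → ℚ.+-identityʳ (f n)))
            }
          ; inverse = (λ f → exactly (λ n → ℚ.+-inverseˡ (f n))) , (λ f → exactly (λ n → ℚ.+-inverseʳ (f n)))
          ; ⁻¹-cong = λ e → upto (λ n n<N → ≡.cong ℚ.-_ (coeff e n n<N))
          }
        ; comm = λ f g → exactly (λ n → ℚ.+-comm (f n) (g n))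
        }
      ; *-cong = λ e f → upto (λ n n<N → ⊛-cong≤ n (λ i i≤n → coeff e i (ℕ.≤-<-trans i≤n n<N))
                                                    (λ i i≤n → coeff f i (ℕ.≤-<-trans i≤n n<N)))
      ; *-assoc = λ f g h → exactly (⊛-assoc f g h)
      ; *-identity = (λ f → exactly (one-⊛ f)) , (λ f → exactly (λ n → ≡.trans (⊛-comm f one n) (one-⊛ f n)))
      ; distrib = (λ h f g → exactly (λ n → ≡.trans (⊛-comm h (f ⊕ g) n) (≡.trans (⊛-distribʳ h f g n)
                     (≡.cong₂ ℚ._+_ (⊛-comm f h n) (⊛-comm g h n)))))
                , (λ h f g → exactly (⊛-distribʳ h f g))
      }
    ; *-comm = λ f g → exactly (⊛-comm f g)
    }
  }
  where
  exactly : ∀ {f g} → (∀ n → f n ≡ g n) → f ≡ g mod N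
  exactly e = upto (λ n _ → e n)

mono-≢ : ∀ {k n} → n < k → mono k n ≡ 0ℚ
mono-≢ {suc k} {zero}  n<k       = ≡.refl
mono-≢ {suc k} {suc n} (s≤s n<k) = mono-≢ n<k

module _ (N : ℕ) where
  private module S = FiniteSums (seriesRing N)

  mono≈^ : ∀ k → mono k S.≈ (mono 1 S.^ k)
  mono≈^ zero    = S.refl
  mono≈^ (suc k) = S.trans (step k) (S.*-cong {mono 1} S.refl (mono≈^ k))
    where
    pointwise : ∀ k n → mono (suc k) n ≡ (mono 1 ⊛ mono k) n
    pointwise k zero    = ≡.sym (≡.trans (⊛-zero (mono 1) (mono k)) (ℚ.*-zeroˡ (mono k 0)))
    pointwise k (suc n) = ≡.sym (≡.trans (mono-⊛-suc 0 (mono k) n) (one-⊛ (mono k) n))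
    step : ∀ k → mono (suc k) S.≈ (mono 1 S.* mono k)
    step k = upto (λ n _ → pointwise k n)

  q^N≈0 : (mono 1 S.^ N) S.≈ S.0#
  q^N≈0 = S.trans (S.sym (mono≈^ N)) (upto (λ n n<N → mono-≢ n<N))

  Σ-at : ∀ k (T : ℕ → Series) n → S.Σ< k T n ≡ Q.Σ< k (λ a → T a n)
  Σ-at zero    T n = ≡.refl
  Σ-at (suc k) T n = ≡.cong (ℚ._+ T k n) (Σ-at k T n)

  -- The cutoff in `infSum` depends on the coefficient; since T a = O(q^a), one cutoff N serves all
  -- coefficients below N.
  infSum≈Σ : ∀ T → (∀ a n → n < a → T a n ≡ 0ℚ) → infSum T S.≈ S.Σ< N T
  infSum≈Σ T T≡0 = upto λ n n<N → ≡.trans (sumTo≡Σ (suc n) _) (≡.trans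
    (≡.sym (Q.Σ-extend (N ∸ suc n) (suc n) _ (λ a n<a → T≡0 a n n<a)))
    (≡.trans (≡.cong (λ k → Q.Σ< k (λ a → T a n)) (ℕ.m∸n+n≡m n<N)) (≡.sym (Σ-at N T n))))

  prodTo≡Π : ∀ k F → prodTo k F ≡ S.Π< k F
  prodTo≡Π zero    F = ≡.refl
  prodTo≡Π (suc k) F = ≡.cong (_⊛ F k) (prodTo≡Π k F)

-- Coefficient n is compared modulo its own power q^(n+1), where every factor of index above n
-- equals 1.
infProd≈Π : ∀ N F → (∀ k → F k ≡ one mod suc k) → infProd F ≡ FiniteSums.Π< (seriesRing N) N F mod N
infProd≈Π N F F≈1 = upto λ n n<N → let module S = FiniteSums (seriesRing (suc n)) in begin
  prodTo (suc n) F n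
    ≡⟨ ≡.cong (λ f → f n) (prodTo≡Π (suc n) (suc n) F) ⟩
  S.Π< (suc n) F n
    ≡⟨ coeff (S.Π-extend (N ∸ suc n) (suc n) F (λ k n<k → upto (λ m m<sn →
         coeff (F≈1 k) m (ℕ.m<n⇒m<1+n (ℕ.<-≤-trans m<sn n<k))))) n ℕ.≤-refl ⟨
  S.Π< (N ∸ suc n ℕ.+ suc n) F n
    ≡⟨ ≡.cong (λ k → S.Π< k F n) (ℕ.m∸n+n≡m n<N) ⟩
  S.Π< N F n
    ≡⟨ ≡.cong (λ f → f n) (prodTo≡Π (suc n) N F) ⟨
  prodTo N F n
    ≡⟨ ≡.cong (λ f → f n) (prodTo≡Π N N F) ⟩
  FiniteSums.Π< (seriesRing N) N F n  ∎
  where open ≡.≡-Reasoning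

-- Integers as rationals, and triangular exponents

-- Division normalises by a gcd that is stuck on an open integer; with the explicit denominator 1,
-- sums and products compute.
ℤtoℚ-mkℚ : ∀ i → ℤtoℚ i ≡ mkℚ i 0 (ℕ.sym (ℕ.1-coprimeTo _))
ℤtoℚ-mkℚ i = ℚ.↥p/↧p≡p (mkℚ i 0 _)

ℤtoℚ-+ : ∀ i j → ℤtoℚ (i ℤ.+ j) ≡ ℤtoℚ i ℚ.+ ℤtoℚ j
ℤtoℚ-+ i j = ≡.sym (≡.trans (≡.cong₂ ℚ._+_ (ℤtoℚ-mkℚ i) (ℤtoℚ-mkℚ j))
  (≡.cong ℤtoℚ (≡.cong₂ ℤ._+_ (ℤ.*-identityʳ i) (ℤ.*-identityʳ j))))

ℤtoℚ-* : ∀ i j → ℤtoℚ (i ℤ.* j) ≡ ℤtoℚ i ℚ.* ℤtoℚ j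
ℤtoℚ-* i j = ≡.sym (≡.cong₂ ℚ._*_ (ℤtoℚ-mkℚ i) (ℤtoℚ-mkℚ j))


tri : ℕ → ℕ
tri zero    = 0
tri (suc k) = tri k ℕ.+ k

tri≡ : ∀ k → k ℕ.* suc k ℕ./ 2 ≡ tri (suc k)
tri≡ k = ≡.trans (≡.cong (ℕ._/ 2) (≡.sym (twice k))) (ℕ.m*n/n≡m (tri (suc k)) 2)
  where
  twice : ∀ k → tri (suc k) ℕ.* 2 ≡ k ℕ.* suc k
  twice zero    = ≡.refl
  twice (suc k) = begin
    (tri (suc k) ℕ.+ suc k) ℕ.* 2          ≡⟨ ℕ.*-distribʳ-+ 2 (tri (suc k)) (suc k) ⟩
    tri (suc k) ℕ.* 2 ℕ.+ suc k ℕ.* 2      ≡⟨ ≡.cong (ℕ._+ suc k ℕ.* 2) (twice k) ⟩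
    k ℕ.* suc k ℕ.+ suc k ℕ.* 2            ≡⟨ ≡.cong (ℕ._+ suc k ℕ.* 2) (ℕ.*-comm k (suc k)) ⟩
    suc k ℕ.* k ℕ.+ suc k ℕ.* 2            ≡⟨ ℕ.*-distribˡ-+ (suc k) k 2 ⟨
    suc k ℕ.* (k ℕ.+ 2)                    ≡⟨ ≡.cong (suc k ℕ.*_) (ℕ.+-comm k 2) ⟩
    suc k ℕ.* suc (suc k)                  ∎
    where open ≡.≡-Reasoning

-- The left-hand sides and the divisor sum

module LeftSides (R : CommutativeRing 0ℓ 0ℓ) (q : CommutativeRing.Carrier R) (n : ℕ)
                 (q^N≈0 : CommutativeRing._≈_ R (FiniteSums._^_ R q (suc n)) (CommutativeRing.0# R))
                 where
  open FiniteSums R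
  open Nilpotent R q n q^N≈0
  open RankMoment R q n q^N≈0
  open QIdentities R q n q^N≈0

  -- Splitting (q)_∞ into odd and even exponents gives (q)_∞ = (q;q²)_∞ (q²;q²)_∞; the finite
  -- product may run to 2N because its factors are 1 beyond N.
  OP≈P² : O N * P N ≈ Base².P N
  OP≈P² = inverse-unique F²OP≈1 (Base².FP≈1 N)
    where
    F≈OF² : F N ≈ O N * Base².F N
    F≈OF² = begin
      F N
        ≈⟨ Π-extend N N _ (λ i N≤i → 1-0≈1 (q^-vanish (ℕ.m≤n⇒m≤1+n N≤i))) ⟨
      F (N ℕ.+ N)
        ≡⟨ ≡.cong F (double≡+ N) ⟨
      F (double N)
        ≈⟨ Π-double N _ ⟩
      Π< N (λ i → 1# - q ^ suc (double i)) * Π< N (λ i → 1# - q ^ suc (suc (double i)))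
        ≈⟨ *-cong (Π-cong N (λ i → 1-cong (*-congˡ (trans (q^double i) (^-distrib-* q q i)))))
                  (Π-cong N (λ i → 1-cong (q^double (suc i)))) ⟩
      O N * Base².F N  ∎
    F²OP≈1 : Base².F N * (O N * P N) ≈ 1#
    F²OP≈1 = begin
      Base².F N * (O N * P N)  ≈⟨ solve 3 (λ f o p → f :* (o :* p) := o :* f :* p) refl _ _ _ ⟩
      O N * Base².F N * P N    ≈⟨ *-congʳ F≈OF² ⟨
      F N * P N                ≈⟨ FP≈1 N ⟩
      1#                       ∎

  -- The exponent 1+2k denotes the factor 1/(1-q^(2k+2)), as `inv` supplies one more q.
  Π-odd≈P² : Π< N (λ k → inv (q ^ (1 ℕ.+ 2 ℕ.* k))) ≈ Base².P N
  Π-odd≈P² = Π-cong N (λ k → inverse-unique (inv-law _) (trans (*-congʳ (1-cong (exponent k))) (Base².I-law k)))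
    where
    exponent : ∀ k → q ^ suc (1 ℕ.+ 2 ℕ.* k) ≈ p ^ suc k
    exponent k = trans (≡⇒≈ (≡.cong (λ m → q ^ suc (suc m))
      (≡.trans (≡.cong (k ℕ.+_) (ℕ.+-identityʳ k)) (≡.sym (double≡+ k))))) (q^double (suc k))

  -- These are (q^(2e+1);q²)_∞ and 1/(q^(e+1);q)_∞, with exponents spelled as in the formal series
  -- they are to match.
  pochTail geomTail : ℕ → Carrier
  pochTail e = Π< N (λ k → 1# - q ^ (suc (2 ℕ.* e) ℕ.+ 2 ℕ.* k))
  geomTail e = Π< N (λ k → inv (q ^ (e ℕ.+ 1 ℕ.* k)))

  tails : ∀ e → pochTail e * geomTail e ≈ Base².P N * (F e * Q e)
  tails e = begin
    pochTail e * geomTail e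
      ≈⟨ *-cong poch≈ geom≈ ⟩
    O N * Q e * (P N * F e)
      ≈⟨ solve 4 (λ a b c d → a :* b :* (c :* d) := a :* c :* (d :* b)) refl _ _ _ _ ⟩
    O N * P N * (F e * Q e)
      ≈⟨ *-congʳ OP≈P² ⟩
    Base².P N * (F e * Q e)  ∎
    where
    quotient : ∀ {u v x y} → u * v ≈ 1# → u * x ≈ y → x ≈ y * v
    quotient {u} {v} {x} {y} uv≈1 ux≈y = cancel-unit uv≈1 (begin
      u * x        ≈⟨ ux≈y ⟩
      y            ≈⟨ trans (*-congˡ uv≈1) (*-identityʳ y) ⟨
      y * (u * v)  ≈⟨ solve 3 (λ y u v → y :* (u :* v) := u :* (y :* v)) refl y u v ⟩
      u * (y * v)  ∎)

    poch≈ : pochTail e ≈ O N * Q e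
    poch≈ = quotient (OQ≈1 e) (begin
      O e * pochTail e
        ≈⟨ *-congˡ (Π-cong N (λ k → 1-cong (*-congˡ (exponent k)))) ⟩
      O e * Π< N (λ k → 1# - q * (q ^ (e ℕ.+ k) * q ^ (e ℕ.+ k)))
        ≈⟨ Π-split e N _ ⟨
      O (e ℕ.+ N)
        ≈⟨ Π-extend e N _ (λ i N≤i → 1-0≈1 (x*0≈0 (0*y≈0 (q^-vanish N≤i)))) ⟩
      O N  ∎)
      where
      exponent : ∀ k → q ^ (2 ℕ.* e ℕ.+ 2 ℕ.* k) ≈ q ^ (e ℕ.+ k) * q ^ (e ℕ.+ k)
      exponent k = begin
        q ^ (2 ℕ.* e ℕ.+ 2 ℕ.* k)        ≡⟨ ≡.cong (q ^_) (ℕ.*-distribˡ-+ 2 e k) ⟨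
        q ^ (e ℕ.+ k ℕ.+ (e ℕ.+ k ℕ.+ 0)) ≡⟨ ≡.cong (λ m → q ^ (e ℕ.+ k ℕ.+ m)) (ℕ.+-identityʳ (e ℕ.+ k)) ⟩
        q ^ (e ℕ.+ k ℕ.+ (e ℕ.+ k))       ≈⟨ ^-homo-* q (e ℕ.+ k) (e ℕ.+ k) ⟩
        q ^ (e ℕ.+ k) * q ^ (e ℕ.+ k)     ∎

    geom≈ : geomTail e ≈ P N * F e
    geom≈ = quotient (trans (*-comm _ _) (FP≈1 e)) (begin
      P e * geomTail e
        ≈⟨ *-congˡ (Π-cong N (λ k → ≡⇒≈ (≡.cong (λ m → I (e ℕ.+ m)) (ℕ.*-identityˡ k)))) ⟩
      P e * Π< N (λ k → I (e ℕ.+ k))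
        ≈⟨ Π-split e N I ⟨
      P (e ℕ.+ N)
        ≈⟨ Π-extend e N I (λ i N≤i → trans (I≈1+c i) (+-elimʳ (0*y≈0 (q^-vanish (ℕ.m≤n⇒m≤1+n N≤i))))) ⟩
      P N  ∎)

  lhsTerm : Carrier → ℕ → Carrier
  lhsTerm z a = z * pochTail (suc a) * I a * I a * geomTail (suc a)

  lhsTerm≈ : ∀ z a → lhsTerm z a ≈ Base².P N * (z * (F a * Q (suc a) * I a))
  lhsTerm≈ z a = begin
    z * pochTail (suc a) * I a * I a * geomTail (suc a)
      ≈⟨ solve 4 (λ z p i g → z :* p :* i :* i :* g := z :* (p :* g) :* (i :* i)) refl z _ (I a) _ ⟩
    z * (pochTail (suc a) * geomTail (suc a)) * (I a * I a)
      ≈⟨ *-congʳ (*-congˡ (tails (suc a))) ⟩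
    z * (Base².P N * (F a * (1# - q ^ suc a) * Q (suc a))) * (I a * I a)
      ≈⟨ solve 6 (λ z p f u o i → z :* (p :* (f :* u :* o)) :* (i :* i) := p :* (z :* (f :* o :* i)) :* (u :* i)) refl
           z (Base².P N) (F a) (1# - q ^ suc a) (Q (suc a)) (I a) ⟩
    Base².P N * (z * (F a * Q (suc a) * I a)) * ((1# - q ^ suc a) * I a)
      ≈⟨ trans (*-congˡ (I-law a)) (*-identityʳ _) ⟩
    Base².P N * (z * (F a * Q (suc a) * I a))  ∎

  δ-as-term : ∀ a s → δ (suc a) * (s * P (suc a)) ≈ q ^ suc a * s * (F a * Q (suc a) * I a)
  δ-as-term a s = begin
    F a * F a * q ^ suc a * Q (suc a) * (s * (P a * I a))
      ≈⟨ solve 6 (λ f x o s p i → f :* f :* x :* o :* (s :* (p :* i)) := x :* s :* (f :* o :* i) :* (f :* p)) refl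
           (F a) (q ^ suc a) (Q (suc a)) s (P a) (I a) ⟩
    q ^ suc a * s * (F a * Q (suc a) * I a) * (F a * P a)
      ≈⟨ trans (*-congˡ (FP≈1 a)) (*-identityʳ _) ⟩
    q ^ suc a * s * (F a * Q (suc a) * I a)  ∎

  -- Both left-hand sides at once: s = 1 gives the first, and s = `t` the second, because
  -- q^(n(n+1)/2) = q^n q^(n(n-1)/2).
  Σ-lhsTerm : ∀ (z s : ℕ → Carrier) → (∀ a → z a ≈ q ^ suc a * s (suc a)) →
              Σ< N (λ a → lhsTerm (z a) a) ≈ Base².P N * Σ< N (λ m → δ m * (s m * P m))
  Σ-lhsTerm z s z≈ = begin
    Σ< N (λ a → lhsTerm (z a) a)
      ≈⟨ Σ-cong N (λ a → trans (lhsTerm≈ (z a) a) (*-congˡ (trans (*-congʳ (z≈ a)) (sym (δ-as-term a (s (suc a))))))) ⟩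
    Σ< N (λ a → Base².P N * (δ (suc a) * (s (suc a) * P (suc a))))
      ≈⟨ Σ-*ˡ N (Base².P N) _ ⟩
    Base².P N * Σ< N (λ a → δ (suc a) * (s (suc a) * P (suc a)))
      ≈⟨ *-congˡ (trans (Σ-shift N _ (0*y≈0 (δ-vanish ℕ.≤-refl))) (trans (+-congʳ (zeroˡ _)) (+-identityˡ _))) ⟨
    Base².P N * Σ< N (λ m → δ m * (s m * P m))  ∎

  t≈q^tri : ∀ k → q ^ tri k ≈ t k
  t≈q^tri zero    = refl
  t≈q^tri (suc k) = trans (^-homo-* q (tri k) k) (*-congʳ (t≈q^tri k))

  Σ-lhs₁ : Σ< N (λ a → lhsTerm (q ^ suc a) a) ≈ Base².P N * (g N - Base².g N + Base².T)
  Σ-lhs₁ = trans (Σ-lhsTerm _ (λ _ → 1#) (λ a → sym (*-identityʳ _)))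
    (*-congˡ (trans (Σ-cong N (λ m → *-congˡ (*-identityˡ _))) ΣδP))

  Σ-lhs₂ : Σ< N (λ a → lhsTerm (q ^ (suc a ℕ.* suc (suc a) ℕ./ 2)) a) ≈ Base².P N * (g N - Base².g N)
  Σ-lhs₂ = trans (Σ-lhsTerm _ t exponent) (*-congˡ ΣδA)
    where
    exponent : ∀ a → q ^ (suc a ℕ.* suc (suc a) ℕ./ 2) ≈ q ^ suc a * t (suc a)
    exponent a = trans (≡⇒≈ (≡.cong (q ^_) (tri≡ (suc a)))) (trans (t≈q^tri (2 ℕ.+ a)) (*-comm _ _))

  -- Expanding 1/(1-q^a) and summing over a first turns Σ a q^a/(1-q^a) into Σ q^r/(1-q^r)².
  Σσ : Σ< N (λ a → ν (suc a) * (q ^ suc a * I a)) ≈ g N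
  Σσ = begin
    Σ< N (λ a → ν (suc a) * (q ^ suc a * I a))
      ≈⟨ Σ-cong N (λ a → trans (sym (*-assoc _ _ _)) (sym (Σ-*ˡ N _ _))) ⟩
    Σ< N (λ a → Σ< N (λ i → ν (suc a) * q ^ suc a * (q ^ suc a) ^ i))
      ≈⟨ Σ-swap N N _ ⟩
    Σ< N (λ i → Σ< N (λ a → ν (suc a) * q ^ suc a * (q ^ suc a) ^ i))
      ≈⟨ Σ-cong N inner ⟩
    g N  ∎
    where
    inner : ∀ i → Σ< N (λ a → ν (suc a) * q ^ suc a * (q ^ suc a) ^ i) ≈ c i * I i
    inner i = begin
      Σ< N (λ a → ν (suc a) * q ^ suc a * (q ^ suc a) ^ i)
        ≈⟨ Σ-cong N (λ a → begin
             ν (suc a) * q ^ suc a * (q ^ suc a) ^ i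
               ≈⟨ *-assoc _ _ _ ⟩
             ν (suc a) * (q ^ suc a) ^ suc i
               ≈⟨ *-congˡ (trans (^-assocʳ q (suc a) (suc i)) (trans (≡⇒≈ (≡.cong (q ^_) (ℕ.*-comm (suc a) (suc i)))) (sym (^-assocʳ q (suc i) (suc a))))) ⟩
             ν (suc a) * x ^ suc a
               ≈⟨ solve 3 (λ v x y → (v :+ con (+ 1)) :* (x :* y) := x :* (v :* y :+ y)) refl (ν a) x (x ^ a) ⟩
             x * (ν a * x ^ a + x ^ a)  ∎) ⟩
      Σ< N (λ a → x * (ν a * x ^ a + x ^ a))
        ≈⟨ trans (Σ-*ˡ N x _) (*-congˡ (trans (Σ-+ N _ _) (+-congʳ (Σνx (q ^ i))))) ⟩
      x * (I i * c i + I i)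
        ≈⟨ solve 3 (λ x i c → x :* (i :* c :+ i) := x :* i :* (con (+ 1) :+ c)) refl x (I i) (c i) ⟩
      c i * (1# + c i)
        ≈⟨ *-congˡ (I≈1+c i) ⟨
      c i * I i  ∎
      where x = q ^ suc i

-- From the formal series to the truncated ring

k<a+dk : ∀ a d k → suc k ≤ suc a ℕ.+ suc d ℕ.* k
k<a+dk a d k = s≤s (ℕ.≤-trans (ℕ.m≤n*m k (suc d)) (ℕ.m≤n+m (suc d ℕ.* k) a))

1-mono≡one : ∀ {m k} → k ≤ m → (one ⊖ mono m) ≡ one mod k
1-mono≡one k≤m = upto λ i i<k → ≡.trans
  (≡.cong (λ z → one i ℚ.- z) (mono-≢ (ℕ.<-≤-trans i<k k≤m))) (ℚ.+-identityʳ (one i))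

module Translation (n : ℕ) where
  open FiniteSums (seriesRing (suc n))
  q : Series
  q = mono 1
  open Nilpotent (seriesRing (suc n)) q n (q^N≈0 (suc n))
  open RankMoment (seriesRing (suc n)) q n (q^N≈0 (suc n)) using (I; g)
  open QIdentities (seriesRing (suc n)) q n (q^N≈0 (suc n)) using (p; q^double; module Base²)
  open LeftSides (seriesRing (suc n)) q n (q^N≈0 (suc n))

  mono≈ : ∀ k → mono k ≈ q ^ k
  mono≈ = mono≈^ N

  geom≈inv : ∀ k → geom (suc k) ≈ inv (q ^ k)
  geom≈inv k = trans
    (infSum≈Σ N (λ a → mono (suc k ℕ.* a)) (λ a m m<a → mono-≢ (ℕ.<-≤-trans m<a (ℕ.m≤n*m a (suc k)))))
    (Σ-cong N (λ a → trans (mono≈ (suc k ℕ.* a)) (sym (^-assocʳ q (suc k) a))))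

  geom≡one : ∀ {m k} → k ≤ m → geom m ≡ one mod k
  geom≡one {m} k≤m = upto λ i i<k → ≡.trans (sumTo≡Σ (suc i) (λ a → mono (m ℕ.* a) i))
    (≡.trans (Q.Σ-only-head i (λ a → mono (m ℕ.* a) i)
       (λ a _ → mono-≢ (ℕ.<-≤-trans i<k (ℕ.≤-trans k≤m (ℕ.m≤m*n m (suc a))))))
    (≡.cong (λ z → mono z i) (ℕ.*-zeroʳ m)))

  poch∞≈ : ∀ a d → poch∞ (suc a) (suc d) ≈ Π< N (λ k → 1# - q ^ (suc a ℕ.+ suc d ℕ.* k))
  poch∞≈ a d = trans (infProd≈Π N _ (λ k → 1-mono≡one (k<a+dk a d k)))
    (Π-cong N (λ k → +-cong {1#} refl (-‿cong (mono≈ (suc a ℕ.+ suc d ℕ.* k)))))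

  invPoch∞≈ : ∀ a d → invPoch∞ (suc a) (suc d) ≈ Π< N (λ k → inv (q ^ (a ℕ.+ suc d ℕ.* k)))
  invPoch∞≈ a d = trans (infProd≈Π N _ (λ k → geom≡one (k<a+dk a d k)))
    (Π-cong N (λ k → geom≈inv (a ℕ.+ suc d ℕ.* k)))

  invPoch2≈P² : invPoch∞ 2 2 ≈ Base².P N
  invPoch2≈P² = trans (invPoch∞≈ 1 1) Π-odd≈P²

  lhsSeries : ℕ → ℕ → Series
  lhsSeries m a = mono m ⊛ poch∞ (suc (2 ℕ.* suc a)) 2 ⊛ geom (suc a) ⊛ geom (suc a) ⊛ invPoch∞ (suc (suc a)) 1

  lhsSeries≈ : ∀ m a → lhsSeries m a ≈ lhsTerm (q ^ m) a
  lhsSeries≈ m a = *-cong (*-cong (*-cong (*-cong (mono≈ m) (poch∞≈ (2 ℕ.* suc a) 1)) (geom≈inv a)) (geom≈inv a))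
    (invPoch∞≈ (suc a) 0)

  -- Read modulo q^a, the leading monomial is already zero, and the whole product with it.
  lhsSeries-vanish : ∀ {m a} → a ≤ m → ∀ i → i < a → lhsSeries m a i ≡ 0ℚ
  lhsSeries-vanish {m} {a} a≤m i i<a = coeff
    (S.0*y≈0 {y = invPoch∞ (suc (suc a)) 1} (S.0*y≈0 {y = geom (suc a)} (S.0*y≈0 {y = geom (suc a)}
      (S.0*y≈0 {mono m} {poch∞ (suc (2 ℕ.* suc a)) 2} (upto λ j j<a → mono-≢ (ℕ.<-≤-trans j<a a≤m)))))) i i<a
    where module S = FiniteSums (seriesRing a)

  lhs₁≈ : lhs₁ ≈ Base².P N * (g N - Base².g N + Base².T)
  lhs₁≈ = trans (infSum≈Σ N (λ a → lhsSeries (suc a) a) (λ a → lhsSeries-vanish (ℕ.n≤1+n a)))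
    (trans (Σ-cong N (λ a → lhsSeries≈ (suc a) a)) Σ-lhs₁)

  lhs₂≈ : lhs₂ ≈ Base².P N * (g N - Base².g N)
  lhs₂≈ = trans (infSum≈Σ N (λ a → lhsSeries (suc a ℕ.* suc (suc a) ℕ./ 2) a)
      (λ a → lhsSeries-vanish (≡.subst (a ≤_) (≡.sym (tri≡ (suc a))) (ℕ.≤-trans (ℕ.n≤1+n a) (ℕ.m≤n+m (suc a) (tri (suc a)))))))
    (trans (Σ-cong N (λ a → lhsSeries≈ (suc a ℕ.* suc (suc a) ℕ./ 2) a)) Σ-lhs₂)

  const : ℚ → Series
  const c = scale c one

  const-* : ∀ c f → const c ⊛ f ≈ scale c f
  const-* c f = upto λ i _ → ≡.trans (⊛-scaleˡ c one f i) (≡.cong (c ℚ.*_) (one-⊛ f i))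

  const-+ : ∀ c d → const (c ℚ.+ d) ≈ const c ⊕ const d
  const-+ c d = upto λ i _ → ℚ.*-distribʳ-+ (one i) c d

  const-mul : ∀ c d → const (c ℚ.* d) ≈ const c ⊛ const d
  const-mul c d = trans (upto λ i _ → ℚ.*-assoc c d (one i)) (sym (const-* c (const d)))

  const-neg : ∀ c → const (ℚ.- c) ≈ ⊝ const c
  const-neg c = upto λ i _ → ≡.sym (ℚ.neg-distribˡ-* c (one i))

  const-0 : const 0ℚ ≈ 𝟘
  const-0 = upto λ i _ → ℚ.*-zeroˡ (one i)

  const-1 : const 1ℚ ≈ one
  const-1 = upto λ i _ → ℚ.*-identityˡ (one i)

  const-ℕ : ∀ k → const (ℕtoℚ k) ≈ ν k
  const-ℕ zero    = const-0
  const-ℕ (suc k) = trans (≡⇒≈ (≡.cong const (≡.trans (≡.cong ℤtoℚ (≡.cong +_ (ℕ.+-comm 1 k))) (ℤtoℚ-+ (+ k) (+ 1)))))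
    (trans (const-+ (ℕtoℚ k) 1ℚ) (+-cong (const-ℕ k) const-1))

  sigma≈ : sigmaSeries ≈ g N
  sigma≈ = trans (infSum≈Σ N (λ a → scale (ℕtoℚ (suc a)) (mono (suc a) ⊛ geom (suc a))) vanish)
    (trans (Σ-cong N (λ a → trans (sym (const-* (ℕtoℚ (suc a)) (mono (suc a) ⊛ geom (suc a))))
      (*-cong (const-ℕ (suc a)) (*-cong (mono≈ (suc a)) (geom≈inv a))))) Σσ)
    where
    vanish : ∀ a i → i < a → scale (ℕtoℚ (suc a)) (mono (suc a) ⊛ geom (suc a)) i ≡ 0ℚ
    vanish a i i<a = ≡.trans (≡.cong (ℕtoℚ (suc a) ℚ.*_)
      (coeff (S.0*y≈0 {mono (suc a)} {geom (suc a)} (upto λ j j<a → mono-≢ (ℕ.m<n⇒m<1+n j<a))) i i<a)) (ℚ.*-zeroʳ (ℕtoℚ (suc a)))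
      where module S = FiniteSums (seriesRing a)

  half-double : ∀ f → scale ½ (f ⊕ f) ≈ f
  half-double f = upto λ i _ → ≡.trans (ℚ.*-distribˡ-+ ½ (f i) (f i))
    -- ½ + ½ computes to 1, so the unit law applies.
    (≡.trans (≡.sym (ℚ.*-distribʳ-+ (f i) ½ ½)) (ℚ.*-identityˡ (f i)))

  scale-cong : ∀ c {f g} → f ≈ g → scale c f ≈ scale c g
  scale-cong c e = upto λ i i<N → ≡.cong (c ℚ.*_) (coeff e i i<N)

  -- The exponents 2m make this series the value at p = q² of Σ a(m) q^m without its constant term.
  dilated : ∀ (a : ℕ → ℚ) → infSum (λ m → scale (a (suc m)) (mono (2 ℕ.* suc m)))
                             ≈ Σ< N (λ m → const (a (suc m)) * p ^ suc m)
  dilated a = trans (infSum≈Σ N (λ m → scale (a (suc m)) (mono (2 ℕ.* suc m))) vanish)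
    (Σ-cong N (λ m → trans (sym (const-* (a (suc m)) (mono (2 ℕ.* suc m))))
      (*-cong {const (a (suc m))} refl (trans (mono≈ (2 ℕ.* suc m))
        (trans (≡⇒≈ (≡.cong (q ^_) (≡.trans (≡.cong (suc m ℕ.+_) (ℕ.+-identityʳ (suc m))) (≡.sym (double≡+ (suc m))))))
               (q^double (suc m)))))))
    where
    vanish : ∀ m i → i < m → scale (a (suc m)) (mono (2 ℕ.* suc m)) i ≡ 0ℚ
    vanish m i i<m = ≡.trans (≡.cong (a (suc m) ℚ.*_)
      (mono-≢ (ℕ.<-≤-trans i<m (ℕ.≤-trans (ℕ.n≤1+n m) (ℕ.m≤n*m (suc m) 2))))) (ℚ.*-zeroʳ (a (suc m)))

  rhs≈ : ∀ (a : ℕ → ℚ) y → Σ< N (λ m → const (a (suc m)) * p ^ suc m) ≈ y ⊕ y →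
         (invPoch∞ 2 2 ⊛ sigmaSeries ⊖ scale ½ (infSum (λ m → scale (a (suc m)) (mono (2 ℕ.* suc m)))))
           ≈ Base².P N * g N - y
  rhs≈ a y e = +-cong (*-cong invPoch2≈P² sigma≈)
    (-‿cong (trans (scale-cong ½ (trans (dilated a) e)) (half-double y)))

-- Supports in z and z-moments

module Z = FiniteSums ℤ.+-*-commutativeRing

offset : ℕ → ℕ → ℤ
offset n i = + i ℤ.- + n

-- Membership in [-n, n], witnessed by the position in the enumeration used by `sumZ`, so that a
-- single term of such a sum can be selected.
InRange : ℕ → ℤ → Set
InRange n z = ∃ λ t → t ≤ n ℕ.+ n × z ≡ offset n t

ΣZ : ℕ → (ℤ → ℚ) → ℚ
ΣZ n f = Q.Σ< (suc (n ℕ.+ n)) (λ i → f (offset n i))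

sumZ≡ΣZ : ∀ n f → sumZ n f ≡ ΣZ n f
sumZ≡ΣZ n f = sumTo≡Σ (suc (n ℕ.+ n)) (λ i → f (offset n i))

offset-injective : ∀ n {i j} → offset n i ≡ offset n j → i ≡ j
offset-injective n {i} {j} eq = ℤ.+-injective (begin
  + i                      ≡⟨ Z.solve 2 (λ i n → i Z.:= (i Z.:- n) Z.:+ n) ≡.refl (+ i) (+ n) ⟩
  offset n i ℤ.+ + n       ≡⟨ ≡.cong (ℤ._+ + n) eq ⟩
  offset n j ℤ.+ + n       ≡⟨ Z.solve 2 (λ i n → i Z.:= (i Z.:- n) Z.:+ n) ≡.refl (+ j) (+ n) ⟨
  + j                      ∎)
  where open ≡.≡-Reasoning

ΣZ-single : ∀ n {z} f → InRange n z → (∀ m → m ≢ z → f m ≡ 0ℚ) → ΣZ n f ≡ f z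
ΣZ-single n f (t , t≤ , ≡.refl) f≡0 = Q.Σ-single (suc (n ℕ.+ n)) (λ i → f (offset n i)) (s≤s t≤)
  (λ i i≢t → f≡0 (offset n i) (λ eq → i≢t (offset-injective n eq)))

ΣZ-cong : ∀ n {f g} → (∀ z → f z ≡ g z) → ΣZ n f ≡ ΣZ n g
ΣZ-cong n eq = Q.Σ-cong (suc (n ℕ.+ n)) (λ i → eq (offset n i))

ΣZ-*ˡ : ∀ n c f → ΣZ n (λ z → c ℚ.* f z) ≡ c ℚ.* ΣZ n f
ΣZ-*ˡ n c f = Q.Σ-*ˡ (suc (n ℕ.+ n)) c (λ i → f (offset n i))

ΣZ-*ʳ : ∀ n c f → ΣZ n (λ z → f z ℚ.* c) ≡ ΣZ n f ℚ.* c
ΣZ-*ʳ n c f = Q.Σ-*ʳ (suc (n ℕ.+ n)) c (λ i → f (offset n i))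

ΣZ-+ : ∀ n f g → ΣZ n (λ z → f z ℚ.+ g z) ≡ ΣZ n f ℚ.+ ΣZ n g
ΣZ-+ n f g = Q.Σ-+ (suc (n ℕ.+ n)) (λ i → f (offset n i)) (λ i → g (offset n i))

-- The substitution m = z + j, with j = `offset i a` in [-i, i], places the window [-l, l] inside
-- [-(i+l), i+l]; the rest of the larger window meets only zeros of `ψ`.
ΣZ-shift : ∀ i l a (Φ ψ : ℤ → ℚ) → a ≤ i ℕ.+ i → (∀ z → ¬ InRange l z → ψ z ≡ 0ℚ) →
           ΣZ (i ℕ.+ l) (λ m → Φ m ℚ.* ψ (m ℤ.- offset i a)) ≡ ΣZ l (λ z → Φ (z ℤ.+ offset i a) ℚ.* ψ z)
ΣZ-shift i l a Φ ψ a≤2i ψ≡0 = begin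
  Q.Σ< (suc (n ℕ.+ n)) F
    ≡⟨ ≡.cong (λ k → Q.Σ< k F) length≡ ⟩
  Q.Σ< (a ℕ.+ (suc (l ℕ.+ l) ℕ.+ (i ℕ.+ i ∸ a))) F
    ≡⟨ Q.Σ-window a (suc (l ℕ.+ l)) (i ℕ.+ i ∸ a) F below above ⟩
  Q.Σ< (suc (l ℕ.+ l)) (λ t → F (a ℕ.+ t))
    ≡⟨ Q.Σ-cong (suc (l ℕ.+ l)) (λ t → ≡.cong₂ ℚ._*_ (≡.cong Φ (shifted t)) (≡.cong ψ (unshifted t))) ⟩
  ΣZ l (λ z → Φ (z ℤ.+ offset i a) ℚ.* ψ z)  ∎
  where
  open ≡.≡-Reasoning
  n = i ℕ.+ l
  F : ℕ → ℚ
  F t = Φ (offset n t) ℚ.* ψ (offset n t ℤ.- offset i a)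
  shifted : ∀ t → offset n (a ℕ.+ t) ≡ offset l t ℤ.+ offset i a
  shifted t = Z.solve 4 (λ a t i l → (a Z.:+ t) Z.:- (i Z.:+ l) Z.:= (t Z.:- l) Z.:+ (a Z.:- i)) ≡.refl (+ a) (+ t) (+ i) (+ l)
  unshifted : ∀ t → offset n (a ℕ.+ t) ℤ.- offset i a ≡ offset l t
  unshifted t = Z.solve 4 (λ a t i l → (a Z.:+ t) Z.:- (i Z.:+ l) Z.:- (a Z.:- i) Z.:= t Z.:- l) ≡.refl (+ a) (+ t) (+ i) (+ l)
  position : ∀ {t u} → offset n t ℤ.- offset i a ≡ offset l u → t ≡ a ℕ.+ u
  position {t} {u} eq = ℤ.+-injective (begin
    + t
      ≡⟨ Z.solve 4 (λ a t i l → t Z.:= (t Z.:- (i Z.:+ l) Z.:- (a Z.:- i)) Z.:+ (a Z.:+ l)) ≡.refl (+ a) (+ t) (+ i) (+ l) ⟩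
    offset n t ℤ.- offset i a ℤ.+ (+ a ℤ.+ + l)
      ≡⟨ ≡.cong (ℤ._+ (+ a ℤ.+ + l)) eq ⟩
    offset l u ℤ.+ (+ a ℤ.+ + l)
      ≡⟨ Z.solve 3 (λ a u l → (u Z.:- l) Z.:+ (a Z.:+ l) Z.:= a Z.:+ u) ≡.refl (+ a) (+ u) (+ l) ⟩
    + (a ℕ.+ u)  ∎)
  outside : ∀ t → ¬ InRange l (offset n t ℤ.- offset i a) → F t ≡ 0ℚ
  outside t out = ≡.trans (≡.cong (Φ (offset n t) ℚ.*_) (ψ≡0 _ out)) (ℚ.*-zeroʳ (Φ (offset n t)))
  below : ∀ t → t < a → F t ≡ 0ℚ
  below t t<a = outside t λ { (u , _ , eq) → ℕ.<⇒≱ t<a (≡.subst (a ≤_) (≡.sym (position eq)) (ℕ.m≤m+n a u)) }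
  above : ∀ t → a ℕ.+ suc (l ℕ.+ l) ≤ t → F t ≡ 0ℚ
  above t t≥ = outside t λ { (u , u≤ , eq) → ℕ.<⇒≱ (ℕ.≤-reflexive (≡.cong suc (position eq)))
    (ℕ.≤-trans (s≤s (ℕ.+-monoʳ-≤ a u≤)) (≡.subst (_≤ t) (ℕ.+-suc a (l ℕ.+ l)) t≥)) }
  length≡ : suc (n ℕ.+ n) ≡ a ℕ.+ (suc (l ℕ.+ l) ℕ.+ (i ℕ.+ i ∸ a))
  length≡ = ≡.sym (begin
    a ℕ.+ (suc (l ℕ.+ l) ℕ.+ (i ℕ.+ i ∸ a))   ≡⟨ ≡.cong (a ℕ.+_) (ℕ.+-comm (suc (l ℕ.+ l)) _) ⟩
    a ℕ.+ (i ℕ.+ i ∸ a ℕ.+ suc (l ℕ.+ l))     ≡⟨ ℕ.+-assoc a _ _ ⟨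
    a ℕ.+ (i ℕ.+ i ∸ a) ℕ.+ suc (l ℕ.+ l)     ≡⟨ ≡.cong (ℕ._+ suc (l ℕ.+ l)) (ℕ.m+[n∸m]≡n a≤2i) ⟩
    i ℕ.+ i ℕ.+ suc (l ℕ.+ l)                 ≡⟨ ℕ.+-suc (i ℕ.+ i) (l ℕ.+ l) ⟩
    suc (i ℕ.+ i ℕ.+ (l ℕ.+ l))               ≡⟨ ≡.cong suc (ℤ.+-injective
      (Z.solve 2 (λ i l → i Z.:+ i Z.:+ (l Z.:+ l) Z.:= i Z.:+ l Z.:+ (i Z.:+ l)) ≡.refl (+ i) (+ l))) ⟩
    suc (n ℕ.+ n)                             ∎)

Mom : (ℤ → ℚ) → BSeries → Series
Mom Φ f n = sumZ n (λ m → Φ m ℚ.* f n m)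

Mom-as-ΣZ : ∀ Φ f n → Mom Φ f n ≡ ΣZ n (λ m → Φ m ℚ.* f n m)
Mom-as-ΣZ Φ f n = sumZ≡ΣZ n (λ m → Φ m ℚ.* f n m)

Supported : BSeries → Set
Supported f = ∀ n z → ¬ InRange n z → f n z ≡ 0ℚ

-- A moment of a product has the kernel K j z = Φ(z+j). With K free, a kernel can be split into
-- separable summands u(j) v(z), and each of these yields a Cauchy product of moments.
kernelSum : (ℤ → ℤ → ℚ) → BSeries → BSeries → Series
kernelSum K f g n =
  Q.Σ< (suc n) (λ i → ΣZ i (λ j → f i j ℚ.* ΣZ (n ∸ i) (λ z → K j z ℚ.* g (n ∸ i) z)))

⊛ᵇ-as-Σ : ∀ f g n m → (f ⊛ᵇ g) n m ≡ Q.Σ< (suc n) (λ i → ΣZ i (λ j → f i j ℚ.* g (n ∸ i) (m ℤ.- j)))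
⊛ᵇ-as-Σ f g n m = ≡.trans (sumTo≡Σ (suc n) _)
  (Q.Σ-cong (suc n) (λ i → sumZ≡ΣZ i (λ j → f i j ℚ.* g (n ∸ i) (m ℤ.- j))))

Mom-⊛ᵇ : ∀ Φ f g → Supported g → ∀ n → Mom Φ (f ⊛ᵇ g) n ≡ kernelSum (λ j z → Φ (z ℤ.+ j)) f g n
Mom-⊛ᵇ Φ f g supp n = begin
  Mom Φ (f ⊛ᵇ g) n
    ≡⟨ Mom-as-ΣZ Φ (f ⊛ᵇ g) n ⟩
  ΣZ n (λ m → Φ m ℚ.* (f ⊛ᵇ g) n m)
    ≡⟨ ΣZ-cong n (λ m → ≡.trans (≡.cong (Φ m ℚ.*_) (⊛ᵇ-as-Σ f g n m)) (≡.sym (Q.Σ-*ˡ (suc n) (Φ m) _))) ⟩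
  ΣZ n (λ m → Q.Σ< (suc n) (λ i → Φ m ℚ.* ΣZ i (λ j → f i j ℚ.* g (n ∸ i) (m ℤ.- j))))
    ≡⟨ Q.Σ-swap (suc (n ℕ.+ n)) (suc n) _ ⟩
  Q.Σ< (suc n) (λ i → ΣZ n (λ m → Φ m ℚ.* ΣZ i (λ j → f i j ℚ.* g (n ∸ i) (m ℤ.- j))))
    ≡⟨ Q.Σ-cong< (suc n) inner ⟩
  kernelSum (λ j z → Φ (z ℤ.+ j)) f g n  ∎
  where
  open ≡.≡-Reasoning
  inner : ∀ i → i < suc n →
    ΣZ n (λ m → Φ m ℚ.* ΣZ i (λ j → f i j ℚ.* g (n ∸ i) (m ℤ.- j)))
      ≡ ΣZ i (λ j → f i j ℚ.* ΣZ (n ∸ i) (λ z → Φ (z ℤ.+ j) ℚ.* g (n ∸ i) z))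
  inner i i<sn = begin
    ΣZ n (λ m → Φ m ℚ.* ΣZ i (λ j → f i j ℚ.* ψ (m ℤ.- j)))
      ≡⟨ ΣZ-cong n (λ m → ≡.sym (ΣZ-*ˡ i (Φ m) (λ j → f i j ℚ.* ψ (m ℤ.- j)))) ⟩
    ΣZ n (λ m → ΣZ i (λ j → Φ m ℚ.* (f i j ℚ.* ψ (m ℤ.- j))))
      ≡⟨ Q.Σ-swap (suc (n ℕ.+ n)) (suc (i ℕ.+ i)) _ ⟩
    ΣZ i (λ j → ΣZ n (λ m → Φ m ℚ.* (f i j ℚ.* ψ (m ℤ.- j))))
      ≡⟨ Q.Σ-cong< (suc (i ℕ.+ i)) (λ a a< → begin
           ΣZ n (λ m → Φ m ℚ.* (f i (offset i a) ℚ.* ψ (m ℤ.- offset i a)))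
             ≡⟨ ΣZ-cong n (λ m → Q.solve 3 (λ x y z → x Q.:* (y Q.:* z) Q.:= y Q.:* (x Q.:* z)) ≡.refl (Φ m) (f i (offset i a)) (ψ (m ℤ.- offset i a))) ⟩
           ΣZ n (λ m → f i (offset i a) ℚ.* (Φ m ℚ.* ψ (m ℤ.- offset i a)))
             ≡⟨ ΣZ-*ˡ n (f i (offset i a)) (λ m → Φ m ℚ.* ψ (m ℤ.- offset i a)) ⟩
           f i (offset i a) ℚ.* ΣZ n (λ m → Φ m ℚ.* ψ (m ℤ.- offset i a))
             ≡⟨ ≡.cong (λ k → f i (offset i a) ℚ.* ΣZ k (λ m → Φ m ℚ.* ψ (m ℤ.- offset i a))) (ℕ.m+[n∸m]≡n (ℕ.s≤s⁻¹ i<sn)) ⟨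
           f i (offset i a) ℚ.* ΣZ (i ℕ.+ (n ∸ i)) (λ m → Φ m ℚ.* ψ (m ℤ.- offset i a))
             ≡⟨ ≡.cong (f i (offset i a) ℚ.*_) (ΣZ-shift i (n ∸ i) a Φ ψ (ℕ.s≤s⁻¹ a<) (supp (n ∸ i))) ⟩
           f i (offset i a) ℚ.* ΣZ (n ∸ i) (λ z → Φ (z ℤ.+ offset i a) ℚ.* ψ z)  ∎) ⟩
    ΣZ i (λ j → f i j ℚ.* ΣZ (n ∸ i) (λ z → Φ (z ℤ.+ j) ℚ.* ψ z))  ∎
    where
    ψ : ℤ → ℚ
    ψ = g (n ∸ i)

kernelSum-cong : ∀ {K K′} f g → (∀ j z → K j z ≡ K′ j z) → ∀ n → kernelSum K f g n ≡ kernelSum K′ f g n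
kernelSum-cong f g eq n = Q.Σ-cong (suc n) (λ i → ΣZ-cong i (λ j → ≡.cong (f i j ℚ.*_)
  (ΣZ-cong (n ∸ i) (λ z → ≡.cong (ℚ._* g (n ∸ i) z) (eq j z)))))

kernelSum-+ : ∀ K K′ f g n → kernelSum (λ j z → K j z ℚ.+ K′ j z) f g n ≡ kernelSum K f g n ℚ.+ kernelSum K′ f g n
kernelSum-+ K K′ f g n = ≡.trans
  (Q.Σ-cong (suc n) (λ i → ≡.trans (ΣZ-cong i (inner i)) (ΣZ-+ i (λ j → f i j ℚ.* S K i j) (λ j → f i j ℚ.* S K′ i j))))
  (Q.Σ-+ (suc n) (λ i → ΣZ i (λ j → f i j ℚ.* S K i j)) (λ i → ΣZ i (λ j → f i j ℚ.* S K′ i j)))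
  where
  S : (ℤ → ℤ → ℚ) → ℕ → ℤ → ℚ
  S K i j = ΣZ (n ∸ i) (λ z → K j z ℚ.* g (n ∸ i) z)
  inner : ∀ i j → f i j ℚ.* S (λ j z → K j z ℚ.+ K′ j z) i j ≡ f i j ℚ.* S K i j ℚ.+ f i j ℚ.* S K′ i j
  inner i j = ≡.trans (≡.cong (f i j ℚ.*_) (≡.trans
      (ΣZ-cong (n ∸ i) (λ z → ℚ.*-distribʳ-+ (g (n ∸ i) z) (K j z) (K′ j z)))
      (ΣZ-+ (n ∸ i) (λ z → K j z ℚ.* g (n ∸ i) z) (λ z → K′ j z ℚ.* g (n ∸ i) z))))
    (ℚ.*-distribˡ-+ (f i j) (S K i j) (S K′ i j))

kernelSum-* : ∀ u v f g n → kernelSum (λ j z → u j ℚ.* v z) f g n ≡ (Mom u f ⊛ Mom v g) n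
kernelSum-* u v f g n = ≡.sym (≡.trans (⊛-as-Σ (Mom u f) (Mom v g) n) (Q.Σ-cong (suc n) λ i → begin
  Mom u f i ℚ.* Mom v g (n ∸ i)
    ≡⟨ ≡.cong₂ ℚ._*_ (Mom-as-ΣZ u f i) (Mom-as-ΣZ v g (n ∸ i)) ⟩
  ΣZ i (λ j → u j ℚ.* f i j) ℚ.* ΣZ (n ∸ i) (λ z → v z ℚ.* g (n ∸ i) z)
    ≡⟨ ΣZ-*ʳ i (ΣZ (n ∸ i) (λ z → v z ℚ.* g (n ∸ i) z)) (λ j → u j ℚ.* f i j) ⟨
  ΣZ i (λ j → u j ℚ.* f i j ℚ.* ΣZ (n ∸ i) (λ z → v z ℚ.* g (n ∸ i) z))
    ≡⟨ ΣZ-cong i (λ j → ≡.trans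
         (Q.solve 3 (λ u f s → u Q.:* f Q.:* s Q.:= f Q.:* (u Q.:* s)) ≡.refl (u j) (f i j) (ΣZ (n ∸ i) (λ z → v z ℚ.* g (n ∸ i) z)))
         (≡.cong (f i j ℚ.*_) (≡.trans (≡.sym (ΣZ-*ˡ (n ∸ i) (u j) (λ z → v z ℚ.* g (n ∸ i) z)))
           (ΣZ-cong (n ∸ i) (λ z → ≡.sym (ℚ.*-assoc (u j) (v z) (g (n ∸ i) z))))))) ⟩
  ΣZ i (λ j → f i j ℚ.* ΣZ (n ∸ i) (λ z → u j ℚ.* v z ℚ.* g (n ∸ i) z))  ∎))
  where open ≡.≡-Reasoning

Φ₀ Φ₁ Φ₂ : ℤ → ℚ
Φ₀ _ = 1ℚ
Φ₁ m = ℤtoℚ m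
Φ₂ m = ℤtoℚ (m ℤ.* m)

Mom₀-⊛ᵇ : ∀ f g → Supported g → ∀ n → Mom Φ₀ (f ⊛ᵇ g) n ≡ (Mom Φ₀ f ⊛ Mom Φ₀ g) n
Mom₀-⊛ᵇ f g supp n = ≡.trans (Mom-⊛ᵇ Φ₀ f g supp n) (kernelSum-* Φ₀ Φ₀ f g n)

Mom₁-⊛ᵇ : ∀ f g → Supported g → ∀ n →
          Mom Φ₁ (f ⊛ᵇ g) n ≡ (Mom Φ₁ f ⊛ Mom Φ₀ g ⊕ Mom Φ₀ f ⊛ Mom Φ₁ g) n
Mom₁-⊛ᵇ f g supp n = begin
  Mom Φ₁ (f ⊛ᵇ g) n
    ≡⟨ Mom-⊛ᵇ Φ₁ f g supp n ⟩
  kernelSum (λ j z → Φ₁ (z ℤ.+ j)) f g n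
    ≡⟨ kernelSum-cong f g (λ j z → ≡.trans (ℤtoℚ-+ z j)
         (Q.solve 2 (λ z j → z Q.:+ j Q.:= j Q.:* Q.con (+ 1) Q.:+ Q.con (+ 1) Q.:* z) ≡.refl (Φ₁ z) (Φ₁ j))) n ⟩
  kernelSum (λ j z → K₁₀ j z ℚ.+ K₀₁ j z) f g n
    ≡⟨ kernelSum-+ K₁₀ K₀₁ f g n ⟩
  kernelSum K₁₀ f g n ℚ.+ kernelSum K₀₁ f g n
    ≡⟨ ≡.cong₂ ℚ._+_ (kernelSum-* Φ₁ Φ₀ f g n) (kernelSum-* Φ₀ Φ₁ f g n) ⟩
  (Mom Φ₁ f ⊛ Mom Φ₀ g ⊕ Mom Φ₀ f ⊛ Mom Φ₁ g) n  ∎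
  where
  open ≡.≡-Reasoning
  K₁₀ K₀₁ : ℤ → ℤ → ℚ
  K₁₀ j z = Φ₁ j ℚ.* Φ₀ z
  K₀₁ j z = Φ₀ j ℚ.* Φ₁ z

Mom₂-⊛ᵇ : ∀ f g → Supported g → ∀ n →
          Mom Φ₂ (f ⊛ᵇ g) n ≡ (Mom Φ₂ f ⊛ Mom Φ₀ g ⊕ (Mom Φ₁ f ⊛ Mom Φ₁ g ⊕ Mom Φ₁ f ⊛ Mom Φ₁ g) ⊕ Mom Φ₀ f ⊛ Mom Φ₂ g) n
Mom₂-⊛ᵇ f g supp n = begin
  Mom Φ₂ (f ⊛ᵇ g) n
    ≡⟨ Mom-⊛ᵇ Φ₂ f g supp n ⟩
  kernelSum (λ j z → Φ₂ (z ℤ.+ j)) f g n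
    ≡⟨ kernelSum-cong f g square n ⟩
  kernelSum (λ j z → K₂₀ j z ℚ.+ (K₁₁ j z ℚ.+ K₁₁ j z) ℚ.+ K₀₂ j z) f g n
    ≡⟨ ≡.trans (kernelSum-+ (λ j z → K₂₀ j z ℚ.+ (K₁₁ j z ℚ.+ K₁₁ j z)) K₀₂ f g n)
         (≡.cong (ℚ._+ kernelSum K₀₂ f g n) (≡.trans (kernelSum-+ K₂₀ (λ j z → K₁₁ j z ℚ.+ K₁₁ j z) f g n)
         (≡.cong (kernelSum K₂₀ f g n ℚ.+_) (kernelSum-+ K₁₁ K₁₁ f g n)))) ⟩
  kernelSum K₂₀ f g n ℚ.+ (kernelSum K₁₁ f g n ℚ.+ kernelSum K₁₁ f g n) ℚ.+ kernelSum K₀₂ f g n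
    ≡⟨ ≡.cong₂ ℚ._+_ (≡.cong₂ ℚ._+_ (kernelSum-* Φ₂ Φ₀ f g n)
         (≡.cong₂ ℚ._+_ (kernelSum-* Φ₁ Φ₁ f g n) (kernelSum-* Φ₁ Φ₁ f g n))) (kernelSum-* Φ₀ Φ₂ f g n) ⟩
  (Mom Φ₂ f ⊛ Mom Φ₀ g ⊕ (Mom Φ₁ f ⊛ Mom Φ₁ g ⊕ Mom Φ₁ f ⊛ Mom Φ₁ g) ⊕ Mom Φ₀ f ⊛ Mom Φ₂ g) n  ∎
  where
  open ≡.≡-Reasoning
  K₂₀ K₁₁ K₀₂ : ℤ → ℤ → ℚ
  K₂₀ j z = Φ₂ j ℚ.* Φ₀ z
  K₁₁ j z = Φ₁ j ℚ.* Φ₁ z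
  K₀₂ j z = Φ₀ j ℚ.* Φ₂ z
  square : ∀ j z → Φ₂ (z ℤ.+ j) ≡ Φ₂ j ℚ.* 1ℚ ℚ.+ (Φ₁ j ℚ.* Φ₁ z ℚ.+ Φ₁ j ℚ.* Φ₁ z) ℚ.+ 1ℚ ℚ.* Φ₂ z
  square j z = begin
    Φ₂ (z ℤ.+ j)
      ≡⟨ ≡.trans (ℤtoℚ-* (z ℤ.+ j) (z ℤ.+ j)) (≡.cong₂ ℚ._*_ (ℤtoℚ-+ z j) (ℤtoℚ-+ z j)) ⟩
    (Φ₁ z ℚ.+ Φ₁ j) ℚ.* (Φ₁ z ℚ.+ Φ₁ j)
      ≡⟨ Q.solve 2 (λ z j → (z Q.:+ j) Q.:* (z Q.:+ j) Q.:=
           j Q.:* j Q.:* Q.con (+ 1) Q.:+ (j Q.:* z Q.:+ j Q.:* z) Q.:+ Q.con (+ 1) Q.:* (z Q.:* z)) ≡.refl (Φ₁ z) (Φ₁ j) ⟩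
    Φ₁ j ℚ.* Φ₁ j ℚ.* 1ℚ ℚ.+ (Φ₁ j ℚ.* Φ₁ z ℚ.+ Φ₁ j ℚ.* Φ₁ z) ℚ.+ 1ℚ ℚ.* (Φ₁ z ℚ.* Φ₁ z)
      ≡⟨ ≡.cong₂ (λ x y → x ℚ.* 1ℚ ℚ.+ (Φ₁ j ℚ.* Φ₁ z ℚ.+ Φ₁ j ℚ.* Φ₁ z) ℚ.+ 1ℚ ℚ.* y) (ℤtoℚ-* j j) (ℤtoℚ-* z z) ⟨
    Φ₂ j ℚ.* 1ℚ ℚ.+ (Φ₁ j ℚ.* Φ₁ z ℚ.+ Φ₁ j ℚ.* Φ₁ z) ℚ.+ 1ℚ ℚ.* Φ₂ z  ∎

Supported-⊛ᵇ : ∀ f g → Supported g → Supported (f ⊛ᵇ g)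
Supported-⊛ᵇ f g supp n m out = ≡.trans (⊛ᵇ-as-Σ f g n m)
  (Q.Σ-zero (suc n) (λ i i<sn → Q.Σ-zero (suc (i ℕ.+ i)) (λ a a< → ≡.trans
    (≡.cong (f i (offset i a) ℚ.*_) (supp (n ∸ i) (m ℤ.- offset i a) (λ inner → out (enlarge i i<sn a a< inner))))
    (ℚ.*-zeroʳ (f i (offset i a))))))
  where
  enlarge : ∀ i → i < suc n → ∀ a → a < suc (i ℕ.+ i) → InRange (n ∸ i) (m ℤ.- offset i a) → InRange n m
  enlarge i i<sn a a< (u , u≤ , eq) = a ℕ.+ u , bound , (begin
    m                                     ≡⟨ Z.solve 2 (λ m o → m Z.:= (m Z.:- o) Z.:+ o) ≡.refl m (offset i a) ⟩
    m ℤ.- offset i a ℤ.+ offset i a       ≡⟨ ≡.cong (ℤ._+ offset i a) eq ⟩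
    offset (n ∸ i) u ℤ.+ offset i a       ≡⟨ Z.solve 4 (λ u l a i → (u Z.:- l) Z.:+ (a Z.:- i) Z.:= (a Z.:+ u) Z.:- (i Z.:+ l)) ≡.refl (+ u) (+ (n ∸ i)) (+ a) (+ i) ⟩
    offset (i ℕ.+ (n ∸ i)) (a ℕ.+ u)      ≡⟨ ≡.cong (λ k → offset k (a ℕ.+ u)) i+l≡n ⟩
    offset n (a ℕ.+ u)                    ∎)
    where
    open ≡.≡-Reasoning
    i+l≡n : i ℕ.+ (n ∸ i) ≡ n
    i+l≡n = ℕ.m+[n∸m]≡n (ℕ.s≤s⁻¹ i<sn)
    bound : a ℕ.+ u ≤ n ℕ.+ n
    bound = ℕ.≤-trans (ℕ.+-mono-≤ (ℕ.s≤s⁻¹ a<) u≤) (ℕ.≤-reflexive (≡.trans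
      (ℤ.+-injective (Z.solve 2 (λ i l → i Z.:+ i Z.:+ (l Z.:+ l) Z.:= i Z.:+ l Z.:+ (i Z.:+ l)) ≡.refl (+ i) (+ (n ∸ i))))
      (≡.cong₂ ℕ._+_ i+l≡n i+l≡n)))

bmono-≢ : ∀ {s m} k n → m ≢ s → bmono s k n m ≡ 0ℚ
bmono-≢ {s} {m} k n m≢s with k ℕ.≡ᵇ n
... | false = ≡.refl
... | true rewrite dec-false (s ℤ.≟ m) (λ s≡m → m≢s (≡.sym s≡m)) = ≡.refl

bmono-self : ∀ s k n → bmono s k n s ≡ mono k n
bmono-self s k n rewrite dec-true (s ℤ.≟ s) ≡.refl = ≡.refl

Mom-bmono : ∀ Φ s k n → InRange n s → Mom Φ (bmono s k) n ≡ Φ s ℚ.* mono k n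
Mom-bmono Φ s k n s∈ = ≡.trans (Mom-as-ΣZ Φ (bmono s k) n) (≡.trans
  (ΣZ-single n (λ m → Φ m ℚ.* bmono s k n m) s∈ (λ m m≢s → ≡.trans (≡.cong (Φ m ℚ.*_) (bmono-≢ k n m≢s)) (ℚ.*-zeroʳ (Φ m))))
  (≡.cong (Φ s ℚ.*_) (bmono-self s k n)))

0∈ : ∀ n → InRange n (+ 0)
0∈ n = n , ℕ.m≤m+n n n , ≡.sym (ℤ.+-inverseʳ (+ n))

+∈ : ∀ {a n} → a ≤ n → InRange n (+ a)
+∈ {a} {n} a≤n = a ℕ.+ n , ℕ.+-monoˡ-≤ n a≤n ,
  Z.solve 2 (λ a n → a Z.:= (a Z.:+ n) Z.:- n) ≡.refl (+ a) (+ n)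

-∈ : ∀ {a n} → a ≤ n → InRange n (ℤ.- (+ a))
-∈ {a} {n} a≤n = n ∸ a , ℕ.≤-trans (ℕ.m∸n≤m n a) (ℕ.m≤m+n n n) , (begin
  ℤ.- (+ a)                              ≡⟨ ℤ.+-identityˡ _ ⟨
  + 0 ℤ.- + a                            ≡⟨ Z.solve 2 (λ a l → Z.con (+ 0) Z.:- a Z.:= l Z.:- (a Z.:+ l)) ≡.refl (+ a) (+ (n ∸ a)) ⟩
  offset (a ℕ.+ (n ∸ a)) (n ∸ a)         ≡⟨ ≡.cong (λ k → offset k (n ∸ a)) (ℕ.m+[n∸m]≡n a≤n) ⟩
  offset n (n ∸ a)                       ∎)
  where open ≡.≡-Reasoning

-- With s a = a and s a = -a this is definitionally `geomZ` and `geomZ⁻`, so both are treated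
-- together.
module _ (s : ℕ → ℤ) (s∈ : ∀ {a n} → a ≤ n → InRange n (s a)) (k : ℕ) where
  geomSeries : BSeries
  geomSeries = bInfSum (λ a → bmono (s a) (k ℕ.* a))

  Mom-geom : ∀ Φ n → Mom Φ geomSeries n ≡ infSum (λ a → scale (Φ (s a)) (mono (k ℕ.* a))) n
  Mom-geom Φ n = begin
    Mom Φ geomSeries n
      ≡⟨ Mom-as-ΣZ Φ geomSeries n ⟩
    ΣZ n (λ m → Φ m ℚ.* geomSeries n m)
      ≡⟨ ΣZ-cong n (λ m → ≡.trans (≡.cong (Φ m ℚ.*_) (sumTo≡Σ (suc n) (λ a → bmono (s a) (k ℕ.* a) n m)))
         (≡.sym (Q.Σ-*ˡ (suc n) (Φ m) (λ a → bmono (s a) (k ℕ.* a) n m)))) ⟩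
    ΣZ n (λ m → Q.Σ< (suc n) (λ a → Φ m ℚ.* bmono (s a) (k ℕ.* a) n m))
      ≡⟨ Q.Σ-swap (suc (n ℕ.+ n)) (suc n) _ ⟩
    Q.Σ< (suc n) (λ a → ΣZ n (λ m → Φ m ℚ.* bmono (s a) (k ℕ.* a) n m))
      ≡⟨ Q.Σ-cong< (suc n) (λ a a< → ≡.trans (≡.sym (Mom-as-ΣZ Φ (bmono (s a) (k ℕ.* a)) n)) (Mom-bmono Φ (s a) (k ℕ.* a) n (s∈ (ℕ.s≤s⁻¹ a<)))) ⟩
    Q.Σ< (suc n) (λ a → Φ (s a) ℚ.* mono (k ℕ.* a) n)
      ≡⟨ sumTo≡Σ (suc n) _ ⟨
    infSum (λ a → scale (Φ (s a)) (mono (k ℕ.* a))) n  ∎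
    where open ≡.≡-Reasoning

  Supported-geom : Supported geomSeries
  Supported-geom n m out = ≡.trans (sumTo≡Σ (suc n) _) (Q.Σ-zero (suc n) (λ a a< →
    bmono-≢ (k ℕ.* a) n (λ m≡s → out (≡.subst (InRange n) (≡.sym m≡s) (s∈ (ℕ.s≤s⁻¹ a<))))))

Mom-lift : ∀ Φ f n → Mom Φ (lift f) n ≡ Φ (+ 0) ℚ.* f n
Mom-lift Φ f n = ≡.trans (Mom-as-ΣZ Φ (lift f) n)
  (ΣZ-single n (λ m → Φ m ℚ.* lift f n m) (0∈ n) (λ m m≢0 → ≡.trans (≡.cong (Φ m ℚ.*_) (lift-≢ m m≢0)) (ℚ.*-zeroʳ (Φ m))))
  where
  lift-≢ : ∀ m → m ≢ + 0 → lift f n m ≡ 0ℚ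
  lift-≢ m m≢0 rewrite dec-false (m ℤ.≟ + 0) m≢0 = ≡.refl

mono-off : ∀ k m → m ≢ k → mono k m ≡ 0ℚ
mono-off zero    zero    m≢k = contradiction ≡.refl m≢k
mono-off zero    (suc m) m≢k = ≡.refl
mono-off (suc k) zero    m≢k = ≡.refl
mono-off (suc k) (suc m) m≢k = mono-off k m (λ m≡k → m≢k (≡.cong suc m≡k))

mono-self : ∀ k → mono k k ≡ 1ℚ
mono-self zero    = ≡.refl
mono-self (suc k) = mono-self k

-- Evaluation of rational power series at a nilpotent element

record Coefficients (R : CommutativeRing 0ℓ 0ℓ) : Set where
  open CommutativeRing R
  field
    κ     : ℚ → Carrier
    κ-0   : κ 0ℚ ≈ 0#
    κ-1   : κ 1ℚ ≈ 1#
    κ-+   : ∀ x y → κ (x ℚ.+ y) ≈ κ x + κ y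
    κ-*   : ∀ x y → κ (x ℚ.* y) ≈ κ x * κ y
    κ-neg : ∀ x → κ (ℚ.- x) ≈ - κ x

module Evaluation (R : CommutativeRing 0ℓ 0ℓ) (q : CommutativeRing.Carrier R) (n : ℕ)
                  (q^N≈0 : CommutativeRing._≈_ R (FiniteSums._^_ R q (suc n)) (CommutativeRing.0# R))
                  (coefficients : Coefficients R)
                  where
  open FiniteSums R
  open Nilpotent R q n q^N≈0
  open RankMoment R q n q^N≈0
  open Coefficients coefficients
  open Algebra.Properties.Ring ring using (-1*x≈-x; -‿distribˡ-*; -‿distribʳ-*; -‿involutive)

  -- `ev` substitutes the nilpotent element for the variable. Its use at q² turns the moment series
  -- of rank and crank into those on the right-hand sides.
  ev< : ℕ → Series → Carrier
  ev< k f = Σ< k (λ m → κ (f m) * q ^ m)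

  ev : Series → Carrier
  ev = ev< N

  ev-cong : ∀ {f g} → f ≡ g mod N → ev f ≈ ev g
  ev-cong e = Σ-cong< N (λ m m<N → *-congʳ (≡⇒≈ (≡.cong κ (coeff e m m<N))))

  ev-⊕ : ∀ k f g → ev< k (f ⊕ g) ≈ ev< k f + ev< k g
  ev-⊕ k f g = trans (Σ-cong k (λ m → trans (*-congʳ (κ-+ (f m) (g m))) (distribʳ _ _ _))) (Σ-+ k _ _)

  ev-⊝ : ∀ f → ev (⊝ f) ≈ - ev f
  ev-⊝ f = x+y≈0⇒x≈-y (begin
    ev (⊝ f) + ev f
      ≈⟨ Σ-+ N _ _ ⟨
    Σ< N (λ m → κ (ℚ.- f m) * q ^ m + κ (f m) * q ^ m)
      ≈⟨ Σ-zero N (λ m _ → trans (sym (distribʳ _ _ _)) (0*y≈0 (trans (+-congʳ (κ-neg (f m))) (-‿inverseˡ _)))) ⟩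
    0#  ∎)
    where
    x+y≈0⇒x≈-y : ∀ {x y} → x + y ≈ 0# → x ≈ - y
    x+y≈0⇒x≈-y {x} {y} e = trans (solve 2 (λ x y → x := (x :+ y) :- y) refl x y) (trans (+-congʳ e) (+-identityˡ _))

  ev-scale : ∀ k c f → ev< k (scale c f) ≈ κ c * ev< k f
  ev-scale k c f = trans (Σ-cong k (λ m → trans (*-congʳ (κ-* c (f m))) (*-assoc _ _ _))) (Σ-*ˡ k (κ c) _)

  ev-mono : ∀ k → ev (mono k) ≈ q ^ k
  ev-mono k with k ℕ.<? N
  ... | yes k<N = trans (Σ-single N (λ m → κ (mono k m) * q ^ m) k<N
                          (λ m m≢k → 0*y≈0 (trans (≡⇒≈ (≡.cong κ (mono-off k m m≢k))) κ-0)))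
                        (trans (*-congʳ (trans (≡⇒≈ (≡.cong κ (mono-self k))) κ-1)) (*-identityˡ _))
  ... | no  k≮N = trans (Σ-zero N (λ m m<N → 0*y≈0 (trans (≡⇒≈ (≡.cong κ (mono-≢ (ℕ.<-≤-trans m<N (ℕ.≮⇒≥ k≮N))))) κ-0)))
                        (sym (q^-vanish (ℕ.≮⇒≥ k≮N)))

  ev-𝟘 : ev 𝟘 ≈ 0#
  ev-𝟘 = Σ-zero N (λ _ _ → 0*y≈0 κ-0)

  ev-suc : ∀ k f → ev< (suc k) f ≈ κ (f 0) + q * ev< k (λ m → f (suc m))
  ev-suc k f = trans (Σ-head k _) (+-cong (*-identityʳ _) (trans
    (Σ-cong k (λ m → solve 3 (λ c q x → c :* (q :* x) := q :* (c :* x)) refl (κ (f (suc m))) q (q ^ m))) (Σ-*ˡ k q _)))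

  -- Truncated evaluations multiply up to multiples of q^k, which q^j annihilates once N ≤ j + k.
  ev-⊛-below : ∀ k j → N ≤ j ℕ.+ k → ∀ f g → q ^ j * ev< k (f ⊛ g) ≈ q ^ j * (ev< k f * ev< k g)
  ev-⊛-below zero    j N≤ f g = *-congˡ (sym (zeroˡ _))
  ev-⊛-below (suc k) j N≤ f g = begin
    q ^ j * ev< (suc k) (f ⊛ g)
      ≈⟨ *-congˡ (ev-suc k (f ⊛ g)) ⟩
    q ^ j * (κ ((f ⊛ g) 0) + q * ev< k (λ m → (f ⊛ g) (suc m)))
      ≈⟨ *-congˡ (+-cong (trans (≡⇒≈ (≡.cong κ (⊛-zero f g))) (κ-* (f 0) (g 0)))
           (*-congˡ (trans (Σ-cong k (λ m → *-congʳ (≡⇒≈ (≡.cong κ (⊛-sucˡ f g m)))))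
             (trans (ev-⊕ k (scale (f 0) g′) (f′ ⊛ g)) (+-congʳ (ev-scale k (f 0) g′)))))) ⟩
    q ^ j * (κ (f 0) * κ (g 0) + q * (κ (f 0) * ev< k g′ + ev< k (f′ ⊛ g)))
      ≈⟨ solve 6 (λ x a b q s t → x :* (a :* b :+ q :* (a :* s :+ t)) := x :* (a :* (b :+ q :* s)) :+ q :* x :* t) refl
           (q ^ j) (κ (f 0)) (κ (g 0)) q (ev< k g′) (ev< k (f′ ⊛ g)) ⟩
    q ^ j * (κ (f 0) * (κ (g 0) + q * ev< k g′)) + q ^ suc j * ev< k (f′ ⊛ g)
      ≈⟨ +-cong (*-congˡ (*-congˡ (sym (ev-suc k g)))) (ev-⊛-below k (suc j) (≡.subst (N ≤_) (ℕ.+-suc j k) N≤) f′ g) ⟩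
    q ^ j * (κ (f 0) * ev< (suc k) g) + q ^ suc j * (ev< k f′ * ev< k g)
      ≈⟨ +-congˡ (+-elimʳ tail) ⟨
    q ^ j * (κ (f 0) * ev< (suc k) g) + (q ^ suc j * (ev< k f′ * ev< k g) + ev< k f′ * κ (g k) * (q ^ suc j * q ^ k))
      ≈⟨ solve 7 (λ x a q e s c y → x :* (a :* (s :+ c :* y)) :+ (q :* x :* (e :* s) :+ e :* c :* (q :* x :* y)) :=
           x :* ((a :+ q :* e) :* (s :+ c :* y))) refl (q ^ j) (κ (f 0)) q (ev< k f′) (ev< k g) (κ (g k)) (q ^ k) ⟩
    q ^ j * ((κ (f 0) + q * ev< k f′) * ev< (suc k) g)
      ≈⟨ *-congˡ (*-congʳ (ev-suc k f)) ⟨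
    q ^ j * (ev< (suc k) f * ev< (suc k) g)  ∎
    where
    f′ g′ : Series
    f′ m = f (suc m)
    g′ m = g (suc m)
    tail : ev< k f′ * κ (g k) * (q ^ suc j * q ^ k) ≈ 0#
    tail = x*0≈0 (trans (sym (^-homo-* q (suc j) k)) (q^-vanish (≡.subst (N ≤_) (ℕ.+-suc j k) N≤)))

  ev-⊛ : ∀ f g → ev (f ⊛ g) ≈ ev f * ev g
  ev-⊛ f g = trans (sym (*-identityˡ _)) (trans (ev-⊛-below N 0 ℕ.≤-refl f g) (*-identityˡ _))

  private module S = FiniteSums (seriesRing N)

  ev-Σ : ∀ k T → ev (S.Σ< k T) ≈ Σ< k (λ a → ev (T a))
  ev-Σ zero    T = ev-𝟘
  ev-Σ (suc k) T = trans (ev-⊕ N (S.Σ< k T) (T k)) (+-congʳ (ev-Σ k T))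

  ev-Π : ∀ k T → ev (S.Π< k T) ≈ Π< k (λ a → ev (T a))
  ev-Π zero    T = ev-mono 0
  ev-Π (suc k) T = trans (ev-⊛ (S.Π< k T) (T k)) (*-congʳ (ev-Π k T))

  ev-infSum : ∀ (c : ℕ → ℚ) k → ev (infSum (λ a → scale (c a) (mono (suc k ℕ.* a)))) ≈ Σ< N (λ a → κ (c a) * (q ^ suc k) ^ a)
  ev-infSum c k = begin
    ev (infSum (λ a → scale (c a) (mono (suc k ℕ.* a))))
      ≈⟨ ev-cong (infSum≈Σ N _ (λ a m m<a → ≡.trans
           (≡.cong (c a ℚ.*_) (mono-≢ (ℕ.<-≤-trans m<a (ℕ.m≤n*m a (suc k))))) (ℚ.*-zeroʳ (c a)))) ⟩
    ev (S.Σ< N (λ a → scale (c a) (mono (suc k ℕ.* a))))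
      ≈⟨ ev-Σ N _ ⟩
    Σ< N (λ a → ev (scale (c a) (mono (suc k ℕ.* a))))
      ≈⟨ Σ-cong N (λ a → trans (ev-scale N (c a) _) (*-congˡ (trans (ev-mono (suc k ℕ.* a)) (sym (^-assocʳ q (suc k) a))))) ⟩
    Σ< N (λ a → κ (c a) * (q ^ suc k) ^ a)  ∎

  ev-poch : ev (poch∞ 1 1) ≈ F N
  ev-poch = begin
    ev (poch∞ 1 1)
      ≈⟨ ev-cong (infProd≈Π N _ (λ k → 1-mono≡one (k<a+dk 0 0 k))) ⟩
    ev (S.Π< N (λ k → one ⊖ mono (1 ℕ.+ 1 ℕ.* k)))
      ≈⟨ ev-Π N _ ⟩
    Π< N (λ k → ev (one ⊖ mono (1 ℕ.+ 1 ℕ.* k)))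
      ≈⟨ Π-cong N (λ k → trans (ev-⊕ N one (⊝ mono (1 ℕ.+ 1 ℕ.* k)))
           (+-cong (ev-mono 0) (trans (ev-⊝ (mono (1 ℕ.+ 1 ℕ.* k))) (-‿cong (trans (ev-mono (1 ℕ.+ 1 ℕ.* k))
             (≡⇒≈ (≡.cong (λ m → q ^ suc m) (ℕ.*-identityˡ k)))))))) ⟩
    F N  ∎

  κ-ℕ : ∀ a → κ (ℤtoℚ (+ a)) ≈ ν a
  κ-ℕ zero    = κ-0
  κ-ℕ (suc a) = trans (≡⇒≈ (≡.cong κ (≡.trans (≡.cong ℤtoℚ (≡.cong +_ (ℕ.+-comm 1 a))) (ℤtoℚ-+ (+ a) (+ 1)))))
    (trans (κ-+ (ℤtoℚ (+ a)) 1ℚ) (+-cong (κ-ℕ a) κ-1))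

  κ-neg-ℤ : ∀ z → κ (ℤtoℚ (ℤ.- z)) ≈ - κ (ℤtoℚ z)
  κ-neg-ℤ z = trans (solve 2 (λ x y → x := (x :+ y) :- y) refl (κ (ℤtoℚ (ℤ.- z))) (κ (ℤtoℚ z)))
    (trans (+-congʳ (trans (sym (trans (≡⇒≈ (≡.cong κ (ℤtoℚ-+ (ℤ.- z) z))) (κ-+ _ _)))
      (trans (≡⇒≈ (≡.cong (λ z → κ (ℤtoℚ z)) (ℤ.+-inverseˡ z))) κ-0))) (+-identityˡ _))

  κ-square : ∀ z → κ (Φ₂ z) ≈ κ (ℤtoℚ z) * κ (ℤtoℚ z)
  κ-square z = trans (≡⇒≈ (≡.cong κ (ℤtoℚ-* z z))) (κ-* _ _)

  μ : (ℤ → ℚ) → BSeries → Carrier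
  μ Φ f = ev (Mom Φ f)

  module _ (s : ℕ → ℤ) (s∈ : ∀ {a n} → a ≤ n → InRange n (s a)) where
    μ-geom : ∀ Φ k → μ Φ (geomSeries s s∈ (suc k)) ≈ Σ< N (λ a → κ (Φ (s a)) * (q ^ suc k) ^ a)
    μ-geom Φ k = trans (ev-cong (upto λ m _ → Mom-geom s s∈ (suc k) Φ m)) (ev-infSum (λ a → Φ (s a)) k)

    μ₀-geom : ∀ k → μ Φ₀ (geomSeries s s∈ (suc k)) ≈ I k
    μ₀-geom k = trans (μ-geom Φ₀ k) (Σ-cong N (λ a → trans (*-congʳ κ-1) (*-identityˡ _)))

  μ₁-geom : ∀ k → μ Φ₁ (geomZ (suc k)) ≈ I k * c k
  μ₁-geom k = trans (μ-geom (λ a → + a) +∈ Φ₁ k) (trans (Σ-cong N (λ a → *-congʳ (κ-ℕ a))) (Σνx (q ^ k)))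

  μ₁-geom⁻ : ∀ k → μ Φ₁ (geomZ⁻ (suc k)) ≈ - (I k * c k)
  μ₁-geom⁻ k = begin
    μ Φ₁ (geomZ⁻ (suc k))
      ≈⟨ μ-geom (λ a → ℤ.- (+ a)) -∈ Φ₁ k ⟩
    Σ< N (λ a → κ (ℤtoℚ (ℤ.- (+ a))) * (q ^ suc k) ^ a)
      ≈⟨ Σ-cong N (λ a → trans (*-congʳ (trans (κ-neg-ℤ (+ a)) (trans (-‿cong (κ-ℕ a)) (sym (-1*x≈-x (ν a))))))
           (*-assoc _ _ _)) ⟩
    Σ< N (λ a → - 1# * (ν a * (q ^ suc k) ^ a))
      ≈⟨ trans (Σ-*ˡ N _ _) (*-congˡ (Σνx (q ^ k))) ⟩
    - 1# * (I k * c k)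
      ≈⟨ -1*x≈-x _ ⟩
    - (I k * c k)  ∎

  μ₂-geom : ∀ k → μ Φ₂ (geomZ (suc k)) ≈ I k * (c k * c k + c k * c k + c k)
  μ₂-geom k = trans (μ-geom (λ a → + a) +∈ Φ₂ k)
    (trans (Σ-cong N (λ a → *-congʳ (trans (κ-square (+ a)) (*-cong (κ-ℕ a) (κ-ℕ a))))) (Σν²x (q ^ k)))

  μ₂-geom⁻ : ∀ k → μ Φ₂ (geomZ⁻ (suc k)) ≈ I k * (c k * c k + c k * c k + c k)
  μ₂-geom⁻ k = trans (μ-geom (λ a → ℤ.- (+ a)) -∈ Φ₂ k)
    (trans (Σ-cong N (λ a → *-congʳ (begin
        κ (Φ₂ (ℤ.- (+ a)))    ≈⟨ κ-square (ℤ.- (+ a)) ⟩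
        κ (ℤtoℚ (ℤ.- (+ a))) * κ (ℤtoℚ (ℤ.- (+ a)))
          ≈⟨ *-cong (trans (κ-neg-ℤ (+ a)) (-‿cong (κ-ℕ a))) (trans (κ-neg-ℤ (+ a)) (-‿cong (κ-ℕ a))) ⟩
        - ν a * - ν a         ≈⟨ trans (sym (-‿distribˡ-* _ _)) (trans (-‿cong (sym (-‿distribʳ-* _ _))) (-‿involutive _)) ⟩
        ν a * ν a             ∎))) (Σν²x (q ^ k)))

-- The generating function of the second rank moment

rankIs : ℤ → List ℕ → Set
rankIs k λp = rank λp ≡ k

rankIs? : ∀ k → Decidable (rankIs k)
rankIs? k λp = rank λp ℤ.≟ k

-- Bounds on largest part and length place every rank inside the window [-m, m] over which `N₂`
-- sums.
partsLE-bounded : ∀ k m → All (λ λp → largestPart λp ≤ k × length λp ≤ m) (partsLE k m)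
partsLE-bounded zero    zero    = (z≤n , z≤n) ∷ []
partsLE-bounded zero    (suc m) = []
partsLE-bounded (suc k) m = concat⁺ (map⁺ (All.map
  (λ {j} j*sk≤m → map⁺ (All.map (λ {λp} bounds → largest j (proj₁ bounds) , len j {λp} j*sk≤m (proj₂ bounds))
    (partsLE-bounded k (m ∸ j ℕ.* suc k))))
  (all-filter (λ j → j ℕ.* suc k ℕ.≤? m) (upTo (suc m)))))
  where
  largest : ∀ j {λp} → largestPart λp ≤ k → largestPart (replicate j (suc k) ++ λp) ≤ suc k
  largest zero    l≤k = ℕ.m≤n⇒m≤1+n l≤k
  largest (suc j) l≤k = ℕ.≤-refl
  len : ∀ j {λp} → j ℕ.* suc k ≤ m → length λp ≤ m ∸ j ℕ.* suc k → length (replicate j (suc k) ++ λp) ≤ m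
  len j {λp} j*sk≤m l≤ = begin
    length (replicate j (suc k) ++ λp)          ≡⟨ length-++ (replicate j (suc k)) ⟩
    length (replicate j (suc k)) ℕ.+ length λp  ≡⟨ ≡.cong (ℕ._+ length λp) (length-replicate j) ⟩
    j ℕ.+ length λp                             ≤⟨ ℕ.+-mono-≤ (ℕ.m≤m*n j (suc k)) l≤ ⟩
    j ℕ.* suc k ℕ.+ (m ∸ j ℕ.* suc k)           ≡⟨ ℕ.m+[n∸m]≡n j*sk≤m ⟩
    m                                           ∎
    where open ℕ.≤-Reasoning

rank∈ : ∀ m λp → largestPart λp ≤ m × length λp ≤ m → InRange m (rank λp)
rank∈ m λp (L≤m , l≤m) = L ℕ.+ (m ∸ l) , ℕ.+-mono-≤ L≤m (ℕ.m∸n≤m m l) , (begin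
  + L ℤ.- + l                              ≡⟨ Z.solve 3 (λ L l d → L Z.:- l Z.:= (L Z.:+ d) Z.:- (l Z.:+ d)) ≡.refl (+ L) (+ l) (+ (m ∸ l)) ⟩
  offset (l ℕ.+ (m ∸ l)) (L ℕ.+ (m ∸ l))   ≡⟨ ≡.cong (λ k → offset k (L ℕ.+ (m ∸ l))) (ℕ.m+[n∸m]≡n l≤m) ⟩
  offset m (L ℕ.+ (m ∸ l))                 ∎)
  where
  open ≡.≡-Reasoning
  L = largestPart λp
  l = length λp

indicator : ℤ → ℤ → ℚ
indicator r k = if does (r ℤ.≟ k) then 1ℚ else 0ℚ

count-∷ : ∀ λp λps k → ℕtoℚ (length (filter (rankIs? k) (λp ∷ λps)))
                       ≡ indicator (rank λp) k ℚ.+ ℕtoℚ (length (filter (rankIs? k) λps))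
count-∷ λp λps k with does (rank λp ℤ.≟ k)
... | true  = ℤtoℚ-+ (+ 1) (+ length (filter (rankIs? k) λps))
... | false = ≡.sym (ℚ.+-identityˡ _)

module RankSeries (R : CommutativeRing 0ℓ 0ℓ) (q : CommutativeRing.Carrier R) (n : ℕ)
                  (q^N≈0 : CommutativeRing._≈_ R (FiniteSums._^_ R q (suc n)) (CommutativeRing.0# R))
                  (coefficients : Coefficients R)
                  where
  open FiniteSums R
  open Nilpotent R q n q^N≈0
  open RankMoment R q n q^N≈0
  open PartitionSums R q n q^N≈0
  open Evaluation R q n q^N≈0 coefficients
  open Coefficients coefficients

  κ-rank : ∀ λp → κ (Φ₂ (rank λp)) ≈ rank² λp
  κ-rank λp = trans (κ-square (rank λp)) (*-cong linear linear)
    where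
    linear : κ (ℤtoℚ (rank λp)) ≈ ν (largestPart λp) - len λp
    linear = trans (≡⇒≈ (≡.cong κ (ℤtoℚ-+ (+ largestPart λp) (ℤ.- (+ length λp))))) (trans (κ-+ _ _)
      (+-cong (κ-ℕ (largestPart λp)) (trans (κ-neg-ℤ (+ length λp)) (-‿cong (κ-ℕ (length λp))))))

  -- Exchanging the sums turns Σ_k k² · (number of λ of rank k) into a sum of squared ranks; each λ
  -- is counted exactly once because its rank lies in the window.
  κ-ΣZ-rank : ∀ m λps → All (λ λp → InRange m (rank λp)) λps →
    κ (ΣZ m (λ k → Φ₂ k ℚ.* ℕtoℚ (length (filter (rankIs? k) λps)))) ≈ ΣL rank² λps
  κ-ΣZ-rank m [] [] = trans (≡⇒≈ (≡.cong κ
    (Q.Σ-zero (suc (m ℕ.+ m)) (λ i _ → ℚ.*-zeroʳ (Φ₂ (offset m i)))))) κ-0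
  κ-ΣZ-rank m (λp ∷ λps) (r∈ ∷ rs∈) = begin
    κ (ΣZ m (λ k → Φ₂ k ℚ.* ℕtoℚ (length (filter (rankIs? k) (λp ∷ λps)))))
      ≡⟨ ≡.cong κ (≡.trans (ΣZ-cong m (λ k → ≡.trans (≡.cong (Φ₂ k ℚ.*_) (count-∷ λp λps k))
             (ℚ.*-distribˡ-+ (Φ₂ k) (e k) (count k))))
           (ΣZ-+ m (λ k → Φ₂ k ℚ.* e k) (λ k → Φ₂ k ℚ.* count k))) ⟩
    κ (ΣZ m (λ k → Φ₂ k ℚ.* e k) ℚ.+ ΣZ m (λ k → Φ₂ k ℚ.* count k))
      ≈⟨ κ-+ _ _ ⟩
    κ (ΣZ m (λ k → Φ₂ k ℚ.* e k)) + κ (ΣZ m (λ k → Φ₂ k ℚ.* count k))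
      ≈⟨ +-cong (trans (≡⇒≈ (≡.cong κ single)) (κ-rank λp)) (κ-ΣZ-rank m λps rs∈) ⟩
    rank² λp + ΣL rank² λps  ∎
    where
    e count : ℤ → ℚ
    e = indicator (rank λp)
    count k = ℕtoℚ (length (filter (rankIs? k) λps))
    e-off : ∀ k → k ≢ rank λp → e k ≡ 0ℚ
    e-off k k≢ rewrite dec-false (rank λp ℤ.≟ k) (λ r≡k → k≢ (≡.sym r≡k)) = ≡.refl
    e-on : e (rank λp) ≡ 1ℚ
    e-on rewrite dec-true (rank λp ℤ.≟ rank λp) ≡.refl = ≡.refl
    single : ΣZ m (λ k → Φ₂ k ℚ.* e k) ≡ Φ₂ (rank λp)
    single = ≡.trans (ΣZ-single m (λ k → Φ₂ k ℚ.* e k) r∈ (λ k k≢ → ≡.trans (≡.cong (Φ₂ k ℚ.*_) (e-off k k≢)) (ℚ.*-zeroʳ (Φ₂ k))))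
      (≡.trans (≡.cong (Φ₂ (rank λp) ℚ.*_) e-on) (ℚ.*-identityʳ _))

  κ-N₂ : ∀ m → κ (N₂ m) ≈ ΣL rank² (partitions m)
  κ-N₂ m = trans (≡⇒≈ (≡.cong κ (sumZ≡ΣZ m (λ k → ℤtoℚ (k ℤ.* k) ℚ.* ℕtoℚ (Nrank k m)))))
    (κ-ΣZ-rank m (partitions m) (All.map (λ {λp} → rank∈ m λp) (partsLE-bounded m m)))

  ev-N₂ : ev N₂ ≈ (P N * g N - P N * T) + (P N * g N - P N * T)
  ev-N₂ = trans (Σ-cong N (λ m → trans (*-comm _ _) (*-congˡ (κ-N₂ m)))) rankGF

-- The generating function of the second crank moment

crankFactor : ℕ → BSeries
crankFactor k = geomZ (suc k) ⊛ᵇ geomZ⁻ (suc k)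

crankProduct : ℕ → BSeries
crankProduct k = bProdTo k crankFactor

Supported-geomZ⁻ : ∀ k → Supported (geomZ⁻ (suc k))
Supported-geomZ⁻ k = Supported-geom (λ a → ℤ.- (+ a)) -∈ (suc k)

Supported-crankFactor : ∀ k → Supported (crankFactor k)
Supported-crankFactor k = Supported-⊛ᵇ (geomZ (suc k)) (geomZ⁻ (suc k)) (Supported-geomZ⁻ k)

Supported-crankLimit : Supported (bInfProd crankFactor)
Supported-crankLimit n = Supported-⊛ᵇ (crankProduct n) (crankFactor n) (Supported-crankFactor n) n

-- The Leibniz rules for the z-moments of a product whose right factor is 1 to the working precision.
module Jets (R : CommutativeRing 0ℓ 0ℓ) where
  open FiniteSums R

  jet₁-unit : ∀ {a₀ a₁ b₀ b₁} → b₀ ≈ 1# → b₁ ≈ 0# → a₁ * b₀ + a₀ * b₁ ≈ a₁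
  jet₁-unit b₀≈1 b₁≈0 = trans (+-elimʳ (x*0≈0 b₁≈0)) (trans (*-congˡ b₀≈1) (*-identityʳ _))

  jet₂-unit : ∀ {a₀ a₁ a₂ b₀ b₁ b₂} → b₀ ≈ 1# → b₁ ≈ 0# → b₂ ≈ 0# →
              a₂ * b₀ + (a₁ * b₁ + a₁ * b₁) + a₀ * b₂ ≈ a₂
  jet₂-unit b₀≈1 b₁≈0 b₂≈0 = trans (+-elimʳ (x*0≈0 b₂≈0))
    (trans (+-elimʳ (trans (+-elimʳ (x*0≈0 b₁≈0)) (x*0≈0 b₁≈0))) (trans (*-congˡ b₀≈1) (*-identityʳ _)))

module CrankStability (K : ℕ) where
  private module S = FiniteSums (seriesRing K)
  open Jets (seriesRing K)

  Mom₀-* : ∀ f g → Supported g → Mom Φ₀ (f ⊛ᵇ g) S.≈ (Mom Φ₀ f ⊛ Mom Φ₀ g)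
  Mom₀-* f g supp = upto λ n _ → Mom₀-⊛ᵇ f g supp n

  Mom₁-* : ∀ f g → Supported g → Mom Φ₁ (f ⊛ᵇ g) S.≈ (Mom Φ₁ f ⊛ Mom Φ₀ g ⊕ Mom Φ₀ f ⊛ Mom Φ₁ g)
  Mom₁-* f g supp = upto λ n _ → Mom₁-⊛ᵇ f g supp n

  Mom₂-* : ∀ f g → Supported g → Mom Φ₂ (f ⊛ᵇ g) S.≈
           (Mom Φ₂ f ⊛ Mom Φ₀ g ⊕ (Mom Φ₁ f ⊛ Mom Φ₁ g ⊕ Mom Φ₁ f ⊛ Mom Φ₁ g) ⊕ Mom Φ₀ f ⊛ Mom Φ₂ g)
  Mom₂-* f g supp = upto λ n _ → Mom₂-⊛ᵇ f g supp n

  -- The moments of the series 1. A factor of this kind does not change moments of order at most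
  -- two, by the Leibniz rules.
  record Trivial (f : BSeries) : Set where
    constructor trivial
    field
      m₀ : Mom Φ₀ f S.≈ one
      m₁ : Mom Φ₁ f S.≈ 𝟘
      m₂ : Mom Φ₂ f S.≈ 𝟘
  open Trivial

  Trivial-geom : ∀ s (s∈ : ∀ {a n} → a ≤ n → InRange n (s a)) → s 0 ≡ + 0 → ∀ k → K ≤ suc k →
                 Trivial (geomSeries s s∈ (suc k))
  Trivial-geom s s∈ s0≡0 k K≤sk = trivial
    (upto λ i i<K → ≡.trans (constant Φ₀ i i<K) (ℚ.*-identityˡ (one i)))
    (upto λ i i<K → ≡.trans (constant Φ₁ i i<K) (≡.trans (≡.cong (λ z → Φ₁ z ℚ.* one i) s0≡0) (ℚ.*-zeroˡ (one i))))
    (upto λ i i<K → ≡.trans (constant Φ₂ i i<K) (≡.trans (≡.cong (λ z → Φ₂ z ℚ.* one i) s0≡0) (ℚ.*-zeroˡ (one i))))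
    where
    constant : ∀ Φ i → i < K → Mom Φ (geomSeries s s∈ (suc k)) i ≡ Φ (s 0) ℚ.* one i
    constant Φ i i<K = ≡.trans (Mom-geom s s∈ (suc k) Φ i) (≡.trans
      (sumTo≡Σ (suc i) (λ a → Φ (s a) ℚ.* mono (suc k ℕ.* a) i)) (≡.trans
      (Q.Σ-only-head i (λ a → Φ (s a) ℚ.* mono (suc k ℕ.* a) i) (λ a _ → ≡.trans
        (≡.cong (Φ (s (suc a)) ℚ.*_) (mono-≢ (ℕ.<-≤-trans i<K (ℕ.≤-trans K≤sk (ℕ.m≤m*n (suc k) (suc a))))))
        (ℚ.*-zeroʳ (Φ (s (suc a))))))
      (≡.cong (λ z → Φ (s 0) ℚ.* mono z i) (ℕ.*-zeroʳ (suc k)))))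

  Trivial-crankFactor : ∀ k → K ≤ suc k → Trivial (crankFactor k)
  Trivial-crankFactor k K≤sk = trivial
    (S.trans (Mom₀-* x y y∈) (S.trans (S.*-cong (m₀ tx) (m₀ ty)) (S.*-identityˡ one)))
    (S.trans (Mom₁-* x y y∈) (S.trans (jet₁-unit {Mom Φ₀ x} {Mom Φ₁ x} (m₀ ty) (m₁ ty)) (m₁ tx)))
    (S.trans (Mom₂-* x y y∈) (S.trans (jet₂-unit {Mom Φ₀ x} {Mom Φ₁ x} {Mom Φ₂ x} (m₀ ty) (m₁ ty) (m₂ ty)) (m₂ tx)))
    where
    x  = geomZ (suc k)
    y  = geomZ⁻ (suc k)
    y∈ = Supported-geomZ⁻ k
    tx = Trivial-geom (λ a → + a) +∈ ≡.refl k K≤sk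
    ty = Trivial-geom (λ a → ℤ.- (+ a)) -∈ ≡.refl k K≤sk

  stable : ∀ d k → K ≤ k → Mom Φ₂ (crankProduct (d ℕ.+ k)) S.≈ Mom Φ₂ (crankProduct k)
  stable zero    k K≤k = S.refl
  stable (suc d) k K≤k = S.trans (Mom₂-* x y (Supported-crankFactor (d ℕ.+ k)))
    (S.trans (jet₂-unit {Mom Φ₀ x} {Mom Φ₁ x} {Mom Φ₂ x} (m₀ ty) (m₁ ty) (m₂ ty)) (stable d k K≤k))
    where
    x  = crankProduct (d ℕ.+ k)
    y  = crankFactor (d ℕ.+ k)
    ty = Trivial-crankFactor (d ℕ.+ k) (ℕ.≤-trans K≤k (ℕ.m≤n⇒m≤1+n (ℕ.m≤n+m k d)))

-- Coefficient m of the limit uses m+1 factors. Modulo q^(m+1) the later ones are trivial, so N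
-- factors give the same coefficient.
Mom₂-crankLimit : ∀ N → Mom Φ₂ (bInfProd crankFactor) ≡ Mom Φ₂ (crankProduct N) mod N
Mom₂-crankLimit N = upto λ m m<N → ≡.trans
  (≡.sym (coeff (CrankStability.stable (suc m) (N ∸ suc m) (suc m) ℕ.≤-refl) m ℕ.≤-refl))
  (≡.cong (λ k → Mom Φ₂ (crankProduct k) m) (ℕ.m∸n+n≡m m<N))

module CrankSeries (R : CommutativeRing 0ℓ 0ℓ) (q : CommutativeRing.Carrier R) (n : ℕ)
                   (q^N≈0 : CommutativeRing._≈_ R (FiniteSums._^_ R q (suc n)) (CommutativeRing.0# R))
                   (coefficients : Coefficients R)
                   where
  open FiniteSums R
  open Nilpotent R q n q^N≈0
  open RankMoment R q n q^N≈0
  open Evaluation R q n q^N≈0 coefficients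
  open Coefficients coefficients
  open CrankStability N using (Mom₀-*; Mom₁-*; Mom₂-*)

  μ₀-⊛ᵇ : ∀ f g → Supported g → μ Φ₀ (f ⊛ᵇ g) ≈ μ Φ₀ f * μ Φ₀ g
  μ₀-⊛ᵇ f g supp = trans (ev-cong (Mom₀-* f g supp)) (ev-⊛ (Mom Φ₀ f) (Mom Φ₀ g))

  μ₁-⊛ᵇ : ∀ f g → Supported g → μ Φ₁ (f ⊛ᵇ g) ≈ μ Φ₁ f * μ Φ₀ g + μ Φ₀ f * μ Φ₁ g
  μ₁-⊛ᵇ f g supp = trans (ev-cong (Mom₁-* f g supp)) (trans (ev-⊕ N (Mom Φ₁ f ⊛ Mom Φ₀ g) (Mom Φ₀ f ⊛ Mom Φ₁ g))
    (+-cong (ev-⊛ (Mom Φ₁ f) (Mom Φ₀ g)) (ev-⊛ (Mom Φ₀ f) (Mom Φ₁ g))))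

  μ₂-⊛ᵇ : ∀ f g → Supported g →
          μ Φ₂ (f ⊛ᵇ g) ≈ μ Φ₂ f * μ Φ₀ g + (μ Φ₁ f * μ Φ₁ g + μ Φ₁ f * μ Φ₁ g) + μ Φ₀ f * μ Φ₂ g
  μ₂-⊛ᵇ f g supp = trans (ev-cong (Mom₂-* f g supp))
    (trans (ev-⊕ N (f₂ ⊛ g₀ ⊕ (f₁ ⊛ g₁ ⊕ f₁ ⊛ g₁)) (f₀ ⊛ g₂)) (+-cong
      (trans (ev-⊕ N (f₂ ⊛ g₀) (f₁ ⊛ g₁ ⊕ f₁ ⊛ g₁))
        (+-cong (ev-⊛ f₂ g₀) (trans (ev-⊕ N (f₁ ⊛ g₁) (f₁ ⊛ g₁)) (+-cong (ev-⊛ f₁ g₁) (ev-⊛ f₁ g₁)))))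
      (ev-⊛ f₀ g₂)))
    where
    f₀ = Mom Φ₀ f
    f₁ = Mom Φ₁ f
    f₂ = Mom Φ₂ f
    g₀ = Mom Φ₀ g
    g₁ = Mom Φ₁ g
    g₂ = Mom Φ₂ g

  μ₀-factor : ∀ k → μ Φ₀ (crankFactor k) ≈ I k * I k
  μ₀-factor k = trans (μ₀-⊛ᵇ (geomZ (suc k)) (geomZ⁻ (suc k)) (Supported-geomZ⁻ k))
    (*-cong (μ₀-geom (λ a → + a) +∈ k) (μ₀-geom (λ a → ℤ.- (+ a)) -∈ k))

  -- The factor is symmetric under z ↦ 1/z. This removes the cross terms from the second moment of
  -- the product.
  μ₁-factor : ∀ k → μ Φ₁ (crankFactor k) ≈ 0#
  μ₁-factor k = begin
    μ Φ₁ (crankFactor k)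
      ≈⟨ μ₁-⊛ᵇ (geomZ (suc k)) (geomZ⁻ (suc k)) (Supported-geomZ⁻ k) ⟩
    _ ≈⟨ +-cong (*-cong (μ₁-geom k) (μ₀-geom (λ a → ℤ.- (+ a)) -∈ k)) (*-cong (μ₀-geom (λ a → + a) +∈ k) (μ₁-geom⁻ k)) ⟩
    I k * c k * I k + I k * - (I k * c k)
      ≈⟨ +-cong (solve 2 (λ i c → i :* c :* i := i :* (i :* c)) refl (I k) (c k)) (sym (-‿distribʳ-* _ _)) ⟩
    I k * (I k * c k) - I k * (I k * c k)
      ≈⟨ -‿inverseʳ _ ⟩
    0#  ∎
    where open Algebra.Properties.Ring ring using (-‿distribʳ-*)

  -- Total mass times the variance of a difference of two independent geometric variables, each of
  -- variance `c k * I k`.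
  μ₂-factor : ∀ k → μ Φ₂ (crankFactor k) ≈ I k * I k * (c k * I k + c k * I k)
  μ₂-factor k = begin
    μ Φ₂ (crankFactor k)
      ≈⟨ μ₂-⊛ᵇ (geomZ (suc k)) (geomZ⁻ (suc k)) (Supported-geomZ⁻ k) ⟩
    _ ≈⟨ +-cong (+-cong (*-cong (μ₂-geom k) i⁻) (+-cong cross cross)) (*-cong (μ₀-geom (λ a → + a) +∈ k) (μ₂-geom⁻ k)) ⟩
    I k * (c k * c k + c k * c k + c k) * I k + ((0# - z) + (0# - z)) + I k * (I k * (c k * c k + c k * c k + c k))
      ≈⟨ solve 2 (λ i c → i :* (c :* c :+ c :* c :+ c) :* i :+ ((con (+ 0) :- i :* c :* (i :* c)) :+ (con (+ 0) :- i :* c :* (i :* c))) :+ i :* (i :* (c :* c :+ c :* c :+ c)) :=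
           i :* i :* (c :* (con (+ 1) :+ c) :+ c :* (con (+ 1) :+ c))) refl (I k) (c k) ⟩
    I k * I k * (c k * (1# + c k) + c k * (1# + c k))
      ≈⟨ *-congˡ (+-cong (*-congˡ (I≈1+c k)) (*-congˡ (I≈1+c k))) ⟨
    I k * I k * (c k * I k + c k * I k)  ∎
    where
    open Algebra.Properties.Ring ring using (-‿distribʳ-*)
    z = I k * c k * (I k * c k)
    i⁻ = μ₀-geom (λ a → ℤ.- (+ a)) -∈ k
    cross : μ Φ₁ (geomZ (suc k)) * μ Φ₁ (geomZ⁻ (suc k)) ≈ 0# - z
    cross = trans (*-cong (μ₁-geom k) (μ₁-geom⁻ k)) (trans (sym (-‿distribʳ-* _ _)) (sym (+-identityˡ _)))

  μ-bone : ∀ Φ → μ Φ bone ≈ κ (Φ (+ 0))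
  μ-bone Φ = trans (ev-cong (upto λ m _ → Mom-bmono Φ (+ 0) 0 m (0∈ m)))
    (trans (ev-scale N (Φ (+ 0)) one) (trans (*-congˡ (ev-mono 0)) (*-identityʳ _)))

  μ₀-product : ∀ k → μ Φ₀ (crankProduct k) ≈ P k * P k
  μ₀-product zero    = trans (μ-bone Φ₀) (trans κ-1 (sym (*-identityˡ 1#)))
  μ₀-product (suc k) = trans (μ₀-⊛ᵇ (crankProduct k) (crankFactor k) (Supported-crankFactor k))
    (trans (*-cong (μ₀-product k) (μ₀-factor k)) (solve 2 (λ p i → p :* p :* (i :* i) := p :* i :* (p :* i)) refl (P k) (I k)))

  μ₂-product : ∀ k → μ Φ₂ (crankProduct k) ≈ P k * P k * (g k + g k)
  μ₂-product zero    = trans (μ-bone Φ₂) (trans κ-0 (sym (x*0≈0 (+-identityʳ 0#))))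
  μ₂-product (suc k) = begin
    μ Φ₂ (crankProduct (suc k))
      ≈⟨ μ₂-⊛ᵇ (crankProduct k) (crankFactor k) (Supported-crankFactor k) ⟩
    _ ≈⟨ +-cong (+-elimʳ (trans (+-elimʳ (x*0≈0 (μ₁-factor k))) (x*0≈0 (μ₁-factor k)))) refl ⟩
    μ Φ₂ (crankProduct k) * μ Φ₀ (crankFactor k) + μ Φ₀ (crankProduct k) * μ Φ₂ (crankFactor k)
      ≈⟨ +-cong (*-cong (μ₂-product k) (μ₀-factor k)) (*-cong (μ₀-product k) (μ₂-factor k)) ⟩
    P k * P k * (g k + g k) * (I k * I k) + P k * P k * (I k * I k * (c k * I k + c k * I k))
      ≈⟨ solve 4 (λ p g i c → p :* p :* (g :+ g) :* (i :* i) :+ p :* p :* (i :* i :* (c :* i :+ c :* i)) :=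
           p :* i :* (p :* i) :* (g :+ c :* i :+ (g :+ c :* i))) refl (P k) (g k) (I k) (c k) ⟩
    P (suc k) * P (suc k) * (g (suc k) + g (suc k))  ∎

  μ-lift : ∀ Φ f → μ Φ (lift f) ≈ κ (Φ (+ 0)) * ev f
  μ-lift Φ f = trans (ev-cong (upto λ m _ → Mom-lift Φ f m)) (ev-scale N (Φ (+ 0)) f)

  ev-M₂ : ev M₂ ≈ P N * g N + P N * g N
  ev-M₂ = begin
    μ Φ₂ crankGF
      ≈⟨ μ₂-⊛ᵇ (lift (poch∞ 1 1)) (bInfProd crankFactor) Supported-crankLimit ⟩
    _ ≈⟨ +-cong (+-cong (0*y≈0 lift₂) (trans (+-cong (0*y≈0 lift₁) (0*y≈0 lift₁)) (+-identityˡ 0#)))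
                (*-cong lift₀ (trans (ev-cong (Mom₂-crankLimit N)) (μ₂-product N))) ⟩
    0# + 0# + F N * (P N * P N * (g N + g N))
      ≈⟨ solve 3 (λ f p g → con (+ 0) :+ con (+ 0) :+ f :* (p :* p :* (g :+ g)) := f :* p :* (p :* g :+ p :* g)) refl (F N) (P N) (g N) ⟩
    F N * P N * (P N * g N + P N * g N)
      ≈⟨ trans (*-congʳ (FP≈1 N)) (*-identityˡ _) ⟩
    P N * g N + P N * g N  ∎
    where
    lift₀ : μ Φ₀ (lift (poch∞ 1 1)) ≈ F N
    lift₀ = trans (μ-lift Φ₀ (poch∞ 1 1)) (trans (*-cong κ-1 ev-poch) (*-identityˡ _))
    lift₁ : μ Φ₁ (lift (poch∞ 1 1)) ≈ 0#
    lift₁ = trans (μ-lift Φ₁ (poch∞ 1 1)) (0*y≈0 κ-0)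
    lift₂ : μ Φ₂ (lift (poch∞ 1 1)) ≈ 0#
    lift₂ = trans (μ-lift Φ₂ (poch∞ 1 1)) (0*y≈0 κ-0)

-- Comparison of the two sides

module Identities (R : CommutativeRing 0ℓ 0ℓ) (q : CommutativeRing.Carrier R) (n : ℕ)
                  (q^N≈0 : CommutativeRing._≈_ R (FiniteSums._^_ R q (suc n)) (CommutativeRing.0# R))
                  (coefficients : Coefficients R)
                  where
  open FiniteSums R
  open Nilpotent R q n q^N≈0
  open RankMoment R q n q^N≈0 using (g)
  open QIdentities R q n q^N≈0 using (p; p^N≈0; module Base²)
  open Coefficients coefficients
  open Evaluation R p n p^N≈0 coefficients using (ev)

  -- The sums in the theorem start at n = 1, whereas `ev` starts at 0 and stops before N. The term
  -- at 0 vanishes by hypothesis, and the one at N because p^N = 0.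
  dropConstant : ∀ a → a 0 ≡ 0ℚ → Σ< N (λ m → κ (a (suc m)) * p ^ suc m) ≈ ev a
  dropConstant a a0≡0 = sym (trans (Σ-shift N _ (x*0≈0 p^N≈0))
    (trans (+-congʳ (0*y≈0 (trans (≡⇒≈ (≡.cong κ a0≡0)) κ-0))) (+-identityˡ _)))

  ΣN₂ : Σ< N (λ m → κ (N₂ (suc m)) * p ^ suc m)
          ≈ (Base².P N * Base².g N - Base².P N * Base².T) + (Base².P N * Base².g N - Base².P N * Base².T)
  ΣN₂ = trans (dropConstant N₂ ≡.refl) (RankSeries.ev-N₂ R p n p^N≈0 coefficients)

  ΣM₂ : Σ< N (λ m → κ (M₂ (suc m)) * p ^ suc m) ≈ Base².P N * Base².g N + Base².P N * Base².g N
  ΣM₂ = trans (dropConstant M₂ M₂0≡0) (CrankSeries.ev-M₂ R p n p^N≈0 coefficients)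
    where
    M₂0≡0 : M₂ 0 ≡ 0ℚ
    M₂0≡0 = ≡.trans (ℚ.+-identityˡ _) (ℚ.*-zeroˡ (Mcrank (+ 0) 0))

  rank-side : Base².P N * (g N - Base².g N + Base².T)
                ≈ Base².P N * g N - (Base².P N * Base².g N - Base².P N * Base².T)
  rank-side = solve 4 (λ p g h t → p :* (g :- h :+ t) := p :* g :- (p :* h :- p :* t)) refl (Base².P N) (g N) (Base².g N) Base².T

  crank-side : Base².P N * (g N - Base².g N) ≈ Base².P N * g N - Base².P N * Base².g N
  crank-side = solve 3 (λ p g h → p :* (g :- h) := p :* g :- p :* h) refl (Base².P N) (g N) (Base².g N)

module Comparison (n : ℕ) where
  open Translation n

  coefficients : Coefficients (seriesRing (suc n))
  coefficients = record
    { κ = const ; κ-0 = const-0 ; κ-1 = const-1 ; κ-+ = const-+ ; κ-* = const-mul ; κ-neg = const-neg }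

  open FiniteSums (seriesRing (suc n)) using (_≈_; trans; sym)
  open Identities (seriesRing (suc n)) q n (q^N≈0 (suc n)) coefficients

  lhs₁≈rhs₁ : lhs₁ ≈ rhs₁
  lhs₁≈rhs₁ = trans lhs₁≈ (trans rank-side (sym (rhs≈ N₂ _ ΣN₂)))

  lhs₂≈rhs₂ : lhs₂ ≈ rhs₂
  lhs₂≈rhs₂ = trans lhs₂≈ (trans crank-side (sym (rhs≈ M₂ _ ΣM₂)))

-- Coefficient n is read off in the ring modulo q^(n+1), so the precision grows with the
-- coefficient.
theorem1 : ((n : ℕ) → lhs₁ n ≡ rhs₁ n) × ((n : ℕ) → lhs₂ n ≡ rhs₂ n)
theorem1 = (λ n → coeff (Comparison.lhs₁≈rhs₁ n) n (ℕ.n<1+n n)) , (λ n → coeff (Comparison.lhs₂≈rhs₂ n) n (ℕ.n<1+n n))
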